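{- For every constant $\gamma>0$ there exists an integer $n_0=n_0(\gamma)$ such that for all $n\ge n_0$ with $4\mid n$, $$t^3_2(n,K_4^3-e)\le \left(\tfrac12+\gamma\right)n.$$
   Context: A 3-graph $H$ is a pair $(V(H),E(H))$ where $V(H)$ is a finite set of vertices and $E(H)$ is a set of 3-element subsets of $V(H)$; its order is $|V(H)|$. For a 2-set $T$ of vertices, $\deg(T)$ is the number of vertices $v$ such that $T\cup\{v\}$ is an edge of $H$, and $\delta_2(H)$ is the minimum of $\deg(T)$ over all 2-element subsets $T$ of $V(H)$. $K_4^3-e$ denotes the 3-graph on 4 vertices with exactly 3 edges. For a 3-graph $F$, an $F$-factor in $H$ is a spanning subgraph of $H$ consisting of vertex-disjoint copies of $F$ (copies are not required to be induced). For $n$ divisible by $|V(F)|$, $t^3_2(n,F)$ is the smallest integer $d$ such that every 3-graph $H$ of order $n$ with $\delta_2(H)\ge d$ contains an $F$-factor. -}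

module Defs where

open import Data.Bool using (Bool; T; _∧_)
open import Data.Bool.Properties using (T-∧)
open import Data.Fin using (Fin; zero)
import Data.Fin.Properties as Fin
open import Data.Fin.Subset using (Subset; ∣_∣; _∪_; ⁅_⁆)
open import Data.Fin.Subset.Properties using (_∈?_)
open import Data.Integer using (+_)
open import Data.List using (List; map; filter; allFin; cartesianProduct)
open import Data.List.Extrema.Nat using (min)
open import Data.Nat using (ℕ; zero; suc; _≤_; _≡ᵇ_; _⊔_)
open import Data.Nat.Properties using (≡ᵇ⇒≡; ≤-trans; m≤m⊔n; m≤n⊔m)
open import Data.Product using (∃; _×_; _,_; proj₁; proj₂)
open import Data.Rational as ℚ using (ℚ; 0ℚ; 1ℚ; ½)
import Data.Rational.Properties as ℚ
open import Data.Rational.Solver using (module +-*-Solver)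
open import Data.Vec using (tabulate)
open import Function using (Equivalence; Injective)
open import Relation.Binary.PropositionalEquality
  using (_≡_; refl; sym; trans; cong; subst)
open import Relation.Nullary using (does; ¬?; _×-dec_)

-- A real number is represented by a Cauchy sequence of rationals.

record ℝ : Set where
  field
    seq    : ℕ → ℚ
    cauchy : ∀ ε → 0ℚ ℚ.< ε →
             ∃ λ N → ∀ i j → N ≤ i → N ≤ j → ℚ.∣ seq i ℚ.- seq j ∣ ℚ.≤ ε

open ℝ public

-- The intended equality of reals is x ≤ℝ y × y ≤ℝ x, not _≡_.
infix 4 _<ℝ_ _≤ℝ_

_<ℝ_ : ℝ → ℝ → Set
x <ℝ y = ∃ λ ε → 0ℚ ℚ.< ε × ∃ λ N → ∀ i → N ≤ i → seq x i ℚ.+ ε ℚ.≤ seq y i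

_≤ℝ_ : ℝ → ℝ → Set
x ≤ℝ y = ∀ ε → 0ℚ ℚ.< ε → ∃ λ N → ∀ i → N ≤ i → seq x i ℚ.≤ seq y i ℚ.+ ε

fromℚ : ℚ → ℝ
fromℚ q .seq _ = q
fromℚ q .cauchy ε ε>0 =
  0 , λ _ _ _ _ → subst (ℚ._≤ ε) (sym (cong ℚ.∣_∣ (ℚ.+-inverseʳ q))) (ℚ.<⇒≤ ε>0)

fromℕ : ℕ → ℝ
fromℕ n = fromℚ (+ n ℚ./ 1)

infixl 6 _+ℝ_

_+ℝ_ : ℝ → ℝ → ℝ
(x +ℝ y) .seq i = seq x i ℚ.+ seq y i
(x +ℝ y) .cauchy ε ε>0 = M ⊔ N , close
  where
  ε/2>0 : 0ℚ ℚ.< ε ℚ.* ½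
  ε/2>0 = ℚ.*-monoˡ-<-pos ½ ε>0

  M N : ℕ
  M = proj₁ (cauchy x (ε ℚ.* ½) ε/2>0)
  N = proj₁ (cauchy y (ε ℚ.* ½) ε/2>0)

  regroup : ∀ a b c d → (a ℚ.+ b) ℚ.- (c ℚ.+ d) ≡ (a ℚ.- c) ℚ.+ (b ℚ.- d)
  regroup = solve 4 (λ a b c d → (a :+ b) :- (c :+ d) := (a :- c) :+ (b :- d)) refl
    where open +-*-Solver

  halves : ε ℚ.* ½ ℚ.+ ε ℚ.* ½ ≡ ε
  halves = trans (sym (ℚ.*-distribˡ-+ ε ½ ½)) (ℚ.*-identityʳ ε)

  close : ∀ i j → M ⊔ N ≤ i → M ⊔ N ≤ j →
          ℚ.∣ (seq x i ℚ.+ seq y i) ℚ.- (seq x j ℚ.+ seq y j) ∣ ℚ.≤ ε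
  close i j i≥ j≥ = begin
    ℚ.∣ (seq x i ℚ.+ seq y i) ℚ.- (seq x j ℚ.+ seq y j) ∣
      ≡⟨ cong ℚ.∣_∣ (regroup (seq x i) (seq y i) (seq x j) (seq y j)) ⟩
    ℚ.∣ (seq x i ℚ.- seq x j) ℚ.+ (seq y i ℚ.- seq y j) ∣
      ≤⟨ ℚ.∣p+q∣≤∣p∣+∣q∣ (seq x i ℚ.- seq x j) (seq y i ℚ.- seq y j) ⟩
    ℚ.∣ seq x i ℚ.- seq x j ∣ ℚ.+ ℚ.∣ seq y i ℚ.- seq y j ∣
      ≤⟨ ℚ.+-mono-≤
           (proj₂ (cauchy x (ε ℚ.* ½) ε/2>0) i j
             (≤-trans (m≤m⊔n M N) i≥) (≤-trans (m≤m⊔n M N) j≥))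
           (proj₂ (cauchy y (ε ℚ.* ½) ε/2>0) i j
             (≤-trans (m≤n⊔m M N) i≥) (≤-trans (m≤n⊔m M N) j≥)) ⟩
    ε ℚ.* ½ ℚ.+ ε ℚ.* ½
      ≡⟨ halves ⟩
    ε ∎
    where open ℚ.≤-Reasoning

infixl 7 _·_

_·_ : ℕ → ℝ → ℝ
zero  · x = fromℚ 0ℚ
suc n · x = x +ℝ n · x

-- The vertex set is Fin n, so n is the order.

record 3Graph (n : ℕ) : Set where
  field
    edge    : Subset n → Bool
    uniform : ∀ s → T (edge s) → ∣ s ∣ ≡ 3

open 3Graph public

deg : ∀ {n} → 3Graph n → Subset n → ℕ
deg H S = ∣ tabulate (λ v → edge H (S ∪ ⁅ v ⁆)) ∣

-- The first argument of min is only the value on the empty list (n < 2):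
-- every degree is at most n.
δ₂ : ∀ {n} → 3Graph n → ℕ
δ₂ {n} H = min n (map (λ (u , v) → deg H (⁅ u ⁆ ∪ ⁅ v ⁆)) distinctPairs)
  where
  distinctPairs : List (Fin n × Fin n)
  distinctPairs =
    filter (λ (u , v) → ¬? (u Fin.≟ v)) (cartesianProduct (allFin n) (allFin n))

-- The edges are the three 3-element subsets containing vertex zero.
K₄³-e : 3Graph 4
K₄³-e .edge s = does (zero ∈? s) ∧ (∣ s ∣ ≡ᵇ 3)
K₄³-e .uniform s e =
  ≡ᵇ⇒≡ ∣ s ∣ 3 (proj₂ (Equivalence.to (T-∧ {does (zero ∈? s)}) e))

image : ∀ {m n} → (Fin m → Fin n) → Subset m → Subset n
image f s = tabulate λ v → does (Fin.any? λ u → (u ∈? s) ×-dec (f u Fin.≟ v))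

-- A not necessarily induced copy of F in H, given by an embedding.
record Copy {m n} (F : 3Graph m) (H : 3Graph n) : Set where
  field
    vertex     : Fin m → Fin n
    injective  : Injective _≡_ _≡_ vertex
    preserves  : ∀ s → T (edge F s) → T (edge H (image vertex s))

open Copy public

record Factor {m n} (F : 3Graph m) (H : 3Graph n) : Set where
  field
    size     : ℕ
    copy     : Fin size → Copy F H
    disjoint : ∀ i j u v → vertex (copy i) u ≡ vertex (copy j) v → i ≡ j
    spanning : ∀ w → ∃ λ i → ∃ λ u → vertex (copy i) u ≡ w

ForcesFactor : ∀ {m} → ℕ → 3Graph m → ℕ → Set
ForcesFactor n F d = (H : 3Graph n) → d ≤ δ₂ H → Factor F H

-- t is the number t³₂(n, F).
IsThreshold : ∀ {m} → ℕ → 3Graph m → ℕ → Set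
IsThreshold n F t = ForcesFactor n F t × (∀ d → ForcesFactor n F d → t ≤ d)

{-# OPTIONS --safe #-}
module Submission where

-- Absorption. Call a copy of K₄³-e a tile, and call two vertices x, y exchangeable if many words s
-- of bounded length make both x ∷ s and y ∷ s unions of tiles. The vertices completing a given
-- edge to a tile, i.e. those adjacent to two of its pairs, number at least n/4 and are mutually
-- exchangeable. If not all vertices are exchangeable after boundedly many compositions, then at some
-- stable level there is a class P with n/4 < |P| ≤ (1/2 + o(1)) n, and the completions of almost
-- every edge lie inside P or outside P. The three pairs inside a triple of P have total codegree
-- above 3n/2, so many tiles have three vertices in P. This yields a vertex a and, in its link, a
-- vertex b of P adjacent to at least half of P; let e′ be a neighbour of b outside P and f a common
-- neighbour of b and e′. Since P is a class, f is not in P, the neighbourhoods of e′ and f in P are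
-- disjoint from that of b, and the edge a e′ f is completed by b ∈ P, so that e′ and f have almost
-- no common neighbour outside P. Then the degrees of e′ and f in the link of a sum up to at most n,
-- a contradiction. So all vertices are exchangeable, every 4-set has a positive density of
-- absorbers, and a greedy choice yields a small set that absorbs any bounded number of 4-sets.
--
-- Almost perfect tilings. Given a tiling of the remaining vertices with uncovered set L, let T grow
-- from L as follows: if a vertex s of a tile has many triangles of its link in T, then the other
-- three vertices of the tile are added to T. Every vertex of T can be uncovered by exchanging
-- boundedly many tiles, so T contains few tiles if the tiling cannot be enlarged, and hence has edge
-- density at most 1/3. The links of the vertices of unaffected tiles have density at most 1/2 in T
-- by Mantel's theorem. Summing the codegrees of the pairs of T gives at most n/2 on average unless
-- L is bounded; a bounded L is absorbed.
--
-- The threshold exists constructively because there are finitely many edge functions.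

-- All estimates live in ℕ. The degree excess is a number `g` with `n + 2 * g ≤ 2 * D` and
-- `n ≤ k * g`, a density of at least `1 / c` among the words of length `m` reads
-- `n ^ m ≤ c * count`, and most inequalities are weighted sums of earlier ones, certified by `lin`.
-- Words may repeat letters and unions of tiles are multisets, so that exchanges compose without
-- disjointness conditions. Distinctness is imposed once, when a word is selected (`rainbow`):
-- collisions spoil only a proportion of order `1 / n` of the words. The obstacle to absorption is a
-- splitting of the vertices into two halves that cannot be exchanged with each other.
-- Exchangeability at a fixed density is not transitive, hence classes exist only approximately:
-- each composition costs density and length. With `E`, a power of `k`, fixed in advance, a
-- pigeonhole argument over `2 * E` levels finds two consecutive ones between which a class grows by
-- at most `n / E`. The number of levels, and with it every density, depends on `k` alone.

import Data.Bool as Bool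
open import Data.Bool using (Bool; true; false; _∧_; _∨_; not; if_then_else_)
import Data.Bool.Properties as Bool
open import Data.Empty using (⊥; ⊥-elim)
open import Data.Fin using (Fin; zero; suc)
import Data.Fin.Properties as Fin
open import Data.List
  using (List; []; _∷_; _++_; length; map; allFin; tabulate; cartesianProductWith; concat;
    cartesianProduct; filterᵇ)
open import Data.List.Membership.Propositional using (_∈_; lose)
open import Data.List.Membership.Propositional.Properties
  using (∈-allFin; ∈-cartesianProductWith⁺; ∈-cartesianProduct⁺; ∈-++⁻; ∈-++⁺ˡ; ∈-++⁺ʳ)
open import Data.List.Properties using (length-++; length-tabulate; map-tabulate; length-map)
import Data.List.Relation.Unary.All as All
open import Data.List.Relation.Unary.All using (All; []; _∷_)
import Data.List.Relation.Unary.All.Properties as All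
open import Data.List.Relation.Unary.Any using (here; there; Any; any?; satisfied)
import Data.Nat as ℕ
open import Data.Nat
  using (ℕ; zero; suc; _+_; _*_; _^_; _≤_; _<_; _≤ᵇ_; z≤n; s≤s; _≤?_; _⊔_; _∸_; >-nonZero)
open import Data.Nat.DivMod using (_/_; _%_; m≡m%n+[m/n]*n; m%n<n; m/n*n≤m)
open import Data.Nat.Divisibility using (_∣_; divides; ∣m+n∣m⇒∣n)
open import Data.Nat.Properties
open import Data.Nat.Tactic.RingSolver using (solve-∀)
open import Data.Product using (∃; _×_; _,_; proj₁; proj₂)
open import Data.Sum using (_⊎_; inj₁; inj₂)
open import Function using (_∘_; id)
open import Relation.Binary.PropositionalEquality
open import Relation.Nullary using (¬_; Dec; yes; no; does; _×-dec_)
open import Relation.Nullary.Decidable using (dec-true; map′)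

-- A certificate for linear arithmetic: the second premise is a semiring identity.
lin : ∀ {a b P Q} s → P ≤ Q → b + P ≡ a + Q + s → a ≤ b
lin {a} {b} {P} {Q} s P≤Q eq = +-cancelʳ-≤ P a b (begin
  a + P      ≤⟨ +-monoʳ-≤ a P≤Q ⟩
  a + Q      ≤⟨ m≤m+n (a + Q) s ⟩
  a + Q + s  ≡⟨ eq ⟨
  b + P      ∎)
  where open ≤-Reasoning

infixl 6 _⊕_
_⊕_ : ∀ {a b c d} → a ≤ b → c ≤ d → a + c ≤ b + d
_⊕_ = +-mono-≤

infixr 7 _⊙_
_⊙_ : ∀ c {a b} → a ≤ b → c * a ≤ c * b
c ⊙ h = *-monoʳ-≤ c h

𝟙 : Bool → ℕ
𝟙 true  = 1
𝟙 false = 0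

𝟙≤1 : ∀ b → 𝟙 b ≤ 1
𝟙≤1 true  = s≤s z≤n
𝟙≤1 false = z≤n

𝟙-true : ∀ {b} → b ≡ true → 𝟙 b ≡ 1
𝟙-true refl = refl

𝟙-pos : ∀ {b} → 1 ≤ 𝟙 b → b ≡ true
𝟙-pos {true} _ = refl

≤ᵇ-true : ∀ {m n} → m ≤ n → (m ≤ᵇ n) ≡ true
≤ᵇ-true {m} {n} h with m ≤ᵇ n | ≤⇒≤ᵇ h
... | true | _ = refl

true-≤ᵇ : ∀ {m n} → (m ≤ᵇ n) ≡ true → m ≤ n
true-≤ᵇ {m} {n} h = ≤ᵇ⇒≤ m n (subst Bool.T (sym h) _)

≤ᵇ-false : ∀ {m n} → n < m → (m ≤ᵇ n) ≡ false
≤ᵇ-false {m} {n} h with m ≤ᵇ n in eq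
... | false = refl
... | true  = ⊥-elim (<⇒≱ h (true-≤ᵇ eq))

false-≤ᵇ : ∀ {m n} → (m ≤ᵇ n) ≡ false → n < m
false-≤ᵇ {m} {n} h = ≰⇒> λ m≤n → case-⊥ (trans (sym (≤ᵇ-true m≤n)) h)
  where
  case-⊥ : true ≡ false → ⊥
  case-⊥ ()

∧-true : ∀ {a b} → a ∧ b ≡ true → a ≡ true × b ≡ true
∧-true {true} h = refl , h

does-sound : ∀ {P : Set} (d : Dec P) → does d ≡ true → P
does-sound (yes p) _ = p

infixr 6 _∧ᵗ_
_∧ᵗ_ : ∀ {a b} → a ≡ true → b ≡ true → a ∧ b ≡ true
refl ∧ᵗ h = h

-- Finite sums

∑ : ∀ {A : Set} → List A → (A → ℕ) → ℕ
∑ []       f = 0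
∑ (x ∷ xs) f = f x + ∑ xs f

syntax ∑ xs (λ x → t) = ∑[ x ← xs ] t
infixr 8 ∑

module _ {A : Set} where

  ∑-cong : ∀ (xs : List A) {f g : A → ℕ} → (∀ x → f x ≡ g x) → ∑ xs f ≡ ∑ xs g
  ∑-cong []       h = refl
  ∑-cong (x ∷ xs) h = cong₂ _+_ (h x) (∑-cong xs h)

  ∑-mono∈ : ∀ (xs : List A) {f g : A → ℕ} → (∀ x → x ∈ xs → f x ≤ g x) → ∑ xs f ≤ ∑ xs g
  ∑-mono∈ []       h = z≤n
  ∑-mono∈ (x ∷ xs) h = h x (here refl) ⊕ ∑-mono∈ xs (λ y p → h y (there p))

  ∑-mono : ∀ (xs : List A) {f g : A → ℕ} → (∀ x → f x ≤ g x) → ∑ xs f ≤ ∑ xs g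
  ∑-mono xs h = ∑-mono∈ xs (λ x _ → h x)

  ∑-+ : ∀ (xs : List A) (f g : A → ℕ) → ∑[ x ← xs ] (f x + g x) ≡ ∑ xs f + ∑ xs g
  ∑-+ []       f g = refl
  ∑-+ (x ∷ xs) f g = trans (cong (f x + g x +_) (∑-+ xs f g)) (eq (f x) (g x) (∑ xs f) (∑ xs g))
    where
    eq : ∀ a b c d → a + b + (c + d) ≡ a + c + (b + d)
    eq = solve-∀

  ∑-*ˡ : ∀ c (xs : List A) (f : A → ℕ) → ∑[ x ← xs ] (c * f x) ≡ c * ∑ xs f
  ∑-*ˡ c []       f = sym (*-zeroʳ c)
  ∑-*ˡ c (x ∷ xs) f = trans (cong (c * f x +_) (∑-*ˡ c xs f)) (sym (*-distribˡ-+ c (f x) _))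

  ∑-*ʳ : ∀ c (xs : List A) (f : A → ℕ) → ∑[ x ← xs ] (f x * c) ≡ ∑ xs f * c
  ∑-*ʳ c xs f = trans (∑-cong xs (λ x → *-comm (f x) c)) (trans (∑-*ˡ c xs f) (*-comm c _))

  ∑-const : ∀ (xs : List A) c → ∑[ x ← xs ] c ≡ length xs * c
  ∑-const []       c = refl
  ∑-const (x ∷ xs) c = cong (c +_) (∑-const xs c)

  ∑-≤const : ∀ (xs : List A) {f : A → ℕ} c → (∀ x → f x ≤ c) → ∑ xs f ≤ length xs * c
  ∑-≤const xs c h = ≤-trans (∑-mono xs h) (≤-reflexive (∑-const xs c))

  ∑-++ : ∀ (xs ys : List A) f → ∑ (xs ++ ys) f ≡ ∑ xs f + ∑ ys f
  ∑-++ []       ys f = refl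
  ∑-++ (x ∷ xs) ys f = trans (cong (f x +_) (∑-++ xs ys f)) (sym (+-assoc (f x) _ _))

  ∑-∈ : ∀ {xs : List A} {x} f → x ∈ xs → f x ≤ ∑ xs f
  ∑-∈ f (here refl) = m≤m+n _ _
  ∑-∈ f (there p)   = ≤-trans (∑-∈ f p) (m≤n+m _ _)

  ∑-witness : ∀ (xs : List A) {f g : A → ℕ} → ∑ xs g < ∑ xs f → ∃ λ x → x ∈ xs × g x < f x
  ∑-witness (x ∷ xs) {f} {g} h with f x ≤? g x
  ... | no  f≰g = x , here refl , ≰⇒> f≰g
  ... | yes f≤g =
    let y , y∈ , lt = ∑-witness xs {f} {g} (+-cancelˡ-< (g x) _ _ (<-≤-trans h (+-monoˡ-≤ (∑ xs f) f≤g)))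
    in  y , there y∈ , lt

∑-map : ∀ {A B : Set} (h : A → B) xs f → ∑ (map h xs) f ≡ ∑ xs (f ∘ h)
∑-map h []       f = refl
∑-map h (x ∷ xs) f = cong (f (h x) +_) (∑-map h xs f)

∑-swap : ∀ {A B : Set} (xs : List A) (ys : List B) (f : A → B → ℕ) →
         ∑[ x ← xs ] ∑[ y ← ys ] f x y ≡ ∑[ y ← ys ] ∑[ x ← xs ] f x y
∑-swap []       ys f = sym (trans (∑-const ys 0) (*-zeroʳ (length ys)))
∑-swap (x ∷ xs) ys f =
  trans (cong (∑ ys (f x) +_) (∑-swap xs ys f)) (sym (∑-+ ys (f x) _))

∑-product : ∀ {A B : Set} (xs : List A) (ys : List B) (f : A → ℕ) (g : B → ℕ) →
            ∑[ x ← xs ] ∑[ y ← ys ] (f x * g y) ≡ ∑ xs f * ∑ ys g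
∑-product xs ys f g = trans (∑-cong xs (λ x → ∑-*ˡ (f x) ys g)) (∑-*ʳ (∑ ys g) xs f)

2ab≤a²+b² : ∀ a b → 2 * (a * b) ≤ a * a + b * b
2ab≤a²+b² a b with ≤-total a b
... | inj₁ a≤b = subst (λ b → 2 * (a * b) ≤ a * a + b * b) (m+[n∸m]≡n a≤b) (square a (b ∸ a))
  where
  square : ∀ a d → 2 * (a * (a + d)) ≤ a * a + (a + d) * (a + d)
  square a d = lin (d * d) (≤-refl {0}) (eq a d)
    where
    eq : ∀ a d → a * a + (a + d) * (a + d) + 0 ≡ 2 * (a * (a + d)) + 0 + d * d
    eq = solve-∀
... | inj₂ b≤a = subst (λ a → 2 * (a * b) ≤ a * a + b * b) (m+[n∸m]≡n b≤a) (square b (a ∸ b))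
  where
  square : ∀ b d → 2 * ((b + d) * b) ≤ (b + d) * (b + d) + b * b
  square b d = lin (d * d) (≤-refl {0}) (eq b d)
    where
    eq : ∀ b d → (b + d) * (b + d) + b * b + 0 ≡ 2 * ((b + d) * b) + 0 + d * d
    eq = solve-∀

-- Sums over words

module _ {A : Set} where

  ∑ʷ : List A → ℕ → (List A → ℕ) → ℕ
  ∑ʷ xs zero    f = f []
  ∑ʷ xs (suc m) f = ∑[ x ← xs ] ∑ʷ xs m (λ s → f (x ∷ s))

  ∑ʷ-mono : ∀ xs m {f g : List A → ℕ} → (∀ s → length s ≡ m → f s ≤ g s) → ∑ʷ xs m f ≤ ∑ʷ xs m g
  ∑ʷ-mono xs zero    h = h [] refl
  ∑ʷ-mono xs (suc m) h = ∑-mono xs (λ x → ∑ʷ-mono xs m (λ s eq → h (x ∷ s) (cong suc eq)))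

  ∑ʷ-cong : ∀ xs m {f g : List A → ℕ} → (∀ s → f s ≡ g s) → ∑ʷ xs m f ≡ ∑ʷ xs m g
  ∑ʷ-cong xs zero    h = h []
  ∑ʷ-cong xs (suc m) h = ∑-cong xs (λ x → ∑ʷ-cong xs m (λ s → h (x ∷ s)))

  ∑ʷ-*ˡ : ∀ c xs m (f : List A → ℕ) → ∑ʷ xs m (λ s → c * f s) ≡ c * ∑ʷ xs m f
  ∑ʷ-*ˡ c xs zero    f = refl
  ∑ʷ-*ˡ c xs (suc m) f = trans (∑-cong xs (λ x → ∑ʷ-*ˡ c xs m (λ s → f (x ∷ s)))) (∑-*ˡ c xs _)

  ∑ʷ-+ : ∀ xs m (f g : List A → ℕ) → ∑ʷ xs m (λ s → f s + g s) ≡ ∑ʷ xs m f + ∑ʷ xs m g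
  ∑ʷ-+ xs zero    f g = refl
  ∑ʷ-+ xs (suc m) f g = trans (∑-cong xs (λ x → ∑ʷ-+ xs m (λ s → f (x ∷ s)) (λ s → g (x ∷ s)))) (∑-+ xs _ _)

  ∑ʷ-++ : ∀ xs m k (f : List A → ℕ) → ∑ʷ xs (m + k) f ≡ ∑ʷ xs m (λ s → ∑ʷ xs k (λ t → f (s ++ t)))
  ∑ʷ-++ xs zero    k f = refl
  ∑ʷ-++ xs (suc m) k f = ∑-cong xs (λ x → ∑ʷ-++ xs m k (λ s → f (x ∷ s)))

  ∑ʷ-const : ∀ xs m c → ∑ʷ xs m (λ _ → c) ≡ length xs ^ m * c
  ∑ʷ-const xs zero    c = sym (+-identityʳ c)
  ∑ʷ-const xs (suc m) c = trans (∑-cong xs (λ _ → ∑ʷ-const xs m c))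
    (trans (∑-const xs _) (sym (*-assoc (length xs) (length xs ^ m) c)))

  ∑ʷ-≤const : ∀ xs m {f : List A → ℕ} c → (∀ s → f s ≤ c) → ∑ʷ xs m f ≤ length xs ^ m * c
  ∑ʷ-≤const xs m c h = ≤-trans (∑ʷ-mono xs m (λ s _ → h s)) (≤-reflexive (∑ʷ-const xs m c))

  ∑ʷ-product : ∀ xs m k (f g : List A → ℕ) →
               ∑ʷ xs m (λ s → ∑ʷ xs k (λ t → f s * g t)) ≡ ∑ʷ xs m f * ∑ʷ xs k g
  ∑ʷ-product xs m k f g = trans (∑ʷ-cong xs m (λ s → trans (∑ʷ-*ˡ (f s) xs k g) (*-comm (f s) _)))
    (trans (∑ʷ-*ˡ (∑ʷ xs k g) xs m f) (*-comm _ (∑ʷ xs m f)))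

  ∑-∑ʷ-swap : ∀ {B : Set} (ys : List B) xs m (f : B → List A → ℕ) →
              ∑[ y ← ys ] ∑ʷ xs m (f y) ≡ ∑ʷ xs m (λ s → ∑[ y ← ys ] f y s)
  ∑-∑ʷ-swap ys xs zero    f = refl
  ∑-∑ʷ-swap ys xs (suc m) f = trans (∑-swap ys xs _)
    (∑-cong xs (λ x → ∑-∑ʷ-swap ys xs m (λ y s → f y (x ∷ s))))

  -- Makes `∑³` compute to `∑ʷ` at length three, so that the lemmas on words apply to triple sums as
  -- they stand.
  on₃ : (A → A → A → ℕ) → List A → ℕ
  on₃ f (a ∷ b ∷ c ∷ []) = f a b c
  on₃ f _                = 0

  ∑³ : List A → (A → A → A → ℕ) → ℕ
  ∑³ xs f = ∑[ a ← xs ] ∑[ b ← xs ] ∑[ c ← xs ] f a b c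

  ∑³-mono : ∀ xs {f g : A → A → A → ℕ} → (∀ a b c → f a b c ≤ g a b c) → ∑³ xs f ≤ ∑³ xs g
  ∑³-mono xs h = ∑-mono xs (λ a → ∑-mono xs (λ b → ∑-mono xs (h a b)))

  ∑³-cong : ∀ xs {f g : A → A → A → ℕ} → (∀ a b c → f a b c ≡ g a b c) → ∑³ xs f ≡ ∑³ xs g
  ∑³-cong xs h = ∑-cong xs (λ a → ∑-cong xs (λ b → ∑-cong xs (h a b)))

  ∑³-+ : ∀ xs (f g : A → A → A → ℕ) → ∑³ xs (λ a b c → f a b c + g a b c) ≡ ∑³ xs f + ∑³ xs g
  ∑³-+ xs f g = ∑ʷ-+ xs 3 (on₃ f) (on₃ g)

  ∑³-*ˡ : ∀ k xs (f : A → A → A → ℕ) → ∑³ xs (λ a b c → k * f a b c) ≡ k * ∑³ xs f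
  ∑³-*ˡ k xs f = ∑ʷ-*ˡ k xs 3 (on₃ f)

  ∑-∑³-swap : ∀ {B : Set} (ys : List B) xs (f : B → A → A → A → ℕ) →
              ∑[ y ← ys ] ∑³ xs (f y) ≡ ∑³ xs (λ a b c → ∑[ y ← ys ] f y a b c)
  ∑-∑³-swap ys xs f = ∑-∑ʷ-swap ys xs 3 (λ y → on₃ (f y))

∑³-swap₁₂ : ∀ {A : Set} (xs : List A) (f : A → A → A → ℕ) → ∑³ xs (λ a b c → f b a c) ≡ ∑³ xs f
∑³-swap₁₂ xs f = ∑-swap xs xs (λ a b → ∑[ c ← xs ] f b a c)

∑³-swap₂₃ : ∀ {A : Set} (xs : List A) (f : A → A → A → ℕ) → ∑³ xs (λ a b c → f a c b) ≡ ∑³ xs f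
∑³-swap₂₃ xs f = ∑-cong xs (λ a → ∑-swap xs xs (λ b c → f a c b))

∑³-rotˡ : ∀ {A : Set} (xs : List A) (f : A → A → A → ℕ) → ∑³ xs (λ a b c → f b c a) ≡ ∑³ xs f
∑³-rotˡ xs f = trans (∑³-swap₁₂ xs (λ b a c → f b c a)) (∑³-swap₂₃ xs f)

∑³-rotʳ : ∀ {A : Set} (xs : List A) (f : A → A → A → ℕ) → ∑³ xs (λ a b c → f c a b) ≡ ∑³ xs f
∑³-rotʳ xs f = sym (∑³-rotˡ xs (λ a b c → f c a b))

∑-∧ : ∀ {A : Set} b (xs : List A) (p : A → Bool) → ∑[ x ← xs ] 𝟙 (b ∧ p x) ≡ 𝟙 b * ∑[ x ← xs ] 𝟙 (p x)
∑-∧ true  xs p = sym (+-identityʳ _)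
∑-∧ false xs p = trans (∑-const xs 0) (*-zeroʳ (length xs))

𝟙-* : ∀ a b → 𝟙 (a ∧ b) ≡ 𝟙 a * 𝟙 b
𝟙-* true  b = sym (+-identityʳ (𝟙 b))
𝟙-* false b = refl

guard : ∀ b {m n} → (b ≡ true → m ≤ n) → 𝟙 b * m ≤ 𝟙 b * n
guard true  h = 1 ⊙ h refl
guard false h = z≤n

does-false : ∀ {P : Set} (d : Dec P) → does d ≡ false → ¬ P
does-false (no ¬p) _ = ¬p

-- Multisets of elements of Fin n

_==_ : ∀ {n} → Fin n → Fin n → Bool
u == v = does (u Fin.≟ v)

==-refl : ∀ {n} (u : Fin n) → (u == u) ≡ true
==-refl u = dec-true (u Fin.≟ u) refl

==-sound : ∀ {n} {u v : Fin n} → (u == v) ≡ true → u ≡ v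
==-sound {u = u} {v} h with u Fin.≟ v
... | yes eq = eq

==-false : ∀ {n} {u v : Fin n} → (u == v) ≡ false → u ≢ v
==-false {u = u} {v} h with u Fin.≟ v
... | no neq = neq

==-sym : ∀ {n} (u v : Fin n) → (u == v) ≡ (v == u)
==-sym u v with u Fin.≟ v | v Fin.≟ u
... | yes _ | yes _ = refl
... | no  _ | no  _ = refl
... | yes p | no ¬q = ⊥-elim (¬q (sym p))
... | no ¬p | yes q = ⊥-elim (¬p (sym q))

mult : ∀ {n} → List (Fin n) → Fin n → ℕ
mult l v = ∑[ u ← l ] 𝟙 (u == v)

length-allFin : ∀ n → length (allFin n) ≡ n
length-allFin n = length-tabulate id

∑-allFin-suc : ∀ n (f : Fin (suc n) → ℕ) → ∑ (allFin (suc n)) f ≡ f zero + ∑ (allFin n) (f ∘ suc)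
∑-allFin-suc n f = cong (f zero +_)
  (trans (cong (λ xs → ∑ xs f) (sym (map-tabulate id suc))) (∑-map suc (allFin n) f))

∑-delta : ∀ {n} (u : Fin n) (f : Fin n → ℕ) → ∑[ v ← allFin n ] (𝟙 (u == v) * f v) ≡ f u
∑-delta {suc n} zero f =
  trans (∑-allFin-suc n (λ v → 𝟙 (zero == v) * f v))
  (trans (cong₂ _+_ (+-identityʳ (f zero)) (trans (∑-const (allFin n) 0) (*-zeroʳ (length (allFin n)))))
         (+-identityʳ (f zero)))
∑-delta {suc n} (suc u) f =
  trans (∑-allFin-suc n (λ v → 𝟙 (suc u == v) * f v))
        (trans (∑-cong (allFin n) (λ v → cong (λ b → 𝟙 b * f (suc v)) (suc-== v))) (∑-delta u (f ∘ suc)))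
  where
  suc-== : ∀ v → (suc u == suc v) ≡ (u == v)
  suc-== v with u Fin.≟ v
  ... | yes _ = refl
  ... | no  _ = refl

mult-allFin : ∀ {n} (v : Fin n) → mult (allFin n) v ≡ 1
mult-allFin {n} v = trans (∑-cong (allFin n)
  (λ u → trans (cong 𝟙 (==-sym u v)) (sym (*-identityʳ _)))) (∑-delta v (λ _ → 1))

∑-mult : ∀ {n} (l : List (Fin n)) f → ∑ l f ≡ ∑[ v ← allFin n ] (mult l v * f v)
∑-mult {n} l f = sym (begin
  ∑[ v ← allFin n ] (mult l v * f v)
    ≡⟨ ∑-cong (allFin n) (λ v → sym (∑-*ʳ (f v) l _)) ⟩
  ∑[ v ← allFin n ] ∑[ u ← l ] (𝟙 (u == v) * f v)
    ≡⟨ ∑-swap (allFin n) l _ ⟩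
  ∑[ u ← l ] ∑[ v ← allFin n ] (𝟙 (u == v) * f v)
    ≡⟨ ∑-cong l (λ u → ∑-delta u f) ⟩
  ∑ l f ∎)
  where open ≡-Reasoning

∑-mult-cong : ∀ {n} (l l′ : List (Fin n)) f → (∀ v → mult l v ≡ mult l′ v) → ∑ l f ≡ ∑ l′ f
∑-mult-cong l l′ f h = trans (∑-mult l f)
  (trans (∑-cong (allFin _) (λ v → cong (_* f v) (h v))) (sym (∑-mult l′ f)))

length-∑ : ∀ {A : Set} (l : List A) → length l ≡ ∑[ x ← l ] 1
length-∑ l = sym (trans (∑-const l 1) (*-identityʳ _))

length-mult : ∀ {n} (l l′ : List (Fin n)) → (∀ v → mult l v ≡ mult l′ v) → length l ≡ length l′
length-mult l l′ h = trans (length-∑ l) (trans (∑-mult-cong l l′ (λ _ → 1) h) (sym (length-∑ l′)))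

∈⇒mult : ∀ {n} {l : List (Fin n)} {v} → v ∈ l → 1 ≤ mult l v
∈⇒mult {l = l} {v} p = ≤-trans (≤-reflexive (sym (𝟙-true (==-refl v)))) (∑-∈ (λ u → 𝟙 (u == v)) p)

mult⇒∈ : ∀ {n} (l : List (Fin n)) {v} → 1 ≤ mult l v → v ∈ l
mult⇒∈ (u ∷ l) {v} h with u Fin.≟ v
... | yes refl = here refl
... | no  _    = there (mult⇒∈ l h)

-- Tiles, unions of tiles and exchangeable vertices

at-least-2 : Bool → Bool → Bool → Bool
at-least-2 a b c = (a ∧ b) ∨ ((a ∨ b) ∧ c)

at-least-3 : Bool → Bool → Bool → Bool → Bool
at-least-3 a b c d = (a ∧ b ∧ (c ∨ d)) ∨ ((a ∨ b) ∧ c ∧ d)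

words : ∀ {A : Set} → List A → ℕ → List (List A)
words xs zero    = [] ∷ []
words xs (suc m) = cartesianProductWith _∷_ xs (words xs m)

∈-words : ∀ {n} (s : List (Fin n)) → s ∈ words (allFin n) (length s)
∈-words []      = here refl
∈-words (x ∷ s) = ∈-cartesianProductWith⁺ _∷_ (∈-allFin x) (∈-words s)

module Tiles {n : ℕ} (e : Fin n → Fin n → Fin n → Bool) where

  V : List (Fin n)
  V = allFin n

  tile : Fin n → Fin n → Fin n → Fin n → Bool
  tile a b c d = at-least-3 (e a b c) (e a b d) (e a c d) (e b c d)

  data Tiled : List (Fin n) → Set where
    []   : Tiled []
    tile∷ : ∀ {a b c d s} → tile a b c d ≡ true → Tiled s → Tiled (a ∷ b ∷ c ∷ d ∷ s)

  tiled-++ : ∀ {s t} → Tiled s → Tiled t → Tiled (s ++ t)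
  tiled-++ []          q = q
  tiled-++ (tile∷ h p) q = tile∷ h (tiled-++ p q)

  tiled? : ∀ s → Dec (Tiled s)
  tiled? []                  = yes []
  tiled? (_ ∷ [])            = no λ ()
  tiled? (_ ∷ _ ∷ [])        = no λ ()
  tiled? (_ ∷ _ ∷ _ ∷ [])    = no λ ()
  tiled? (a ∷ b ∷ c ∷ d ∷ s) =
    map′ (λ (h , p) → tile∷ h p) (λ { (tile∷ h p) → h , p })
         ((tile a b c d Bool.≟ true) ×-dec tiled? s)

  -- Vertex lists are read as multisets: Fac l says that l is a union of tiles.
  Fac : List (Fin n) → Set
  Fac l = ∃ λ s → Tiled s × (∀ v → mult s v ≡ mult l v)

  abstract
   -- A witness has the same multiplicities as `l`, hence the same length, and a search through all
   -- words of that length decides.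
   fac? : ∀ l → Dec (Fac l)
   fac? l = map′ satisfied
     (λ (s , t , h) → lose (subst (λ m → s ∈ words V m) (length-mult s l h) (∈-words s)) (t , h))
     (any? (λ s → tiled? s ×-dec Fin.all? (λ v → mult s v ℕ.≟ mult l v)) (words V (length l)))

  fac : List (Fin n) → Bool
  fac l = does (fac? l)

  fac-sound : ∀ {l} → fac l ≡ true → Fac l
  fac-sound {l} = does-sound (fac? l)

  fac-complete : ∀ {l} → Fac l → fac l ≡ true
  fac-complete {l} = dec-true (fac? l)

  mult-++ : ∀ s t (v : Fin n) → mult (s ++ t) v ≡ mult s v + mult t v
  mult-++ s t v = ∑-++ s t _

  Fac-resp : ∀ l l′ → (∀ v → mult l v ≡ mult l′ v) → Fac l → Fac l′
  Fac-resp _ _ h (s , t , h′) = s , t , λ v → trans (h′ v) (h v)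

  Fac-++ : ∀ {l l′} → Fac l → Fac l′ → Fac (l ++ l′)
  Fac-++ {l} {l′} (s , p , h) (s′ , p′ , h′) = s ++ s′ , tiled-++ p p′ , λ v →
    trans (mult-++ s s′ v) (trans (cong₂ _+_ (h v) (h′ v)) (sym (mult-++ l l′ v)))

  Fac-tile : ∀ {a b c d} → tile a b c d ≡ true → Fac (a ∷ b ∷ c ∷ d ∷ [])
  Fac-tile h = _ , tile∷ h [] , λ v → refl

  joins : Fin n → Fin n → List (Fin n) → Bool
  joins x y s = fac (x ∷ s) ∧ fac (y ∷ s)

  -- 1 / c is the density of the words of length 3 + 4 h through which x and y can be exchanged.
  record Reach (h c : ℕ) (x y : Fin n) : Set where
    constructor reach
    field many : n ^ (3 + 4 * h) ≤ c * ∑ʷ V (3 + 4 * h) (𝟙 ∘ joins x y)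

  open Reach public

  abstract
   reach? : ∀ h c x y → Dec (Reach h c x y)
   reach? h c x y = map′ reach many (_ ≤? _)

  reachᵇ : ℕ → ℕ → Fin n → Fin n → Bool
  reachᵇ h c x y = does (reach? h c x y)

  reachᵇ-sound : ∀ {h c x y} → reachᵇ h c x y ≡ true → Reach h c x y
  reachᵇ-sound {h} {c} {x} {y} = does-sound (reach? h c x y)

  reachᵇ-complete : ∀ {h c x y} → Reach h c x y → reachᵇ h c x y ≡ true
  reachᵇ-complete {h} {c} {x} {y} = dec-true (reach? h c x y)

  joins-sym : ∀ x y s → joins x y s ≡ joins y x s
  joins-sym x y s = Bool.∧-comm (fac (x ∷ s)) (fac (y ∷ s))

  Reach-sym : ∀ {h c x y} → Reach h c x y → Reach h c y x
  Reach-sym {h} {c} {x} {y} (reach p) = reach (≤-trans p (≤-reflexive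
    (cong (c *_) (∑ʷ-cong V (3 + 4 * h) (λ s → cong 𝟙 (joins-sym x y s))))))

  Reach-weaken : ∀ {h c c′ x y} → c ≤ c′ → Reach h c x y → Reach h c′ x y
  Reach-weaken c≤c′ (reach p) = reach (≤-trans p (*-monoˡ-≤ _ c≤c′))

  joins-sound : ∀ {x y s} → joins x y s ≡ true → Fac (x ∷ s) × Fac (y ∷ s)
  joins-sound h = let p , q = ∧-true h in fac-sound p , fac-sound q

  joins-complete : ∀ {x y s} → Fac (x ∷ s) → Fac (y ∷ s) → joins x y s ≡ true
  joins-complete p q = fac-complete p ∧ᵗ fac-complete q

  𝟙-mono : ∀ {a b} → (a ≡ true → b ≡ true) → 𝟙 a ≤ 𝟙 b
  𝟙-mono {false} h = z≤n
  𝟙-mono {true}  h = ≤-reflexive (sym (𝟙-true (h refl)))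

  𝟙-∧₂ : ∀ {a b c} → (a ≡ true → b ≡ true → c ≡ true) → 𝟙 a * 𝟙 b ≤ 𝟙 c
  𝟙-∧₂ {true}  {true}  h = ≤-reflexive (sym (𝟙-true (h refl refl)))
  𝟙-∧₂ {true}  {false} h = z≤n
  𝟙-∧₂ {false}         h = z≤n

  length-V : length V ≡ n
  length-V = length-allFin n

  Ex : ℕ → Fin n → Fin n → ℕ
  Ex m x y = ∑ʷ V m (λ s → 𝟙 (joins x y s))

  -- The counting step behind every composition of exchanges: to each admissible prefix `u` two
  -- connecting words are appended independently, so the densities `1 / E`, `1 / c` and `1 / c`
  -- multiply.
  ∑ʷ-glue : ∀ k m E c (r : List (Fin n) → Bool) (P Q : List (Fin n) → List (Fin n) → Bool)
            (W : List (Fin n) → Bool) →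
            (∀ u → r u ≡ true → n ^ m ≤ c * ∑ʷ V m (λ s → 𝟙 (P u s)) × n ^ m ≤ c * ∑ʷ V m (λ t → 𝟙 (Q u t))) →
            (∀ u s t → r u ≡ true → P u s ≡ true → Q u t ≡ true → W (u ++ s ++ t) ≡ true) →
            n ^ k ≤ E * ∑ʷ V k (λ u → 𝟙 (r u)) →
            n ^ (k + (m + m)) ≤ E * (c * c) * ∑ʷ V (k + (m + m)) (λ u → 𝟙 (W u))
  ∑ʷ-glue k m E c r P Q W dense W-true many-u = begin
    n ^ (k + (m + m))
      ≡⟨ trans (^-distribˡ-+-* n k (m + m)) (cong (n ^ k *_) (^-distribˡ-+-* n m m)) ⟩
    n ^ k * N
      ≤⟨ *-monoˡ-≤ N many-u ⟩
    E * ∑ʷ V k (λ u → 𝟙 (r u)) * N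
      ≡⟨ trans (*-assoc E _ N) (cong (E *_) (trans (*-comm _ N) (sym (∑ʷ-*ˡ N V k (λ u → 𝟙 (r u)))))) ⟩
    E * ∑ʷ V k (λ u → N * 𝟙 (r u))
      ≤⟨ E ⊙ ∑ʷ-mono V k (λ u _ → through u) ⟩
    E * ∑ʷ V k (λ u → (c * c) * ∑ʷ V (m + m) (λ s → 𝟙 (W (u ++ s))))
      ≡⟨ cong (E *_) (∑ʷ-*ˡ (c * c) V k (λ u → ∑ʷ V (m + m) (λ s → 𝟙 (W (u ++ s))))) ⟩
    E * ((c * c) * ∑ʷ V k (λ u → ∑ʷ V (m + m) (λ s → 𝟙 (W (u ++ s)))))
      ≡⟨ cong (λ w → E * ((c * c) * w)) (sym (∑ʷ-++ V k (m + m) (λ u → 𝟙 (W u)))) ⟩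
    E * ((c * c) * ∑ʷ V (k + (m + m)) (λ u → 𝟙 (W u)))
      ≡⟨ sym (*-assoc E (c * c) _) ⟩
    E * (c * c) * ∑ʷ V (k + (m + m)) (λ u → 𝟙 (W u)) ∎
    where
    open ≤-Reasoning
    N = n ^ m * n ^ m
    eq : ∀ c a b → (c * a) * (c * b) ≡ (c * c) * (a * b)
    eq = solve-∀
    through : ∀ u → N * 𝟙 (r u) ≤ (c * c) * ∑ʷ V (m + m) (λ s → 𝟙 (W (u ++ s)))
    through u with r u in ru
    ... | false = ≤-trans (≤-reflexive (*-zeroʳ N)) z≤n
    ... | true  = begin
      N * 1
        ≡⟨ *-identityʳ N ⟩
      N
        ≤⟨ *-mono-≤ (proj₁ (dense u ru)) (proj₂ (dense u ru)) ⟩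
      (c * S) * (c * T)
        ≡⟨ eq c S T ⟩
      (c * c) * (S * T)
        ≡⟨ cong ((c * c) *_) (sym (∑ʷ-product V m m (λ s → 𝟙 (P u s)) (λ t → 𝟙 (Q u t)))) ⟩
      (c * c) * ∑ʷ V m (λ s → ∑ʷ V m (λ t → 𝟙 (P u s) * 𝟙 (Q u t)))
        ≤⟨ (c * c) ⊙ ∑ʷ-mono V m (λ s _ → ∑ʷ-mono V m (λ t _ → 𝟙-∧₂ (W-true u s t ru))) ⟩
      (c * c) * ∑ʷ V m (λ s → ∑ʷ V m (λ t → 𝟙 (W (u ++ s ++ t))))
        ≡⟨ cong ((c * c) *_) (sym (∑ʷ-++ V m m (λ s → 𝟙 (W (u ++ s))))) ⟩
      (c * c) * ∑ʷ V (m + m) (λ s → 𝟙 (W (u ++ s))) ∎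
      where
      S = ∑ʷ V m (λ s → 𝟙 (P u s))
      T = ∑ʷ V m (λ t → 𝟙 (Q u t))

  -- If `s` exchanges `x` with `z` and `t` exchanges `z` with `y`, then `z ∷ s ++ t` exchanges `x`
  -- with `y`: with `x` it regroups as `x s` and `z t`, with `y` as `z s` and `y t`.
  Reach-compose : ∀ h c E {x y} → n ≤ E * ∑[ z ← V ] 𝟙 (reachᵇ h c x z ∧ reachᵇ h c z y) →
                  Reach (1 + (h + h)) (E * (c * c)) x y
  Reach-compose h c E {x} {y} many-z = reach (subst (λ m → n ^ m ≤ E * (c * c) * Ex m x y) (exp h)
    (∑ʷ-glue 1 (3 + 4 * h) E c r P Q (joins x y) dense glue
      (≤-trans (≤-reflexive (*-identityʳ n)) many-z)))
    where
    exp : ∀ h → 1 + ((3 + 4 * h) + (3 + 4 * h)) ≡ 3 + 4 * (1 + (h + h))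
    exp = solve-∀
    r : List (Fin n) → Bool
    r (z ∷ []) = reachᵇ h c x z ∧ reachᵇ h c z y
    r _        = false
    P Q : List (Fin n) → List (Fin n) → Bool
    P (z ∷ []) s = joins x z s
    P _        s = false
    Q (z ∷ []) s = joins z y s
    Q _        s = false
    dense : ∀ u → r u ≡ true → _
    dense (z ∷ []) p = let p₁ , p₂ = ∧-true p in many (reachᵇ-sound p₁) , many (reachᵇ-sound p₂)
    eq₁ : ∀ x z s t → x + (s + (z + t)) ≡ x + (z + (s + t))
    eq₁ = solve-∀
    eq₂ : ∀ y z s t → z + (s + (y + t)) ≡ y + (z + (s + t))
    eq₂ = solve-∀
    glue : ∀ u s t → r u ≡ true → P u s ≡ true → Q u t ≡ true → joins x y (u ++ s ++ t) ≡ true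
    glue (z ∷ []) s t _ p q = joins-complete {x} {y} {z ∷ s ++ t}
      (Fac-resp ((x ∷ s) ++ z ∷ t) (x ∷ z ∷ s ++ t) eqx
        (Fac-++ {x ∷ s} {z ∷ t} (proj₁ (joins-sound {x} {z} {s} p)) (proj₁ (joins-sound {z} {y} {t} q))))
      (Fac-resp ((z ∷ s) ++ y ∷ t) (y ∷ z ∷ s ++ t) eqy
        (Fac-++ {z ∷ s} {y ∷ t} (proj₂ (joins-sound {x} {z} {s} p)) (proj₂ (joins-sound {z} {y} {t} q))))
      where
      eqx : ∀ v → mult ((x ∷ s) ++ z ∷ t) v ≡ mult (x ∷ z ∷ s ++ t) v
      eqx v rewrite mult-++ s (z ∷ t) v | mult-++ s t v = eq₁ (𝟙 (x == v)) (𝟙 (z == v)) (mult s v) (mult t v)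
      eqy : ∀ v → mult ((z ∷ s) ++ y ∷ t) v ≡ mult (y ∷ z ∷ s ++ t) v
      eqy v rewrite mult-++ s (y ∷ t) v | mult-++ s t v = eq₂ (𝟙 (y == v)) (𝟙 (z == v)) (mult s v) (mult t v)

  -- Let `s` exchange `x` with `d` and `t` exchange `c′` with `f`. Together with `x` the letters
  -- `a b c′ f d s t` regroup as `x s`, the tile `a b c′ d` and `f t`; together with `y` as `d s`,
  -- the tile `a b f y` and `c′ t`. Two tiles that differ in two vertices thus still yield an
  -- exchange.
  Reach-transfer : ∀ h c E {x y} →
    n ^ 5 ≤ E * ∑[ a ← V ] ∑[ b ← V ] ∑[ c′ ← V ] ∑[ f ← V ] ∑[ d ← V ]
      𝟙 (reachᵇ h c x d ∧ reachᵇ h c c′ f ∧ tile a b c′ d ∧ tile a b f y) →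
    Reach (2 + (h + h)) (E * (c * c)) x y
  Reach-transfer h c E {x} {y} many-u = reach (subst (λ m → n ^ m ≤ E * (c * c) * Ex m x y) (exp h)
    (∑ʷ-glue 5 (3 + 4 * h) E c r P Q (joins x y) dense glue many-u))
    where
    exp : ∀ h → 5 + ((3 + 4 * h) + (3 + 4 * h)) ≡ 3 + 4 * (2 + (h + h))
    exp = solve-∀
    r : List (Fin n) → Bool
    r (a ∷ b ∷ c′ ∷ f ∷ d ∷ []) = reachᵇ h c x d ∧ reachᵇ h c c′ f ∧ tile a b c′ d ∧ tile a b f y
    r _                         = false
    P Q : List (Fin n) → List (Fin n) → Bool
    P (a ∷ b ∷ c′ ∷ f ∷ d ∷ []) s = joins x d s
    P _                         s = false
    Q (a ∷ b ∷ c′ ∷ f ∷ d ∷ []) s = joins c′ f s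
    Q _                         s = false
    dense : ∀ u → r u ≡ true → _
    dense (a ∷ b ∷ c′ ∷ f ∷ d ∷ []) p =
      let p₁ , q = ∧-true p ; p₂ , _ = ∧-true q in many (reachᵇ-sound p₁) , many (reachᵇ-sound p₂)
    eq₁ : ∀ x s a b c d f t → x + (s + (a + (b + (c + (d + (f + t)))))) ≡ x + (a + (b + (c + (f + (d + (s + t))))))
    eq₁ = solve-∀
    eq₂ : ∀ y s a b c d f t → d + (s + (a + (b + (f + (y + (c + t)))))) ≡ y + (a + (b + (c + (f + (d + (s + t))))))
    eq₂ = solve-∀
    glue : ∀ u s t → r u ≡ true → P u s ≡ true → Q u t ≡ true → joins x y (u ++ s ++ t) ≡ true
    glue (a ∷ b ∷ c′ ∷ f ∷ d ∷ []) s t rr p q =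
      let _ , r₁ = ∧-true {reachᵇ h c x d} rr
          _ , r₂ = ∧-true {reachᵇ h c c′ f} r₁
          t₁ , t₂ = ∧-true {tile a b c′ d} r₂
      in
      joins-complete {x} {y} {a ∷ b ∷ c′ ∷ f ∷ d ∷ s ++ t}
      (Fac-resp ((x ∷ s) ++ a ∷ b ∷ c′ ∷ d ∷ f ∷ t) (x ∷ a ∷ b ∷ c′ ∷ f ∷ d ∷ s ++ t) eqx
        (Fac-++ {x ∷ s} {a ∷ b ∷ c′ ∷ d ∷ f ∷ t} (proj₁ (joins-sound {x} {d} {s} p))
          (Fac-++ {a ∷ b ∷ c′ ∷ d ∷ []} {f ∷ t} (Fac-tile {a} {b} {c′} {d} t₁) (proj₂ (joins-sound {c′} {f} {t} q)))))
      (Fac-resp ((d ∷ s) ++ a ∷ b ∷ f ∷ y ∷ c′ ∷ t) (y ∷ a ∷ b ∷ c′ ∷ f ∷ d ∷ s ++ t) eqy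
        (Fac-++ {d ∷ s} {a ∷ b ∷ f ∷ y ∷ c′ ∷ t} (proj₂ (joins-sound {x} {d} {s} p))
          (Fac-++ {a ∷ b ∷ f ∷ y ∷ []} {c′ ∷ t} (Fac-tile {a} {b} {f} {y} t₂) (proj₁ (joins-sound {c′} {f} {t} q)))))
      where
      eqx : ∀ v → mult ((x ∷ s) ++ a ∷ b ∷ c′ ∷ d ∷ f ∷ t) v ≡ mult (x ∷ a ∷ b ∷ c′ ∷ f ∷ d ∷ s ++ t) v
      eqx v rewrite mult-++ s (a ∷ b ∷ c′ ∷ d ∷ f ∷ t) v | mult-++ s t v =
        eq₁ (𝟙 (x == v)) (mult s v) (𝟙 (a == v)) (𝟙 (b == v)) (𝟙 (c′ == v)) (𝟙 (d == v)) (𝟙 (f == v)) (mult t v)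
      eqy : ∀ v → mult ((d ∷ s) ++ a ∷ b ∷ f ∷ y ∷ c′ ∷ t) v ≡ mult (y ∷ a ∷ b ∷ c′ ∷ f ∷ d ∷ s ++ t) v
      eqy v rewrite mult-++ s (a ∷ b ∷ f ∷ y ∷ c′ ∷ t) v | mult-++ s t v =
        eq₂ (𝟙 (y == v)) (mult s v) (𝟙 (a == v)) (𝟙 (b == v)) (𝟙 (c′ == v)) (𝟙 (d == v)) (𝟙 (f == v)) (mult t v)

  module Padding (τ : ℕ)
    (many-tiles : n ^ 4 ≤ τ * ∑[ a ← V ] ∑[ b ← V ] ∑[ c ← V ] ∑[ d ← V ] 𝟙 (tile a b c d)) where

    -- Any tile can be put in front of a connecting word. This brings exchanges through words of
    -- different lengths to one common length.
    Reach-pad : ∀ {h c x y} → Reach h c x y → Reach (1 + h) (τ * c) x y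
    Reach-pad {h} {c} {x} {y} (reach p) = reach (subst (λ m → n ^ m ≤ τ * c * Ex m x y) (exp h) (pad (3 + 4 * h) p))
      where
      exp : ∀ h → 4 + (3 + 4 * h) ≡ 3 + 4 * (1 + h)
      exp = solve-∀
      padded : ∀ u s → fac u ≡ true → joins x y s ≡ true → joins x y (u ++ s) ≡ true
      padded u s t p = joins-complete {x} {y} {u ++ s} (shift x (proj₁ (joins-sound {x} {y} {s} p)))
                                                       (shift y (proj₂ (joins-sound {x} {y} {s} p)))
        where
        comm : ∀ u x s → u + (x + s) ≡ x + (u + s)
        comm = solve-∀
        shift : ∀ x → Fac (x ∷ s) → Fac (x ∷ u ++ s)
        shift x q = Fac-resp (u ++ x ∷ s) (x ∷ u ++ s)
          (λ v → trans (mult-++ u (x ∷ s) v) (trans (comm (mult u v) (𝟙 (x == v)) (mult s v))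
            (cong (𝟙 (x == v) +_) (sym (mult-++ u s v)))))
          (Fac-++ {u} {x ∷ s} (fac-sound t) q)
      pad : ∀ m → n ^ m ≤ c * Ex m x y → n ^ (4 + m) ≤ τ * c * Ex (4 + m) x y
      pad m p = begin
        n ^ (4 + m)
          ≡⟨ ^-distribˡ-+-* n 4 m ⟩
        n ^ 4 * n ^ m
          ≤⟨ *-mono-≤ (≤-trans many-tiles (τ ⊙ ∑-mono V (λ a → ∑-mono V (λ b → ∑-mono V (λ c → ∑-mono V (λ d →
               𝟙-mono (λ t → fac-complete (Fac-tile t)))))))) p ⟩
        (τ * ∑ʷ V 4 (λ u → 𝟙 (fac u))) * (c * Ex m x y)
          ≡⟨ eq τ _ c _ ⟩
        τ * c * (∑ʷ V 4 (λ u → 𝟙 (fac u)) * Ex m x y)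
          ≡⟨ cong (τ * c *_) (sym (∑ʷ-product V 4 m (λ u → 𝟙 (fac u)) (λ s → 𝟙 (joins x y s)))) ⟩
        τ * c * ∑ʷ V 4 (λ u → ∑ʷ V m (λ s → 𝟙 (fac u) * 𝟙 (joins x y s)))
          ≤⟨ (τ * c) ⊙ ∑ʷ-mono V 4 (λ u _ → ∑ʷ-mono V m (λ s _ → 𝟙-∧₂ (padded u s))) ⟩
        τ * c * ∑ʷ V 4 (λ u → ∑ʷ V m (λ s → 𝟙 (joins x y (u ++ s))))
          ≡⟨ cong (τ * c *_) (sym (∑ʷ-++ V 4 m (λ s → 𝟙 (joins x y s)))) ⟩
        τ * c * Ex (4 + m) x y ∎
        where
        open ≤-Reasoning
        eq : ∀ a b c d → (a * b) * (c * d) ≡ a * c * (b * d)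
        eq = solve-∀

    Reach-pads : ∀ i {h c x y} → Reach h c x y → Reach (i + h) (τ ^ i * c) x y
    Reach-pads zero    {h} {c} {x} {y} r = subst (λ c → Reach h c x y) (sym (*-identityˡ c)) r
    Reach-pads (suc i) {h} {c} {x} {y} r =
      subst (λ c → Reach (suc i + h) c x y) (sym (*-assoc τ (τ ^ i) c)) (Reach-pad (Reach-pads i r))

-- Completions of an edge to a tile

𝟙-∧ : ∀ a b → 𝟙 a + 𝟙 b ≤ 1 + 𝟙 (a ∧ b)
𝟙-∧ true  b = ≤-refl
𝟙-∧ false b = ≤-trans (𝟙≤1 b) (m≤m+n 1 0)

𝟙-at-least-2 : ∀ a b c → 𝟙 a + 𝟙 b + 𝟙 c ≤ 1 + 2 * 𝟙 (at-least-2 a b c)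
𝟙-at-least-2 true  true  c     = s≤s (s≤s (𝟙≤1 c))
𝟙-at-least-2 true  false true  = s≤s (s≤s z≤n)
𝟙-at-least-2 true  false false = s≤s z≤n
𝟙-at-least-2 false true  true  = s≤s (s≤s z≤n)
𝟙-at-least-2 false true  false = s≤s z≤n
𝟙-at-least-2 false false true  = s≤s z≤n
𝟙-at-least-2 false false false = z≤n

at-least-2⇒3 : ∀ a b c d → at-least-2 a b c ≡ true → d ≡ true → at-least-3 a b c d ≡ true
at-least-2⇒3 true  true  true  true h refl = refl
at-least-2⇒3 true  true  false true h refl = refl
at-least-2⇒3 true  false true  true h refl = refl
at-least-2⇒3 false true  true  true h refl = refl

at-least-2-∧ : ∀ {a b} c → a ≡ true → b ≡ true → at-least-2 a b c ≡ true
at-least-2-∧ c refl refl = refl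

at-least-3-∧ : ∀ {a b} c {d} → a ≡ true → b ≡ true → d ≡ true → at-least-3 a b c d ≡ true
at-least-3-∧ true  refl refl refl = refl
at-least-3-∧ false refl refl refl = refl

at-least-3-∧₁₂₃ : ∀ {a b c} d → a ≡ true → b ≡ true → c ≡ true → at-least-3 a b c d ≡ true
at-least-3-∧₁₂₃ d refl refl refl = refl

-- The hypothesis is δ₂ ≥ D ≥ n/2 + g, where g is a constant fraction of n.
module Codegree {n : ℕ} (e : Fin n → Fin n → Fin n → Bool)
  (sym₁₂ : ∀ x y z → e x y z ≡ e y x z) (sym₂₃ : ∀ x y z → e x y z ≡ e x z y)
  (irr : ∀ x z → e x x z ≡ false)
  (D g k : ℕ) (codeg : ∀ x y → x ≢ y → D ≤ ∑[ z ← Tiles.V e ] 𝟙 (e x y z))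
  (half : n + 2 * g ≤ 2 * D) (dense : n ≤ k * g) (2≤n : 2 ≤ n) where

  open Tiles e public

  e-≢ : ∀ {x y z} → e x y z ≡ true → x ≢ y
  e-≢ {x} {.x} {z} h refl with trans (sym h) (irr x z)
  ... | ()

  rot : ∀ x y z → e x y z ≡ e y z x
  rot x y z = trans (sym₁₂ x y z) (sym₂₃ y x z)

  e-≢₂₃ : ∀ {x y z} → e x y z ≡ true → y ≢ z
  e-≢₂₃ {x} {y} {z} h = e-≢ (trans (sym (rot x y z)) h)

  e-≢₁₃ : ∀ {x y z} → e x y z ≡ true → x ≢ z
  e-≢₁₃ {x} {y} {z} h = e-≢ (trans (sym (sym₂₃ x y z)) h)

  ∑-V-const : ∀ c → ∑[ z ← V ] c ≡ n * c
  ∑-V-const c = trans (∑-const V c) (cong (_* c) length-V)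

  ∑-V-≤const : ∀ {f : Fin n → ℕ} c → (∀ z → f z ≤ c) → ∑ V f ≤ n * c
  ∑-V-≤const c h = ≤-trans (∑-mono V h) (≤-reflexive (∑-V-const c))

  ∑-V-1+ : ∀ (f : Fin n → ℕ) → ∑[ z ← V ] (1 + f z) ≡ n + ∑ V f
  ∑-V-1+ f = trans (∑-+ V (λ _ → 1) f) (cong (_+ ∑ V f) (trans (∑-V-const 1) (*-identityʳ n)))

  #∧ : ∀ (p q : Fin n → Bool) → ∑[ z ← V ] 𝟙 (p z) + ∑[ z ← V ] 𝟙 (q z) ≤ n + ∑[ z ← V ] 𝟙 (p z ∧ q z)
  #∧ p q = ≤-trans (≤-reflexive (sym (∑-+ V _ _)))
    (≤-trans (∑-mono V (λ z → 𝟙-∧ (p z) (q z))) (≤-reflexive (∑-V-1+ _)))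

  common : ∀ {a b c d} → a ≢ b → c ≢ d → 2 * g ≤ ∑[ z ← V ] 𝟙 (e a b z ∧ e c d z)
  common {a} {b} {c} {d} a≢b c≢d =
    lin 0 (half ⊕ ((codeg a b a≢b ⊕ codeg c d c≢d) ⊕ #∧ (e a b) (e c d))) 
      (eq n g D (∑[ z ← V ] 𝟙 (e a b z ∧ e c d z)) (∑[ z ← V ] 𝟙 (e a b z)) (∑[ z ← V ] 𝟙 (e c d z)))
    where
    eq : ∀ n g D X A B → X + ((n + 2 * g) + ((D + D) + (A + B))) ≡ 2 * g + (2 * D + ((A + B) + (n + X))) + 0
    eq = solve-∀

  ext : Fin n → Fin n → Fin n → Fin n → Bool
  ext v a b c = at-least-2 (e v a b) (e v a c) (e v b c)

  ext-tile : ∀ {v a b c} → ext v a b c ≡ true → e a b c ≡ true → tile v a b c ≡ true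
  ext-tile {v} {a} {b} {c} = at-least-2⇒3 (e v a b) (e v a c) (e v b c) (e a b c)

  codeg₁ : ∀ a b → a ≢ b → D ≤ ∑[ v ← V ] 𝟙 (e v a b)
  codeg₁ a b a≢b = ≤-trans (codeg a b a≢b) (≤-reflexive (∑-cong V (λ v → cong 𝟙 (sym (rot v a b)))))

  -- A vertex adjacent to at most one of the three pairs contributes at most 1 to the sum of their
  -- codegrees, any other vertex at most 3.
  ext-many : ∀ {a b c} → e a b c ≡ true → 3 * D ≤ n + 2 * ∑[ v ← V ] 𝟙 (ext v a b c)
  ext-many {a} {b} {c} h = begin
    3 * D
      ≡⟨ eq D ⟩
    D + D + D
      ≤⟨ codeg₁ a b (e-≢ h) ⊕ codeg₁ a c (e-≢₁₃ h) ⊕ codeg₁ b c (e-≢₂₃ h) ⟩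
    ∑[ v ← V ] 𝟙 (e v a b) + ∑[ v ← V ] 𝟙 (e v a c) + ∑[ v ← V ] 𝟙 (e v b c)
      ≡⟨ cong (_+ ∑[ v ← V ] 𝟙 (e v b c)) (sym (∑-+ V _ _)) ⟩
    ∑[ v ← V ] (𝟙 (e v a b) + 𝟙 (e v a c)) + ∑[ v ← V ] 𝟙 (e v b c)
      ≡⟨ sym (∑-+ V _ _) ⟩
    ∑[ v ← V ] (𝟙 (e v a b) + 𝟙 (e v a c) + 𝟙 (e v b c))
      ≤⟨ ∑-mono V (λ v → 𝟙-at-least-2 (e v a b) (e v a c) (e v b c)) ⟩
    ∑[ v ← V ] (1 + 2 * 𝟙 (ext v a b c))
      ≡⟨ ∑-V-1+ (λ v → 2 * 𝟙 (ext v a b c)) ⟩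
    n + ∑[ v ← V ] (2 * 𝟙 (ext v a b c))
      ≡⟨ cong (n +_) (∑-*ˡ 2 V (λ v → 𝟙 (ext v a b c))) ⟩
    n + 2 * ∑[ v ← V ] 𝟙 (ext v a b c) ∎
    where
    open ≤-Reasoning
    eq : ∀ D → 3 * D ≡ D + D + D
    eq = solve-∀

  -- Three edges through `b` form a tile in which the triple `b a c` that avoids `x` is itself an
  -- edge. Every completion `y` of `b a c` can therefore take the place of `x`.
  w : Fin n → Fin n → Fin n → Fin n → Bool
  w x b a c = e x b a ∧ (e b a c ∧ e x b c)

  W : Fin n → ℕ
  W x = ∑³ V (λ b a c → 𝟙 (w x b a c))

  w-tile : ∀ {x b a c} → w x b a c ≡ true → tile x b a c ≡ true
  w-tile {x} {b} {a} {c} h = let h₁ , h′ = ∧-true {e x b a} h ; h₂ , h₃ = ∧-true {e b a c} h′ in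
    at-least-3-∧ (e x a c) h₁ h₃ h₂

  -- For `b ≠ x` there are at least `D` choices of `a` and then `2 * g` choices of `c`; leaving out
  -- `b = x` costs at most a factor 2.
  W-large : ∀ x → n * n * n ≤ 2 * k * W x
  W-large x = begin
    n * n * n
      ≤⟨ *-mono-≤ (n ⊙ n≤2D) dense ⟩
    n * (2 * D) * (k * g)
      ≡⟨ eq₁ n D k g ⟩
    k * (n * (D * (2 * g)))
      ≤⟨ k ⊙ nX≤2W ⟩
    k * (2 * W x)
      ≡⟨ eq₂ k (W x) ⟩
    2 * k * W x ∎
    where
    open ≤-Reasoning
    X = D * (2 * g)
    n≤2D : n ≤ 2 * D
    n≤2D = ≤-trans (m≤m+n n (2 * g)) half
    eq₁ : ∀ n D k g → n * (2 * D) * (k * g) ≡ k * (n * (D * (2 * g)))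
    eq₁ = solve-∀
    eq₂ : ∀ k W → k * (2 * W) ≡ 2 * k * W
    eq₂ = solve-∀
    inner : ∀ b → x ≢ b → X ≤ ∑[ a ← V ] ∑[ c ← V ] 𝟙 (w x b a c)
    inner b x≢b = begin
      D * (2 * g)
        ≤⟨ *-monoˡ-≤ (2 * g) (codeg x b x≢b) ⟩
      ∑[ a ← V ] 𝟙 (e x b a) * (2 * g)
        ≡⟨ sym (∑-*ʳ (2 * g) V (λ a → 𝟙 (e x b a))) ⟩
      ∑[ a ← V ] (𝟙 (e x b a) * (2 * g))
        ≤⟨ ∑-mono V (λ a → guard (e x b a) (λ h → common (e-≢₂₃ h) x≢b)) ⟩
      ∑[ a ← V ] (𝟙 (e x b a) * ∑[ c ← V ] 𝟙 (e b a c ∧ e x b c))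
        ≡⟨ ∑-cong V (λ a → sym (∑-∧ (e x b a) V (λ c → e b a c ∧ e x b c))) ⟩
      ∑[ a ← V ] ∑[ c ← V ] 𝟙 (w x b a c) ∎
    per-b : ∀ b → X ≤ ∑[ a ← V ] ∑[ c ← V ] 𝟙 (w x b a c) + 𝟙 (x == b) * X
    per-b b with x == b in eq
    ... | true  = ≤-trans (≤-reflexive (sym (+-identityʳ X))) (m≤n+m (X + 0) (∑[ a ← V ] ∑[ c ← V ] 𝟙 (w x b a c)))
    ... | false = ≤-trans (inner b (==-false eq)) (m≤m+n _ 0)
    nX≤W+X : n * X ≤ W x + X
    nX≤W+X = begin
      n * X
        ≡⟨ sym (∑-V-const X) ⟩
      ∑[ b ← V ] X
        ≤⟨ ∑-mono V per-b ⟩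
      ∑[ b ← V ] (∑[ a ← V ] ∑[ c ← V ] 𝟙 (w x b a c) + 𝟙 (x == b) * X)
        ≡⟨ ∑-+ V _ _ ⟩
      W x + ∑[ b ← V ] (𝟙 (x == b) * X)
        ≡⟨ cong (W x +_) (∑-delta x (λ _ → X)) ⟩
      W x + X ∎
    nX≤2W : n * X ≤ 2 * W x
    nX≤2W = lin 0 ((2 ⊙ nX≤W+X) ⊕ *-monoˡ-≤ X 2≤n) (eq n X (W x))
      where
      eq : ∀ n X W → 2 * W + (2 * (n * X) + 2 * X) ≡ n * X + (2 * (W + X) + n * X) + 0
      eq = solve-∀

  many-tiles : n ^ 4 ≤ 2 * k * ∑[ a ← V ] ∑[ b ← V ] ∑[ c ← V ] ∑[ d ← V ] 𝟙 (tile a b c d)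
  many-tiles = begin
    n ^ 4
      ≡⟨ eq n ⟩
    n * (n * n * n)
      ≡⟨ sym (∑-V-const (n * n * n)) ⟩
    ∑[ x ← V ] (n * n * n)
      ≤⟨ ∑-mono V W-large ⟩
    ∑[ x ← V ] (2 * k * W x)
      ≡⟨ ∑-*ˡ (2 * k) V W ⟩
    2 * k * ∑ V W
      ≤⟨ (2 * k) ⊙ ∑-mono V (λ x → ∑³-mono V (λ b a c → 𝟙-mono (w-tile {x} {b} {a} {c}))) ⟩
    2 * k * ∑[ a ← V ] ∑[ b ← V ] ∑[ c ← V ] ∑[ d ← V ] 𝟙 (tile a b c d) ∎
    where
    open ≤-Reasoning
    eq : ∀ n → n * (n * (n * (n * 1))) ≡ n * (n * n * n)
    eq = solve-∀

  -- Averaging over the edges b a c counted by W x: each of them is completed to a tile by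
  -- (3D - n)/2 > n/4 vertices y.
  module _ (x : Fin n) where

    cc : Fin n → ℕ
    cc y = ∑³ V (λ b a c → 𝟙 (w x b a c ∧ ext y b a c))

    cc≤W : ∀ y → cc y ≤ W x
    cc≤W y = ∑³-mono V (λ b a c → 𝟙-mono {w x b a c ∧ ext y b a c} (λ h → proj₁ (∧-true {w x b a c} h)))

    cc≤Ex : ∀ y → cc y ≤ Ex 3 x y
    cc≤Ex y = ∑³-mono V (λ b a c → 𝟙-mono {w x b a c ∧ ext y b a c} (λ h →
      let h₁ , h₂ = ∧-true {w x b a c} h
          h₃ = proj₁ (∧-true {e b a c} (proj₂ (∧-true {e x b a} h₁)))
      in joins-complete {x} {y} {b ∷ a ∷ c ∷ []} (Fac-tile {x} {b} {a} {c} (w-tile {x} {b} {a} {c} h₁))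
           (Fac-tile {y} {b} {a} {c} (ext-tile {y} {b} {a} {c} h₂ h₃))))

    cc-total : 3 * D * W x ≤ n * W x + 2 * ∑ V cc
    cc-total = begin
      3 * D * W x
        ≡⟨ sym (∑³-*ˡ (3 * D) V (λ b a c → 𝟙 (w x b a c))) ⟩
      ∑³ V (λ b a c → 3 * D * 𝟙 (w x b a c))
        ≤⟨ ∑³-mono V each ⟩
      ∑³ V (λ b a c → n * 𝟙 (w x b a c) + 2 * ∑[ y ← V ] 𝟙 (w x b a c ∧ ext y b a c))
        ≡⟨ ∑³-+ V (λ b a c → n * 𝟙 (w x b a c)) (λ b a c → 2 * ∑[ y ← V ] 𝟙 (w x b a c ∧ ext y b a c)) ⟩
      ∑³ V (λ b a c → n * 𝟙 (w x b a c)) + ∑³ V (λ b a c → 2 * ∑[ y ← V ] 𝟙 (w x b a c ∧ ext y b a c))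
        ≡⟨ cong₂ _+_ (∑³-*ˡ n V (λ b a c → 𝟙 (w x b a c)))
                     (trans (∑³-*ˡ 2 V (λ b a c → ∑[ y ← V ] 𝟙 (w x b a c ∧ ext y b a c)))
                            (cong (2 *_) (sym (∑-∑³-swap V V (λ y b a c → 𝟙 (w x b a c ∧ ext y b a c)))))) ⟩
      n * W x + 2 * ∑ V cc ∎
      where
      open ≤-Reasoning
      each : ∀ b a c → 3 * D * 𝟙 (w x b a c) ≤ n * 𝟙 (w x b a c) + 2 * ∑[ y ← V ] 𝟙 (w x b a c ∧ ext y b a c)
      each b a c = begin
        3 * D * 𝟙 (w x b a c)
          ≡⟨ *-comm (3 * D) (𝟙 (w x b a c)) ⟩
        𝟙 (w x b a c) * (3 * D)
          ≤⟨ guard (w x b a c) (λ h → ext-many (proj₁ (∧-true {e b a c} (proj₂ (∧-true {e x b a} h))))) ⟩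
        𝟙 (w x b a c) * (n + 2 * ∑[ y ← V ] 𝟙 (ext y b a c))
          ≡⟨ eq (𝟙 (w x b a c)) n _ ⟩
        n * 𝟙 (w x b a c) + 2 * (𝟙 (w x b a c) * ∑[ y ← V ] 𝟙 (ext y b a c))
          ≡⟨ cong (λ m → n * 𝟙 (w x b a c) + 2 * m) (sym (∑-∧ (w x b a c) V (λ y → ext y b a c))) ⟩
        n * 𝟙 (w x b a c) + 2 * ∑[ y ← V ] 𝟙 (w x b a c ∧ ext y b a c) ∎
        where
        eq : ∀ i n X → i * (n + 2 * X) ≡ n * i + 2 * (i * X)
        eq = solve-∀

    module _ (c : ℕ) (4k²≤c : 4 * (k * k) ≤ c) (0<c : 0 < c) where

      reached : ℕ
      reached = ∑[ y ← V ] 𝟙 (reachᵇ 0 c x y)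

      -- A vertex that is not reached at density `1 / c` accounts for fewer than `n³ / c` of the
      -- words; a reached one is bounded trivially by `W x`.
      cc-reached : c * ∑ V cc ≤ c * W x * reached + n * (n * n * n)
      cc-reached = begin
        c * ∑ V cc
          ≡⟨ sym (∑-*ˡ c V cc) ⟩
        ∑[ y ← V ] (c * cc y)
          ≤⟨ ∑-mono V each ⟩
        ∑[ y ← V ] (c * W x * 𝟙 (reachᵇ 0 c x y) + n * n * n)
          ≡⟨ ∑-+ V _ _ ⟩
        ∑[ y ← V ] (c * W x * 𝟙 (reachᵇ 0 c x y)) + ∑[ y ← V ] (n * n * n)
          ≡⟨ cong₂ _+_ (∑-*ˡ (c * W x) V (λ y → 𝟙 (reachᵇ 0 c x y))) (∑-V-const (n * n * n)) ⟩
        c * W x * reached + n * (n * n * n) ∎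
        where
        open ≤-Reasoning
        cube : ∀ n → n * (n * (n * 1)) ≡ n * n * n
        cube = solve-∀
        each : ∀ y → c * cc y ≤ c * W x * 𝟙 (reachᵇ 0 c x y) + n * n * n
        each y = by-cases (reachᵇ 0 c x y) refl
          where
          by-cases : ∀ b → reachᵇ 0 c x y ≡ b → c * cc y ≤ c * W x * 𝟙 b + n * n * n
          by-cases true  _ = ≤-trans (c ⊙ cc≤W y) (≤-trans (≤-reflexive (sym (*-identityʳ _))) (m≤m+n _ _))
          by-cases false h = ≤-trans (c ⊙ cc≤Ex y) (≤-trans (<⇒≤ (≰⇒> (λ p → does-false (reach? 0 c x y) h (reach p))))
            (≤-trans (≤-reflexive (cube n)) (m≤n+m (n * n * n) _)))

      -- Dividing the two preceding counts by `W x ≥ n³ / 2k` gives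
      -- `3D - n ≤ 2 * reached + 4kn / c`. The left side is at least `n/2 + 3g`, and the error is at
      -- most `g` because `4k² ≤ c` and `n ≤ kg`.
      reached-many : n + 4 * g ≤ 4 * reached
      reached-many = *-cancelˡ-≤ c {{>-nonZero 0<c}} (lin 0
        ((2 ⊙ bound) ⊕ (3 * c) ⊙ half ⊕ (8 * k) ⊙ dense ⊕ (2 * g) ⊙ 4k²≤c) (eq c n g reached D k))
        where
        0<W : 0 < W x
        0<W = n≢0⇒n>0 λ W≡0 → <⇒≱ (*-mono-< (*-mono-< 2≤n 2≤n) 2≤n)
          (≤-trans (W-large x) (≤-trans (≤-reflexive (trans (cong (2 * k *_) W≡0) (*-zeroʳ (2 * k)))) z≤n))
        bound : 3 * c * D ≤ c * n + 2 * c * reached + 4 * k * n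
        bound = *-cancelʳ-≤ _ _ (W x) {{>-nonZero 0<W}}
          (lin 0 (c ⊙ cc-total ⊕ 2 ⊙ cc-reached ⊕ (2 * n) ⊙ W-large x) (eq′ c D (W x) n (∑ V cc) reached k))
          where
          eq′ : ∀ c D W n S r k →
            (c * n + 2 * c * r + 4 * k * n) * W + (c * (3 * D * W) + 2 * (c * S) + 2 * n * (n * n * n))
            ≡ 3 * c * D * W + (c * (n * W + 2 * S) + 2 * (c * W * r + n * (n * n * n)) + 2 * n * (2 * k * W)) + 0
          eq′ = solve-∀
        eq : ∀ c n g r D k →
          c * (4 * r) + (2 * (3 * c * D) + 3 * c * (n + 2 * g) + 8 * k * n + 2 * g * (4 * (k * k)))
          ≡ c * (n + 4 * g) + (2 * (c * n + 2 * c * r + 4 * k * n) + 3 * c * (2 * D) + 8 * k * (k * g) + 2 * g * c) + 0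
        eq = solve-∀

-- Excluding a stable class of at most about half the vertices

bool-cases : ∀ b → (b ≡ true) ⊎ (b ≡ false)
bool-cases true  = inj₁ refl
bool-cases false = inj₂ refl

true≢false : ∀ {b} → b ≡ true → b ≡ false → ⊥
true≢false refl ()

not-true : ∀ {b} → b ≡ false → not b ≡ true
not-true refl = refl

𝟙-one-of-3 : ∀ t x y z a b c → (t ≡ true → x ≡ false → y ≡ false → z ≡ false → a ≡ false → b ≡ false → c ≡ false → ⊥) →
             𝟙 t ≤ 𝟙 x + 𝟙 y + 𝟙 z + (𝟙 a + 𝟙 b + 𝟙 c)
𝟙-one-of-3 false x y z a b c h = z≤n
𝟙-one-of-3 true true  y     z     a b c h = s≤s z≤n
𝟙-one-of-3 true false true  z     a b c h = s≤s z≤n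
𝟙-one-of-3 true false false true  a b c h = s≤s z≤n
𝟙-one-of-3 true false false false true  b     c     h = s≤s z≤n
𝟙-one-of-3 true false false false false true  c     h = s≤s z≤n
𝟙-one-of-3 true false false false false false true  h = s≤s z≤n
𝟙-one-of-3 true false false false false false false h = ⊥-elim (h refl refl refl refl refl refl refl)

at-least-3-swap₂₃ : ∀ p q r s → at-least-3 p q r s ≡ at-least-3 p r q s
at-least-3-swap₂₃ true  true  true  s     = refl
at-least-3-swap₂₃ true  true  false true  = refl
at-least-3-swap₂₃ true  true  false false = refl
at-least-3-swap₂₃ true  false true  true  = refl
at-least-3-swap₂₃ true  false true  false = refl
at-least-3-swap₂₃ true  false false s     = refl
at-least-3-swap₂₃ false true  true  s     = refl
at-least-3-swap₂₃ false true  false s     = refl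
at-least-3-swap₂₃ false false true  s     = refl
at-least-3-swap₂₃ false false false s     = refl

at-least-3-swap₁₂ : ∀ p q r s → at-least-3 p q r s ≡ at-least-3 q p r s
at-least-3-swap₁₂ true  true  r s = refl
at-least-3-swap₁₂ true  false r s = refl
at-least-3-swap₁₂ false true  r s = refl
at-least-3-swap₁₂ false false r s = refl

at-least-3⇒2 : ∀ p q r s → at-least-3 p q r s ≡ true → p ≡ true → at-least-2 q r s ≡ true
at-least-3⇒2 true true  true  s    h refl = refl
at-least-3⇒2 true true  false true h refl = refl
at-least-3⇒2 true false true  true h refl = refl

module _ {n : ℕ} (e : Fin n → Fin n → Fin n → Bool)
  (sym₁₂ : ∀ x y z → e x y z ≡ e y x z) (sym₂₃ : ∀ x y z → e x y z ≡ e x z y)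
  (irr : ∀ x z → e x x z ≡ false)
  (D g k : ℕ) (codeg : ∀ x y → x ≢ y → D ≤ ∑[ z ← Tiles.V e ] 𝟙 (e x y z))
  (half : n + 2 * g ≤ 2 * D) (dense : n ≤ k * g) (2≤n : 2 ≤ n) where

  open Codegree e sym₁₂ sym₂₃ irr D g k codeg half dense 2≤n

  tile-swap₂₃ : ∀ a b c d → tile a b c d ≡ tile a c b d
  tile-swap₂₃ a b c d rewrite sym₂₃ a b c | sym₁₂ b c d = at-least-3-swap₂₃ (e a c b) (e a b d) (e a c d) (e c b d)

  tile-swap₃₄ : ∀ a b c d → tile a b c d ≡ tile a b d c
  tile-swap₃₄ a b c d rewrite sym₂₃ a c d | sym₂₃ b c d = at-least-3-swap₁₂ (e a b c) (e a b d) (e a d c) (e b d c)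

  tile-ext : ∀ {a b c d} → tile a b c d ≡ true → e a b c ≡ true → ext d a b c ≡ true
  tile-ext {a} {b} {c} {d} h₁ h₂ rewrite sym (rot d a b) | sym (rot d a c) | sym (rot d b c) =
    at-least-3⇒2 (e a b c) (e d a b) (e d a c) (e d b c) h₁ h₂

  tile-≢₁₂ : ∀ {a b c d} → tile a b c d ≡ true → a ≢ b
  tile-≢₁₂ {a} {.a} {c} {d} h refl rewrite irr a c | irr a d with h
  ... | ()

  -- P is a class of mutually exchangeable vertices (p is its indicator) that hardly grows to P⁺ at
  -- the next level of exchangeability; 1/E is the density of all exceptional sets.
  module Class (p p⁺ : Fin n → Bool) (near : Fin n → Fin n → Bool) (E : ℕ)
    (p⊆p⁺ : ∀ v → p v ≡ true → p⁺ v ≡ true) where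

    q : Fin n → Bool
    q v = not (p⁺ v)

    #P #P⁺ : ℕ
    #P  = ∑[ v ← V ] 𝟙 (p v)
    #P⁺ = ∑[ v ← V ] 𝟙 (p⁺ v)

    N : Fin n → Fin n → ℕ
    N a b = ∑[ v ← V ] 𝟙 (p v ∧ e v a b)

    α β : Fin n → Fin n → Fin n → ℕ
    α a b c = ∑[ v ← V ] 𝟙 (p v ∧ ext v a b c)
    β a b c = ∑[ v ← V ] 𝟙 (q v ∧ ext v a b c)

    -- In the application `monochrome` and `transfer` hold because a vertex `v` violating them would
    -- belong to `P⁺`. The purpose of `transfer` is to keep `f` out of `P`: for exchangeable `c` and
    -- `f`, the tiles `a b c d` and `a b f v` would exchange `d` in `P` with `v`.
    module Contradiction
      (large : n + 4 * g ≤ 4 * #P)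
      (small : E * (2 * #P) ≤ E * n + n)
      (stable : E * #P⁺ ≤ E * #P + n)
      (monochrome : ∀ v → q v ≡ true →
        E * ∑[ d ← V ] ∑³ V (λ a b c → 𝟙 (p d ∧ tile d a b c ∧ tile v a b c)) ≤ 2 * n ^ 4)
      (transfer : ∀ v → q v ≡ true →
        E * ∑[ a ← V ] ∑[ b ← V ] ∑[ c ← V ] ∑[ f ← V ] ∑[ d ← V ]
          𝟙 (p d ∧ near c f ∧ tile a b c d ∧ tile a b f v) ≤ n ^ 5)
      (mostly-near : E * ∑[ c ← V ] ∑[ f ← V ] 𝟙 (p c ∧ p f ∧ not (near c f)) ≤ 8 * k * n ^ 2)
      (D≤n : D ≤ n) (6≤g : 6 ≤ g) (60≤k : 60 ≤ k) (E-large : k * k * k * k * k * k * k ≤ E) where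

      -- Fewer than `n / θ` completions count as few. As `n / θ ≤ g / 3`, the three uses of this
      -- threshold in `no-typical-fan` lose at most `g` together.
      θ : ℕ
      θ = 3 * k

      -- A bad edge is counted once for each of its completions on the stated side. With this weight
      -- the bad edges are controlled by the sum of `α * β`, whereas their bare number is not.
      badA badB : Fin n → Fin n → Fin n → Fin n → Bool
      badA a b c d = e a b c ∧ (n ≤ᵇ θ * β a b c) ∧ (p d ∧ ext d a b c)
      badB a b c v = e a b c ∧ (n ≤ᵇ θ * α a b c) ∧ (q v ∧ ext v a b c)

      mixed : ℕ
      mixed = ∑³ V (λ a b c → 𝟙 (e a b c) * (α a b c * β a b c))

      mixed-few : E * mixed ≤ 2 * n ^ 5
      mixed-few = begin
        E * mixed
          ≤⟨ E ⊙ ∑³-mono V each ⟩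
        E * ∑³ V (λ a b c → ∑[ v ← V ] ∑[ d ← V ] (𝟙 (q v) * F d v a b c))
          ≡⟨ cong (E *_) (sym (∑-∑³-swap V V (λ v a b c → ∑[ d ← V ] (𝟙 (q v) * F d v a b c)))) ⟩
        E * ∑[ v ← V ] ∑³ V (λ a b c → ∑[ d ← V ] (𝟙 (q v) * F d v a b c))
          ≡⟨ cong (E *_) (∑-cong V (λ v → sym (∑-∑³-swap V V (λ d a b c → 𝟙 (q v) * F d v a b c)))) ⟩
        E * ∑[ v ← V ] ∑[ d ← V ] ∑³ V (λ a b c → 𝟙 (q v) * F d v a b c)
          ≡⟨ cong (E *_) (∑-cong V (λ v → trans (∑-cong V (λ d → ∑³-*ˡ (𝟙 (q v)) V (F d v)))
                                               (∑-*ˡ (𝟙 (q v)) V (λ d → ∑³ V (F d v))))) ⟩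
        E * ∑[ v ← V ] (𝟙 (q v) * ∑[ d ← V ] ∑³ V (F d v))
          ≡⟨ sym (∑-*ˡ E V (λ v → 𝟙 (q v) * ∑[ d ← V ] ∑³ V (F d v))) ⟩
        ∑[ v ← V ] (E * (𝟙 (q v) * ∑[ d ← V ] ∑³ V (F d v)))
          ≤⟨ ∑-V-≤const (2 * n ^ 4) per-v ⟩
        n * (2 * n ^ 4)
          ≡⟨ eq n (n ^ 4) ⟩
        2 * n ^ 5 ∎
        where
        open ≤-Reasoning
        F : Fin n → Fin n → Fin n → Fin n → Fin n → ℕ
        F d v a b c = 𝟙 (p d ∧ tile d a b c ∧ tile v a b c)
        eq : ∀ n m → n * (2 * m) ≡ 2 * (n * m)
        eq = solve-∀
        eq′ : ∀ E i x → E * (i * x) ≡ i * (E * x)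
        eq′ = solve-∀
        per-v : ∀ v → E * (𝟙 (q v) * ∑[ d ← V ] ∑³ V (F d v)) ≤ 2 * n ^ 4
        per-v v = ≤-trans (≤-reflexive (eq′ E (𝟙 (q v)) _)) (≤-trans (guard (q v) (monochrome v))
          (≤-trans (*-monoˡ-≤ (2 * n ^ 4) (𝟙≤1 (q v))) (≤-reflexive (*-identityˡ _))))
        each : ∀ a b c → 𝟙 (e a b c) * (α a b c * β a b c) ≤ ∑[ v ← V ] ∑[ d ← V ] (𝟙 (q v) * F d v a b c)
        each a b c = begin
          𝟙 (e a b c) * (α a b c * β a b c)
            ≡⟨ cong (𝟙 (e a b c) *_) (trans (*-comm (α a b c) (β a b c))
                 (sym (∑-product V V (λ v → 𝟙 (q v ∧ ext v a b c)) (λ d → 𝟙 (p d ∧ ext d a b c))))) ⟩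
          𝟙 (e a b c) * ∑[ v ← V ] ∑[ d ← V ] (𝟙 (q v ∧ ext v a b c) * 𝟙 (p d ∧ ext d a b c))
            ≡⟨ sym (∑-*ˡ (𝟙 (e a b c)) V _) ⟩
          ∑[ v ← V ] (𝟙 (e a b c) * ∑[ d ← V ] (𝟙 (q v ∧ ext v a b c) * 𝟙 (p d ∧ ext d a b c)))
            ≡⟨ ∑-cong V (λ v → sym (∑-*ˡ (𝟙 (e a b c)) V _)) ⟩
          ∑[ v ← V ] ∑[ d ← V ] (𝟙 (e a b c) * (𝟙 (q v ∧ ext v a b c) * 𝟙 (p d ∧ ext d a b c)))
            ≤⟨ ∑-mono V (λ v → ∑-mono V (λ d → at v d)) ⟩
          ∑[ v ← V ] ∑[ d ← V ] (𝟙 (q v) * F d v a b c) ∎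
          where
          at : ∀ v d → 𝟙 (e a b c) * (𝟙 (q v ∧ ext v a b c) * 𝟙 (p d ∧ ext d a b c)) ≤ 𝟙 (q v) * F d v a b c
          at v d with bool-cases (e a b c)
          ... | inj₂ h rewrite h = z≤n
          ... | inj₁ h = begin
            𝟙 (e a b c) * (𝟙 (q v ∧ ext v a b c) * 𝟙 (p d ∧ ext d a b c))
              ≤⟨ ≤-trans (*-monoˡ-≤ _ (𝟙≤1 (e a b c))) (≤-reflexive (*-identityˡ _)) ⟩
            𝟙 (q v ∧ ext v a b c) * 𝟙 (p d ∧ ext d a b c)
              ≤⟨ factor (q v) (ext v a b c) (p d ∧ ext d a b c) (p d ∧ tile d a b c ∧ tile v a b c)
                   (λ hv hd → let p₁ , p₂ = ∧-true {p d} hd in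
                     p₁ ∧ᵗ ext-tile {d} {a} {b} {c} p₂ h ∧ᵗ ext-tile {v} {a} {b} {c} hv h) ⟩
            𝟙 (q v) * F d v a b c ∎
            where
            factor : ∀ q′ y x z → (y ≡ true → x ≡ true → z ≡ true) → 𝟙 (q′ ∧ y) * 𝟙 x ≤ 𝟙 q′ * 𝟙 z
            factor false y     x h = λ _ → z≤n
            factor true  false x h = λ _ → z≤n
            factor true  true  false h = λ _ → z≤n
            factor true  true  true  z h rewrite h refl refl = ≤-refl

      -- Markov's inequality against `mixed`: where `δ ≥ n / θ`, the weight `γ` is at most `θ / n`
      -- times `α * β`. It is applied with `α` and `β` in either role.
      bad-few : ∀ (γ δ : Fin n → Fin n → Fin n → ℕ) (r : Fin n → Bool) →
                (∀ a b c → γ a b c ≡ ∑[ v ← V ] 𝟙 (r v ∧ ext v a b c)) →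
                (∀ a b c → γ a b c * δ a b c ≡ α a b c * β a b c) →
                E * ∑³ V (λ a b c → ∑[ v ← V ] 𝟙 (e a b c ∧ (n ≤ᵇ θ * δ a b c) ∧ (r v ∧ ext v a b c)))
                ≤ 2 * θ * n ^ 4
      bad-few γ δ r γ≡ γδ≡ = *-cancelˡ-≤ n {{>-nonZero (≤-trans (s≤s z≤n) 2≤n)}} (begin
        n * (E * X)
          ≡⟨ eq₁ n E X ⟩
        E * (n * X)
          ≤⟨ E ⊙ nX ⟩
        E * (θ * mixed)
          ≡⟨ eq₂ E θ mixed ⟩
        θ * (E * mixed)
          ≤⟨ θ ⊙ mixed-few ⟩
        θ * (2 * n ^ 5)
          ≡⟨ eq₃ θ n (n ^ 4) ⟩
        n * (2 * θ * n ^ 4) ∎)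
        where
        open ≤-Reasoning
        B : Fin n → Fin n → Fin n → Bool
        B a b c = n ≤ᵇ θ * δ a b c
        X = ∑³ V (λ a b c → ∑[ v ← V ] 𝟙 (e a b c ∧ B a b c ∧ (r v ∧ ext v a b c)))
        eq₁ : ∀ n E X → n * (E * X) ≡ E * (n * X)
        eq₁ = solve-∀
        eq₂ : ∀ E θ m → E * (θ * m) ≡ θ * (E * m)
        eq₂ = solve-∀
        eq₃ : ∀ θ n m → θ * (2 * (n * m)) ≡ n * (2 * θ * m)
        eq₃ = solve-∀
        each : ∀ a b c → n * ∑[ v ← V ] 𝟙 (e a b c ∧ B a b c ∧ (r v ∧ ext v a b c))
                         ≤ θ * (𝟙 (e a b c) * (α a b c * β a b c))
        each a b c = begin
          n * ∑[ v ← V ] 𝟙 (e a b c ∧ B a b c ∧ (r v ∧ ext v a b c))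
            ≡⟨ cong (n *_) (∑-∧ (e a b c) V (λ v → B a b c ∧ (r v ∧ ext v a b c))) ⟩
          n * (𝟙 (e a b c) * ∑[ v ← V ] 𝟙 (B a b c ∧ (r v ∧ ext v a b c)))
            ≡⟨ cong (λ x → n * (𝟙 (e a b c) * x)) (trans (∑-∧ (B a b c) V (λ v → r v ∧ ext v a b c))
                 (cong (𝟙 (B a b c) *_) (sym (γ≡ a b c)))) ⟩
          n * (𝟙 (e a b c) * (𝟙 (B a b c) * γ a b c))
            ≡⟨ eq₄ n (𝟙 (e a b c)) (𝟙 (B a b c)) (γ a b c) ⟩
          𝟙 (e a b c) * γ a b c * (𝟙 (B a b c) * n)
            ≤⟨ (𝟙 (e a b c) * γ a b c) ⊙ guard (B a b c) true-≤ᵇ ⟩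
          𝟙 (e a b c) * γ a b c * (𝟙 (B a b c) * (θ * δ a b c))
            ≤⟨ (𝟙 (e a b c) * γ a b c) ⊙ *-monoˡ-≤ (θ * δ a b c) (𝟙≤1 (B a b c)) ⟩
          𝟙 (e a b c) * γ a b c * (1 * (θ * δ a b c))
            ≡⟨ eq₅ (𝟙 (e a b c)) (γ a b c) θ (δ a b c) ⟩
          θ * (𝟙 (e a b c) * (γ a b c * δ a b c))
            ≡⟨ cong (λ x → θ * (𝟙 (e a b c) * x)) (γδ≡ a b c) ⟩
          θ * (𝟙 (e a b c) * (α a b c * β a b c)) ∎
          where
          eq₄ : ∀ n i j y → n * (i * (j * y)) ≡ i * y * (j * n)
          eq₄ = solve-∀
          eq₅ : ∀ i y t d → i * y * (1 * (t * d)) ≡ t * (i * (y * d))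
          eq₅ = solve-∀
        nX : n * X ≤ θ * mixed
        nX = begin
          n * X
            ≡⟨ sym (∑³-*ˡ n V (λ a b c → ∑[ v ← V ] 𝟙 (e a b c ∧ B a b c ∧ (r v ∧ ext v a b c)))) ⟩
          ∑³ V (λ a b c → n * ∑[ v ← V ] 𝟙 (e a b c ∧ B a b c ∧ (r v ∧ ext v a b c)))
            ≤⟨ ∑³-mono V each ⟩
          ∑³ V (λ a b c → θ * (𝟙 (e a b c) * (α a b c * β a b c)))
            ≡⟨ ∑³-*ˡ θ V (λ a b c → 𝟙 (e a b c) * (α a b c * β a b c)) ⟩
          θ * mixed ∎

      badA-few : E * ∑³ V (λ a b c → ∑[ d ← V ] 𝟙 (badA a b c d)) ≤ 2 * θ * n ^ 4
      badA-few = bad-few α β p (λ _ _ _ → refl) (λ _ _ _ → refl)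

      badB-few : E * ∑³ V (λ a b c → ∑[ v ← V ] 𝟙 (badB a b c v)) ≤ 2 * θ * n ^ 4
      badB-few = bad-few β α q (λ _ _ _ → refl) (λ a b c → *-comm (β a b c) (α a b c))

      -- Outside `P⁺` a common neighbour of `a b` and `a c` is counted by `β`, so both
      -- neighbourhoods together occupy at most `n - |P⁺| + β` there. In the shell between `P` and
      -- `P⁺` every vertex may count twice, inside `P` the count is `N a b + N a c`.
      N-sum : ∀ {a b c} → a ≢ b → a ≢ c → 2 * D + 2 * #P ≤ N a b + N a c + #P⁺ + n + β a b c
      N-sum {a} {b} {c} a≢b a≢c = begin
        2 * D + 2 * #P
          ≤⟨ +-monoˡ-≤ (2 * #P) (≤-trans (≤-reflexive (cong (D +_) (+-identityʳ D))) (codeg₁ a b a≢b ⊕ codeg₁ a c a≢c)) ⟩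
        ∑[ v ← V ] 𝟙 (e v a b) + ∑[ v ← V ] 𝟙 (e v a c) + 2 * #P
          ≡⟨ cong₂ _+_ (sym (∑-+ V _ _)) (sym (∑-*ˡ 2 V (λ v → 𝟙 (p v)))) ⟩
        ∑[ v ← V ] (𝟙 (e v a b) + 𝟙 (e v a c)) + ∑[ v ← V ] (2 * 𝟙 (p v))
          ≡⟨ sym (∑-+ V _ _) ⟩
        ∑[ v ← V ] (𝟙 (e v a b) + 𝟙 (e v a c) + 2 * 𝟙 (p v))
          ≤⟨ ∑-mono V (λ v → point (p v) (p⁺ v) (e v a b) (e v a c) (e v b c) (p⊆p⁺ v)) ⟩
        ∑[ v ← V ] (1 + (𝟙 (p v ∧ e v a b) + 𝟙 (p v ∧ e v a c) + 𝟙 (p⁺ v) + 𝟙 (q v ∧ ext v a b c)))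
          ≡⟨ ∑-V-1+ _ ⟩
        n + ∑[ v ← V ] (𝟙 (p v ∧ e v a b) + 𝟙 (p v ∧ e v a c) + 𝟙 (p⁺ v) + 𝟙 (q v ∧ ext v a b c))
          ≡⟨ cong (n +_) (trans (∑-+ V _ _) (cong (_+ β a b c) (trans (∑-+ V _ _) (cong (_+ #P⁺) (∑-+ V _ _))))) ⟩
        n + (N a b + N a c + #P⁺ + β a b c)
          ≡⟨ eq n (N a b) (N a c) #P⁺ (β a b c) ⟩
        N a b + N a c + #P⁺ + n + β a b c ∎
        where
        open ≤-Reasoning
        eq : ∀ n x y z w → n + (x + y + z + w) ≡ x + y + z + n + w
        eq = solve-∀
        point : ∀ p p⁺ x y z → (p ≡ true → p⁺ ≡ true) →
          𝟙 x + 𝟙 y + 2 * 𝟙 p ≤ 1 + (𝟙 (p ∧ x) + 𝟙 (p ∧ y) + 𝟙 p⁺ + 𝟙 (not p⁺ ∧ at-least-2 x y z))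
        point true  false x y z h with h refl
        ... | ()
        point true  true  x y z h = ≤-reflexive (eq₁ (𝟙 x) (𝟙 y))
          where
          eq₁ : ∀ x y → x + y + 2 ≡ 1 + (x + y + 1 + 0)
          eq₁ = solve-∀
        point false true  true  true  z h = ≤-refl
        point false true  true  false z h = s≤s z≤n
        point false true  false true  z h = s≤s z≤n
        point false true  false false z h = z≤n
        point false false true  true  z h = ≤-refl
        point false false true  false z h = s≤s z≤n
        point false false false true  z h = s≤s z≤n
        point false false false false z h = z≤n

      N-overlap : ∀ a b c → N a b + N a c ≤ #P + α a b c
      N-overlap a b c = begin
        N a b + N a c
          ≡⟨ sym (∑-+ V _ _) ⟩
        ∑[ v ← V ] (𝟙 (p v ∧ e v a b) + 𝟙 (p v ∧ e v a c))
          ≤⟨ ∑-mono V (λ v → point (p v) (e v a b) (e v a c) (e v b c)) ⟩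
        ∑[ v ← V ] (𝟙 (p v) + 𝟙 (p v ∧ ext v a b c))
          ≡⟨ ∑-+ V _ _ ⟩
        #P + α a b c ∎
        where
        open ≤-Reasoning
        point : ∀ p x y z → 𝟙 (p ∧ x) + 𝟙 (p ∧ y) ≤ 𝟙 p + 𝟙 (p ∧ at-least-2 x y z)
        point false x     y     z = z≤n
        point true  true  true  z = ≤-refl
        point true  true  false z = s≤s z≤n
        point true  false true  z = s≤s z≤n
        point true  false false z = z≤n

      0<k : 0 < k
      0<k = ≤-trans (s≤s z≤n) 60≤k

      3k≤E : 3 * k ≤ E
      3k≤E = ≤-trans (≤-trans (*-monoˡ-≤ k (≤-trans (m≤n+m 3 57) 60≤k)) k²≤k⁷) E-large
        where
        1≤k : 1 ≤ k
        1≤k = 0<k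
        k²≤k⁷ : k * k ≤ k * k * k * k * k * k * k
        k²≤k⁷ = begin
          k * k                      ≡⟨ eq (k * k) ⟩
          k * k * 1 * 1 * 1 * 1 * 1  ≤⟨ *-mono-≤ (*-mono-≤ (*-mono-≤ (*-mono-≤ ((k * k) ⊙ 1≤k) 1≤k) 1≤k) 1≤k) 1≤k ⟩
          k * k * k * k * k * k * k  ∎
          where
          open ≤-Reasoning
          eq : ∀ m → m ≡ m * 1 * 1 * 1 * 1 * 1
          eq = solve-∀

      0<E : 0 < E
      0<E = ≤-trans (≤-trans 0<k (m≤m+n k _)) 3k≤E

      inP : Fin n → Fin n → Fin n → Bool
      inP b c d = p b ∧ p c ∧ p d

      O : ℕ
      O = ∑[ a ← V ] ∑³ V (λ b c d → 𝟙 (inP b c d ∧ tile a b c d))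

      S : (Fin n → Fin n → ℕ) → ℕ
      S G = ∑[ b ← V ] ∑[ c ← V ] (𝟙 (p b ∧ p c) * G b c)

      inP-sum : ∀ G → ∑³ V (λ b c d → 𝟙 (inP b c d) * G b c) ≡ S G * #P
      inP-sum G = trans (∑-cong V (λ b → trans (∑-cong V (λ c → at b c)) (∑-*ʳ #P V _))) (∑-*ʳ #P V _)
        where
        eq : ∀ i j l x → i * (j * l) * x ≡ i * j * x * l
        eq = solve-∀
        at : ∀ b c → ∑[ d ← V ] (𝟙 (inP b c d) * G b c) ≡ 𝟙 (p b ∧ p c) * G b c * #P
        at b c = trans (∑-cong V (λ d → begin
          𝟙 (inP b c d) * G b c
            ≡⟨ cong (_* G b c) (trans (𝟙-* (p b) (p c ∧ p d)) (cong (𝟙 (p b) *_) (𝟙-* (p c) (p d)))) ⟩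
          𝟙 (p b) * (𝟙 (p c) * 𝟙 (p d)) * G b c
            ≡⟨ eq (𝟙 (p b)) (𝟙 (p c)) (𝟙 (p d)) (G b c) ⟩
          𝟙 (p b) * 𝟙 (p c) * G b c * 𝟙 (p d)
            ≡⟨ cong (λ x → x * G b c * 𝟙 (p d)) (sym (𝟙-* (p b) (p c))) ⟩
          𝟙 (p b ∧ p c) * G b c * 𝟙 (p d) ∎)) (∑-*ˡ (𝟙 (p b ∧ p c) * G b c) V (λ d → 𝟙 (p d)))
          where open ≡-Reasoning

      inP-rot : ∀ b c d → 𝟙 (inP b c d) ≡ 𝟙 (inP c d b)
      inP-rot b c d with p b | p c | p d
      ... | true  | true  | true  = refl
      ... | true  | true  | false = refl
      ... | true  | false | true  = refl
      ... | true  | false | false = refl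
      ... | false | true  | true  = refl
      ... | false | true  | false = refl
      ... | false | false | true  = refl
      ... | false | false | false = refl

      inP-swap : ∀ b c d → 𝟙 (inP b c d) ≡ 𝟙 (inP b d c)
      inP-swap b c d = cong (λ x → 𝟙 (p b ∧ x)) (Bool.∧-comm (p c) (p d))

      inP-sum₁₃ : ∀ G → ∑³ V (λ b c d → 𝟙 (inP b c d) * G b d) ≡ S G * #P
      inP-sum₁₃ G = trans (∑³-cong V (λ b c d → cong (_* G b d) (inP-swap b c d)))
        (trans (∑³-swap₂₃ V (λ b c d → 𝟙 (inP b c d) * G b c)) (inP-sum G))

      inP-sum₂₃ : ∀ G → ∑³ V (λ b c d → 𝟙 (inP b c d) * G c d) ≡ S G * #P
      inP-sum₂₃ G = trans (∑³-cong V (λ b c d → cong (_* G c d) (inP-rot b c d)))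
        (trans (∑³-rotˡ V (λ b c d → 𝟙 (inP b c d) * G b c)) (inP-sum G))

      S-const : ∀ x → S (λ _ _ → x) ≡ x * (#P * #P)
      S-const x = trans (∑-cong V (λ b → trans (∑-cong V (λ c → cong (_* x) (𝟙-* (p b) (p c)))) (∑-*ʳ x V _)))
        (trans (∑-*ʳ x V _) (trans (cong (_* x) (∑-product V V (λ b → 𝟙 (p b)) (λ c → 𝟙 (p c)))) (*-comm _ x)))

      S-diagonal : S (λ b c → 𝟙 (b == c)) ≤ #P
      S-diagonal = ∑-mono V (λ b → begin
        ∑[ c ← V ] (𝟙 (p b ∧ p c) * 𝟙 (b == c))
          ≤⟨ ∑-mono V (λ c → ≤-trans (*-monoˡ-≤ (𝟙 (b == c)) (𝟙-mono (λ h → proj₁ (∧-true {p b} h))))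
                                     (≤-reflexive (*-comm (𝟙 (p b)) (𝟙 (b == c))))) ⟩
        ∑[ c ← V ] (𝟙 (b == c) * 𝟙 (p b))
          ≡⟨ ∑-delta b (λ _ → 𝟙 (p b)) ⟩
        𝟙 (p b) ∎)
        where open ≤-Reasoning

      M : Fin n → Fin n → Fin n → ℕ
      M b c d = ∑[ v ← V ] 𝟙 (tile v b c d)

      O-M : ∑³ V (λ b c d → 𝟙 (inP b c d) * M b c d) ≡ O
      O-M = trans (∑³-cong V (λ b c d → sym (∑-∧ (inP b c d) V (λ v → tile v b c d))))
                  (sym (∑-∑³-swap V V (λ v b c d → 𝟙 (inP b c d ∧ tile v b c d))))

      codeg₁′ : ∀ b c → D ≤ ∑[ v ← V ] 𝟙 (e v b c) + n * 𝟙 (b == c)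
      codeg₁′ b c = by-cases (b == c) refl
        where
        by-cases : ∀ x → (b == c) ≡ x → D ≤ ∑[ v ← V ] 𝟙 (e v b c) + n * 𝟙 x
        by-cases true  _ = ≤-trans D≤n (≤-trans (≤-reflexive (sym (*-identityʳ n))) (m≤n+m (n * 1) _))
        by-cases false h = ≤-trans (codeg₁ b c (==-false h)) (m≤m+n _ _)

      -- A vertex outside `P` is adjacent to at most two of the three pairs unless it forms a tile
      -- with `b c d`; the neighbours inside `P` are counted by `N`. The last summand covers triples
      -- with a repeated vertex, where the codegree hypothesis fails.
      outside : ∀ b c d → 3 * D + 2 * #P ≤ M b c d + 2 * n + (N b c + N b d + N c d)
                                          + n * (𝟙 (b == c) + 𝟙 (b == d) + 𝟙 (c == d))
      outside b c d = lin 0 (codeg₁′ b c ⊕ codeg₁′ b d ⊕ codeg₁′ c d ⊕ total)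
        (eq D #P n (M b c d) (N b c + N b d + N c d) (𝟙 (b == c)) (𝟙 (b == d)) (𝟙 (c == d))
            (∑[ v ← V ] 𝟙 (e v b c)) (∑[ v ← V ] 𝟙 (e v b d)) (∑[ v ← V ] 𝟙 (e v c d)))
        where
        eq : ∀ D P n M N i j l x y z →
          M + 2 * n + N + n * (i + j + l) + (D + D + D + (x + y + z + 2 * P))
          ≡ 3 * D + 2 * P + (x + n * i + (y + n * j) + (z + n * l) + (2 * n + (N + M))) + 0
        eq = solve-∀
        point : ∀ p x y z w → 𝟙 x + 𝟙 y + 𝟙 z + 2 * 𝟙 p
                ≤ 2 + (𝟙 (p ∧ x) + 𝟙 (p ∧ y) + 𝟙 (p ∧ z) + 𝟙 (at-least-3 x y z w))
        point true  x     y     z     w = ≤-trans (≤-reflexive (+-comm _ 2)) (s≤s (s≤s (m≤m+n _ _)))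
        point false true  true  true  w = s≤s (s≤s (s≤s z≤n))
        point false true  true  false w = s≤s (s≤s z≤n)
        point false true  false true  w = s≤s (s≤s z≤n)
        point false true  false false w = s≤s z≤n
        point false false true  true  w = s≤s (s≤s z≤n)
        point false false true  false w = s≤s z≤n
        point false false false true  w = s≤s z≤n
        point false false false false w = z≤n
        split : ∀ (f g h i : Fin n → ℕ) → ∑[ v ← V ] (f v + g v + h v + i v) ≡ ∑ V f + ∑ V g + ∑ V h + ∑ V i
        split f g h i = trans (∑-+ V _ i) (cong (_+ ∑ V i) (trans (∑-+ V _ h) (cong (_+ ∑ V h) (∑-+ V f g))))
        total : ∑[ v ← V ] 𝟙 (e v b c) + ∑[ v ← V ] 𝟙 (e v b d) + ∑[ v ← V ] 𝟙 (e v c d) + 2 * #P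
                ≤ 2 * n + (N b c + N b d + N c d + M b c d)
        total = begin
          ∑[ v ← V ] 𝟙 (e v b c) + ∑[ v ← V ] 𝟙 (e v b d) + ∑[ v ← V ] 𝟙 (e v c d) + 2 * #P
            ≡⟨ cong (_ +_) (sym (∑-*ˡ 2 V (λ v → 𝟙 (p v)))) ⟩
          ∑[ v ← V ] 𝟙 (e v b c) + ∑[ v ← V ] 𝟙 (e v b d) + ∑[ v ← V ] 𝟙 (e v c d) + ∑[ v ← V ] (2 * 𝟙 (p v))
            ≡⟨ sym (split (λ v → 𝟙 (e v b c)) (λ v → 𝟙 (e v b d)) (λ v → 𝟙 (e v c d)) (λ v → 2 * 𝟙 (p v))) ⟩
          ∑[ v ← V ] (𝟙 (e v b c) + 𝟙 (e v b d) + 𝟙 (e v c d) + 2 * 𝟙 (p v))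
            ≤⟨ ∑-mono V (λ v → point (p v) (e v b c) (e v b d) (e v c d) (e b c d)) ⟩
          ∑[ v ← V ] (2 + (𝟙 (p v ∧ e v b c) + 𝟙 (p v ∧ e v b d) + 𝟙 (p v ∧ e v c d) + 𝟙 (tile v b c d)))
            ≡⟨ trans (∑-+ V (λ _ → 2) _) (cong₂ _+_ (trans (∑-V-const 2) (*-comm n 2))
                 (split (λ v → 𝟙 (p v ∧ e v b c)) (λ v → 𝟙 (p v ∧ e v b d)) (λ v → 𝟙 (p v ∧ e v c d)) (λ v → 𝟙 (tile v b c d)))) ⟩
          2 * n + (N b c + N b d + N c d + M b c d) ∎
          where open ≤-Reasoning

      O-outside : (3 * D + 2 * #P) * (#P * #P) * #P
                  ≤ O + 2 * n * (#P * #P) * #P + 3 * (S N * #P) + 3 * (n * (#P * #P))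
      O-outside = begin
        (3 * D + 2 * #P) * (#P * #P) * #P
          ≡⟨ cong (_* #P) (sym (S-const (3 * D + 2 * #P))) ⟩
        S (λ _ _ → 3 * D + 2 * #P) * #P
          ≡⟨ sym (inP-sum (λ _ _ → 3 * D + 2 * #P)) ⟩
        ∑³ V (λ b c d → 𝟙 (inP b c d) * (3 * D + 2 * #P))
          ≤⟨ ∑³-mono V (λ b c d → 𝟙 (inP b c d) ⊙ outside b c d) ⟩
        ∑³ V (λ b c d → 𝟙 (inP b c d) * (M b c d + 2 * n + (N b c + N b d + N c d)
                                          + n * (I b c + I b d + I c d)))
          ≡⟨ ∑³-cong V (λ b c d → eq (𝟙 (inP b c d)) (M b c d) n (N b c) (N b d) (N c d) (I b c) (I b d) (I c d)) ⟩
        ∑³ V (λ b c d → (F₁ b c d + F₂ b c d) + ((F₃ b c d + F₄ b c d + F₅ b c d) + n * (F₆ b c d + F₇ b c d + F₈ b c d)))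
          ≡⟨ trans (∑³-+ V _ _) (cong₂ _+_ (∑³-+ V F₁ F₂)
               (trans (∑³-+ V _ _) (cong₂ _+_ (trans (∑³-+ V _ F₅) (cong (_+ ∑³ V F₅) (∑³-+ V F₃ F₄)))
                 (trans (∑³-*ˡ n V _) (cong (n *_) (trans (∑³-+ V _ F₈) (cong (_+ ∑³ V F₈) (∑³-+ V F₆ F₇)))))))) ⟩
        (∑³ V F₁ + ∑³ V F₂) + ((∑³ V F₃ + ∑³ V F₄ + ∑³ V F₅) + n * (∑³ V F₆ + ∑³ V F₇ + ∑³ V F₈))
          ≡⟨ cong₂ _+_ (cong₂ _+_ O-M (trans (inP-sum (λ _ _ → 2 * n)) (cong (_* #P) (S-const (2 * n)))))
               (cong₂ _+_ (cong₂ _+_ (cong₂ _+_ (inP-sum N) (inP-sum₁₃ N)) (inP-sum₂₃ N))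
                 (cong (n *_) (cong₂ _+_ (cong₂ _+_ (inP-sum I) (inP-sum₁₃ I)) (inP-sum₂₃ I)))) ⟩
        (O + 2 * n * (#P * #P) * #P) + ((S N * #P + S N * #P + S N * #P) + n * (S I * #P + S I * #P + S I * #P))
          ≤⟨ ≤-refl {O + 2 * n * (#P * #P) * #P} ⊕ (≤-refl {S N * #P + S N * #P + S N * #P} ⊕ (n ⊙ (SI ⊕ SI ⊕ SI))) ⟩
        (O + 2 * n * (#P * #P) * #P) + ((S N * #P + S N * #P + S N * #P) + n * (#P * #P + #P * #P + #P * #P))
          ≡⟨ eq′ (O + 2 * n * (#P * #P) * #P) (S N * #P) n (#P * #P) ⟩
        O + 2 * n * (#P * #P) * #P + 3 * (S N * #P) + 3 * (n * (#P * #P)) ∎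
        where
        open ≤-Reasoning
        I : Fin n → Fin n → ℕ
        I b c = 𝟙 (b == c)
        SI : S I * #P ≤ #P * #P
        SI = *-monoˡ-≤ #P S-diagonal
        F₁ F₂ F₃ F₄ F₅ F₆ F₇ F₈ : Fin n → Fin n → Fin n → ℕ
        F₁ b c d = 𝟙 (inP b c d) * M b c d
        F₂ b c d = 𝟙 (inP b c d) * (2 * n)
        F₃ b c d = 𝟙 (inP b c d) * N b c
        F₄ b c d = 𝟙 (inP b c d) * N b d
        F₅ b c d = 𝟙 (inP b c d) * N c d
        F₆ b c d = 𝟙 (inP b c d) * I b c
        F₇ b c d = 𝟙 (inP b c d) * I b d
        F₈ b c d = 𝟙 (inP b c d) * I c d
        eq : ∀ t m n x y z i j l → t * (m + 2 * n + (x + y + z) + n * (i + j + l))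
             ≡ (t * m + t * (2 * n)) + ((t * x + t * y + t * z) + n * (t * i + t * j + t * l))
        eq = solve-∀
        eq′ : ∀ o s n m → o + ((s + s + s) + n * (m + m + m)) ≡ o + 3 * s + 3 * (n * m)
        eq′ = solve-∀

      S-N : ∑³ V (λ b c d → 𝟙 (inP b c d) * 𝟙 (e b c d)) ≡ S N
      S-N = ∑-cong V (λ b → ∑-cong V (λ c → trans (∑-cong V (λ d → begin
        𝟙 (inP b c d) * 𝟙 (e b c d)
          ≡⟨ cong₂ _*_ (trans (𝟙-* (p b) (p c ∧ p d)) (cong (𝟙 (p b) *_) (𝟙-* (p c) (p d))))
                       (cong 𝟙 (sym (rot d b c))) ⟩
        𝟙 (p b) * (𝟙 (p c) * 𝟙 (p d)) * 𝟙 (e d b c)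
          ≡⟨ eq (𝟙 (p b)) (𝟙 (p c)) (𝟙 (p d)) (𝟙 (e d b c)) ⟩
        𝟙 (p b) * 𝟙 (p c) * (𝟙 (p d) * 𝟙 (e d b c))
          ≡⟨ cong₂ _*_ (sym (𝟙-* (p b) (p c))) (sym (𝟙-* (p d) (e d b c))) ⟩
        𝟙 (p b ∧ p c) * 𝟙 (p d ∧ e d b c) ∎)) (∑-*ˡ (𝟙 (p b ∧ p c)) V _)))
        where
        open ≡-Reasoning
        eq : ∀ i j l x → i * (j * l) * x ≡ i * j * (l * x)
        eq = solve-∀

      -- Complements `O-outside`, which is weak when `P` spans many edges: then the completions of
      -- these edges supply the tiles.
      O-inside : 3 * D * S N ≤ n * S N + 2 * O
      O-inside = begin
        3 * D * S N
          ≡⟨ trans (cong (3 * D *_) (sym S-N)) (sym (∑³-*ˡ (3 * D) V _)) ⟩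
        ∑³ V (λ b c d → 3 * D * (𝟙 (inP b c d) * 𝟙 (e b c d)))
          ≤⟨ ∑³-mono V each ⟩
        ∑³ V (λ b c d → n * (𝟙 (inP b c d) * 𝟙 (e b c d)) + 2 * (𝟙 (inP b c d) * M b c d))
          ≡⟨ trans (∑³-+ V _ _) (cong₂ _+_ (trans (∑³-*ˡ n V _) (cong (n *_) S-N))
                                          (trans (∑³-*ˡ 2 V _) (cong (2 *_) O-M))) ⟩
        n * S N + 2 * O ∎
        where
        open ≤-Reasoning
        eq : ∀ D i j → 3 * D * (i * j) ≡ i * (j * (3 * D))
        eq = solve-∀
        eq′ : ∀ i j n m → i * (j * n + 2 * m) ≡ n * (i * j) + 2 * (i * m)
        eq′ = solve-∀
        edge : ∀ b c d → 𝟙 (e b c d) * (3 * D) ≤ 𝟙 (e b c d) * n + 2 * M b c d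
        edge b c d = by-cases (e b c d) refl
          where
          by-cases : ∀ x → e b c d ≡ x → 𝟙 x * (3 * D) ≤ 𝟙 x * n + 2 * M b c d
          by-cases false _ = z≤n
          by-cases true  h = ≤-trans (≤-reflexive (*-identityˡ (3 * D))) (≤-trans (ext-many h)
            (≤-reflexive (sym (*-identityˡ n)) ⊕ (2 ⊙ ∑-mono V (λ v → 𝟙-mono (λ hv → ext-tile {v} {b} {c} {d} hv h)))))
        each : ∀ b c d → 3 * D * (𝟙 (inP b c d) * 𝟙 (e b c d))
                         ≤ n * (𝟙 (inP b c d) * 𝟙 (e b c d)) + 2 * (𝟙 (inP b c d) * M b c d)
        each b c d = ≤-trans (≤-reflexive (eq D (𝟙 (inP b c d)) (𝟙 (e b c d))))
          (≤-trans (𝟙 (inP b c d) ⊙ edge b c d)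
            (≤-reflexive (eq′ (𝟙 (inP b c d)) (𝟙 (e b c d)) n (M b c d))))

      #P≤n : #P ≤ n
      #P≤n = ≤-trans (∑-V-≤const 1 (λ v → 𝟙≤1 (p v))) (≤-reflexive (*-identityʳ n))

      n≤4#P : n ≤ 4 * #P
      n≤4#P = ≤-trans (m≤m+n n (4 * g)) large

      -- Since `3D ≥ 3n/2 + 3g` and `2|P| ≥ n/2 + 2g`, the main term of `O-outside` is at least
      -- `5g|P|³`. The edges inside `P` cost `3|P|` times `S N`, which is at most `12 * O` by `nSN`;
      -- together with `O` itself this makes 13. Degenerate triples cost `3n|P|² ≤ 12|P|³ ≤ 2g|P|³`,
      -- the reason for `6 ≤ g`.
      O-P³ : 3 * g * (#P * #P * #P) ≤ 13 * O
      O-P³ = *-cancelˡ-≤ 2 (lin 0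
          (2 ⊙ O-outside ⊕ (3 * (#P * #P * #P)) ⊙ half ⊕ (#P * #P * #P) ⊙ large ⊕ 6 ⊙ nSN ⊕ (6 * S N) ⊙ #P≤n
            ⊕ (6 * (#P * #P)) ⊙ n≤4#P ⊕ (4 * (#P * #P * #P)) ⊙ 6≤g)
          (eq D g n #P O (S N)))
        where
        nSN : S N * n ≤ 2 * (2 * O)
        nSN = lin (6 * g * S N) (2 ⊙ O-inside ⊕ (3 * S N) ⊙ half) (eq₀ D g n (S N) O)
          where
          eq₀ : ∀ D g n s o → 2 * (2 * o) + (2 * (3 * D * s) + 3 * s * (n + 2 * g))
            ≡ s * n + (2 * (n * s + 2 * o) + 3 * s * (2 * D)) + 6 * g * s
          eq₀ = solve-∀
        eq : ∀ D g n P o s →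
          2 * (13 * o) + (2 * ((3 * D + 2 * P) * (P * P) * P) + 3 * (P * P * P) * (n + 2 * g) + P * P * P * (n + 4 * g)
            + 6 * (s * n) + 6 * s * P + 6 * (P * P) * n + 4 * (P * P * P) * 6)
          ≡ 2 * (3 * g * (P * P * P)) + (2 * (o + 2 * n * (P * P) * P + 3 * (s * P) + 3 * (n * (P * P)))
            + 3 * (P * P * P) * (2 * D) + P * P * P * (4 * P) + 6 * (2 * (2 * o)) + 6 * s * n + 6 * (P * P) * (4 * P)
            + 4 * (P * P * P) * g) + 0
        eq = solve-∀

      O-large : n ^ 4 ≤ 5 * (k * k) * O
      O-large = *-cancelˡ-≤ 3 (begin
        3 * (n * (n * (n * (n * 1))))
          ≡⟨ eq₁ n ⟩
        3 * (n * n * n * n)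
          ≤⟨ 3 ⊙ *-mono-≤ (*-mono-≤ (*-mono-≤ n≤4#P n≤4#P) n≤4#P) dense ⟩
        3 * (4 * #P * (4 * #P) * (4 * #P) * (k * g))
          ≡⟨ eq₂ #P k g ⟩
        64 * k * (3 * g * (#P * #P * #P))
          ≤⟨ (64 * k) ⊙ O-P³ ⟩
        64 * k * (13 * O)
          ≡⟨ eq₃ k O ⟩
        832 * (k * O)
          ≤⟨ *-monoˡ-≤ (k * O) (≤-trans (m≤m+n 832 68) (15 ⊙ 60≤k)) ⟩
        15 * k * (k * O)
          ≡⟨ eq₄ k O ⟩
        3 * (5 * (k * k) * O) ∎)
        where
        open ≤-Reasoning
        eq₁ : ∀ n → 3 * (n * (n * (n * (n * 1)))) ≡ 3 * (n * n * n * n)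
        eq₁ = solve-∀
        eq₂ : ∀ P k g → 3 * (4 * P * (4 * P) * (4 * P) * (k * g)) ≡ 64 * k * (3 * g * (P * P * P))
        eq₂ = solve-∀
        eq₃ : ∀ k o → 64 * k * (13 * o) ≡ 832 * (k * o)
        eq₃ = solve-∀
        eq₄ : ∀ k o → 15 * k * (k * o) ≡ 3 * (5 * (k * k) * o)
        eq₄ = solve-∀

      -- In most of these tiles one of the pairs a b, a c, a d has at least |P|/2 common neighbours in P.

      θ-small : ∀ i x {j} → (i ∧ (n ≤ᵇ θ * x) ∧ j) ≡ false → i ≡ true → j ≡ true → θ * x < n
      θ-small true x {true} h refl refl = false-≤ᵇ (trans (sym (Bool.∧-identityʳ (n ≤ᵇ θ * x))) h)

      big : Fin n → Fin n → Bool
      big a b = #P ≤ᵇ 2 * N a b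

      spoke : Fin n → Fin n → Fin n → Fin n → Bool
      spoke a b c d = (inP b c d ∧ tile a b c d) ∧ big a b

      -- In `N-sum` the excess `2g` of `2D` over `n` outweighs the two errors: both `β` and the
      -- growth `n / E` from `P` to `P⁺` are at most `g / 3`.
      edge-big : ∀ {a b c} → e a b c ≡ true → θ * β a b c < n → #P ≤ N a b + N a c
      edge-big {a} {b} {c} h θβ<n = *-cancelˡ-≤ (E * (3 * k)) {{m*n≢0 E (3 * k) {{>-nonZero 0<E}} {{m*n≢0 3 k {{_}} {{>-nonZero 0<k}}}}}}
        (lin (4 * (k * (E * g)))
          ((E * (3 * k)) ⊙ N-sum (e-≢ h) (e-≢₁₃ h) ⊕ (E * (3 * k)) ⊙ half ⊕ (3 * k) ⊙ stable ⊕ E ⊙ <⇒≤ θβ<n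
            ⊕ (E + 3 * k) ⊙ dense ⊕ (k * g) ⊙ 3k≤E)
          (eq D g n k E #P #P⁺ (N a b + N a c) (β a b c)))
        where
        eq : ∀ D g n k E P P⁺ N β →
          E * (3 * k) * N + (E * (3 * k) * (2 * D + 2 * P) + E * (3 * k) * (n + 2 * g) + 3 * k * (E * P⁺) + E * (3 * k * β)
            + (E + 3 * k) * n + k * g * (3 * k))
          ≡ E * (3 * k) * P + (E * (3 * k) * (N + P⁺ + n + β) + E * (3 * k) * (2 * D) + 3 * k * (E * P + n) + E * n
            + (E + 3 * k) * (k * g) + k * g * E) + 4 * (k * (E * g))
        eq = solve-∀

      spoke-tile : ∀ {a b c d} → spoke a b c d ≡ true → p b ≡ true × p c ≡ true × p d ≡ true × tile a b c d ≡ true × big a b ≡ true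
      spoke-tile {a} {b} {c} {d} h =
        let h₁ , h₂ = ∧-true {inP b c d ∧ tile a b c d} h
            h₃ , h₄ = ∧-true {inP b c d} h₁
            h₅ , h₆ = ∧-true {p b} h₃
            h₇ , h₈ = ∧-true {p c} h₆
        in h₅ , h₇ , h₈ , h₄ , h₂

      -- Some edge of the tile contains `a`, and the remaining vertex of the tile completes it from
      -- within `P`. Unless this makes the edge bad, `edge-big` shows that one of its two pairs at
      -- `a` is big.
      tile-spoke : ∀ a b c d → 𝟙 (inP b c d ∧ tile a b c d) ≤
        𝟙 (spoke a b c d) + 𝟙 (spoke a c b d) + 𝟙 (spoke a d b c)
        + (𝟙 (badA a b c d) + 𝟙 (badA a b d c) + 𝟙 (badA a c d b))
      tile-spoke a b c d = 𝟙-one-of-3 _ _ _ _ _ _ _ λ h s₁ s₂ s₃ b₁ b₂ b₃ →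
        let hP , t  = ∧-true {inP b c d} h
            pb , h′ = ∧-true {p b} hP
            pc , pd = ∧-true {p c} h′
            tc = trans (sym (tile-swap₂₃ a b c d)) t
            td = trans (sym (tile-swap₂₃ a b d c)) (trans (sym (tile-swap₃₄ a b c d)) t)
            Nb = not-big a b c d (pb ∧ᵗ pc ∧ᵗ pd) t s₁
            Nc = not-big a c b d (pc ∧ᵗ pb ∧ᵗ pd) tc s₂
            Nd = not-big a d b c (pd ∧ᵗ pb ∧ᵗ pc) td s₃
            t′ = trans (sym (tile-swap₃₄ a b c d)) t
            t″ = trans (sym (tile-swap₃₄ a c b d)) tc
        in some-edge (e a b c) (e a b d) (e a c d) (e b c d) t
             (λ x → clash (N a b) (N a c) Nb Nc (edge-big x (θ-small (e a b c) (β a b c) b₁ x (pd ∧ᵗ tile-ext {a} {b} {c} {d} t x))))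
             (λ x → clash (N a b) (N a d) Nb Nd (edge-big x (θ-small (e a b d) (β a b d) b₂ x (pc ∧ᵗ tile-ext {a} {b} {d} {c} t′ x))))
             (λ x → clash (N a c) (N a d) Nc Nd (edge-big x (θ-small (e a c d) (β a c d) b₃ x (pb ∧ᵗ tile-ext {a} {c} {d} {b} t″ x))))
        where
        some-edge : ∀ x y z w → at-least-3 x y z w ≡ true →
                    (x ≡ true → ⊥) → (y ≡ true → ⊥) → (z ≡ true → ⊥) → ⊥
        some-edge true  y     z     w h f₁ f₂ f₃ = f₁ refl
        some-edge false true  z     w h f₁ f₂ f₃ = f₂ refl
        some-edge false false true  w h f₁ f₂ f₃ = f₃ refl
        not-big : ∀ a b c d → inP b c d ≡ true → tile a b c d ≡ true → spoke a b c d ≡ false → 2 * N a b < #P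
        not-big a b c d hP t h = false-≤ᵇ (last (inP b c d) (tile a b c d) (big a b) hP t h)
          where
          last : ∀ x y z → x ≡ true → y ≡ true → (x ∧ y) ∧ z ≡ false → z ≡ false
          last true true z refl refl h = h
        clash : ∀ x y → 2 * x < #P → 2 * y < #P → #P ≤ x + y → ⊥
        clash x y hx hy h = <⇒≱ (+-mono-< hx hy)
          (≤-trans (≤-reflexive (cong (#P +_) (sym (+-identityʳ #P)))) (≤-trans (2 ⊙ h) (≤-reflexive (*-distribˡ-+ 2 x y))))

      Ω : ℕ
      Ω = ∑[ a ← V ] ∑³ V (λ b c d → 𝟙 (spoke a b c d))

      #badA : ℕ
      #badA = ∑³ V (λ a b c → ∑[ d ← V ] 𝟙 (badA a b c d))

      O-Ω : O ≤ 3 * Ω + 3 * #badA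
      O-Ω = begin
        O
          ≤⟨ ∑-mono V (λ a → ∑³-mono V (tile-spoke a)) ⟩
        ∑[ a ← V ] ∑³ V (λ b c d → S₁ a b c d + S₁ a c b d + S₁ a d b c + (B a b c d + B a b d c + B a c d b))
          ≡⟨ ∑-cong V (λ a → trans (∑³-+ V _ _) (cong₂ _+_
               (trans (∑³-+ V _ _) (cong₂ _+_ (trans (∑³-+ V _ _) (cong (∑³ V (S₁ a) +_) (∑³-swap₁₂ V (S₁ a)))) (∑³-rotʳ V (S₁ a))))
               (trans (∑³-+ V _ _) (cong₂ _+_ (trans (∑³-+ V _ _) (cong (∑³ V (B a) +_) (∑³-swap₂₃ V (B a)))) (∑³-rotˡ V (B a)))))) ⟩
        ∑[ a ← V ] (∑³ V (S₁ a) + ∑³ V (S₁ a) + ∑³ V (S₁ a) + (∑³ V (B a) + ∑³ V (B a) + ∑³ V (B a)))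
          ≡⟨ ∑-cong V (λ a → eq (∑³ V (S₁ a)) (∑³ V (B a))) ⟩
        ∑[ a ← V ] (3 * ∑³ V (S₁ a) + 3 * ∑³ V (B a))
          ≡⟨ trans (∑-+ V _ _) (cong₂ _+_ (∑-*ˡ 3 V _) (∑-*ˡ 3 V _)) ⟩
        3 * Ω + 3 * #badA ∎
        where
        open ≤-Reasoning
        S₁ B : Fin n → Fin n → Fin n → Fin n → ℕ
        S₁ a b c d = 𝟙 (spoke a b c d)
        B a b c d = 𝟙 (badA a b c d)
        eq : ∀ x y → x + x + x + (y + y + y) ≡ 3 * x + 3 * y
        eq = solve-∀

      60k⁵≤E : 60 * (k * k * k * k * k * k) ≤ E
      60k⁵≤E = ≤-trans (≤-trans (*-monoˡ-≤ (k * k * k * k * k * k) 60≤k) (≤-reflexive (*-comm k _))) E-large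

      180k³≤E : 180 * (k * k * k) ≤ E
      180k³≤E = ≤-trans (≤-trans (≤-reflexive (eq₁ (k * k * k)))
          (≤-trans (60 ⊙ *-mono-≤ (*-mono-≤ (*-monoʳ-≤ (k * k * k) 3≤k) 1≤k) 1≤k) (≤-reflexive (eq₂ k)))) 60k⁵≤E
        where
        1≤k : 1 ≤ k
        1≤k = 0<k
        3≤k : 3 ≤ k
        3≤k = ≤-trans (m≤m+n 3 57) 60≤k
        eq₁ : ∀ m → 180 * m ≡ 60 * (m * 3 * 1 * 1)
        eq₁ = solve-∀
        eq₂ : ∀ k → 60 * (k * k * k * k * k * k) ≡ 60 * (k * k * k * k * k * k)
        eq₂ = solve-∀

      Ω-large : n ^ 4 ≤ 30 * (k * k) * Ω
      Ω-large = *-cancelˡ-≤ E {{>-nonZero 0<E}} (lin 0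
          ((2 * E) ⊙ O-large ⊕ (10 * (k * k) * E) ⊙ O-Ω ⊕ (30 * (k * k)) ⊙ badA-few ⊕ (n ^ 4) ⊙ 180k³≤E)
          (eq (n ^ 4) k E O Ω #badA))
        where
        eq : ∀ N k E O Ω A →
          E * (30 * (k * k) * Ω) + (2 * E * N + 10 * (k * k) * E * O + 30 * (k * k) * (E * A) + N * (180 * (k * k * k)))
          ≡ E * N + (2 * E * (5 * (k * k) * O) + 10 * (k * k) * E * (3 * Ω + 3 * A) + 30 * (k * k) * (2 * (3 * k) * N) + N * E) + 0
        eq = solve-∀

      fan : Fin n → Fin n → Fin n → Fin n → Bool
      fan a b e′ f = (q e′ ∧ e a b e′) ∧ (e a b f ∧ e a e′ f)

      -- At least `D - |P⁺| ≥ g / 2` neighbours of `a b` lie outside `P⁺`, because `|P⁺|` exceeds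
      -- `n / 2` by at most `3n / 2E`. Each of them offers `2 * g` choices of `f`.
      fan-many : ∀ {a b} → a ≢ b → g * g ≤ ∑[ e′ ← V ] ∑[ f ← V ] 𝟙 (fan a b e′ f)
      fan-many {a} {b} a≢b = begin
        g * g
          ≤⟨ *-monoˡ-≤ g g≤2# ⟩
        2 * # * g
          ≡⟨ eq # g ⟩
        # * (2 * g)
          ≡⟨ sym (∑-*ʳ (2 * g) V (λ e′ → 𝟙 (q e′ ∧ e a b e′))) ⟩
        ∑[ e′ ← V ] (𝟙 (q e′ ∧ e a b e′) * (2 * g))
          ≤⟨ ∑-mono V (λ e′ → guard (q e′ ∧ e a b e′) (λ h → common a≢b (e-≢₁₃ (proj₂ (∧-true {q e′} h))))) ⟩
        ∑[ e′ ← V ] (𝟙 (q e′ ∧ e a b e′) * ∑[ f ← V ] 𝟙 (e a b f ∧ e a e′ f))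
          ≡⟨ ∑-cong V (λ e′ → sym (∑-∧ (q e′ ∧ e a b e′) V (λ f → e a b f ∧ e a e′ f))) ⟩
        ∑[ e′ ← V ] ∑[ f ← V ] 𝟙 (fan a b e′ f) ∎
        where
        open ≤-Reasoning
        # = ∑[ e′ ← V ] 𝟙 (q e′ ∧ e a b e′)
        eq : ∀ x g → 2 * x * g ≡ x * (2 * g)
        eq = solve-∀
        point : ∀ p x → 𝟙 x ≤ 𝟙 (not p ∧ x) + 𝟙 p
        point true  x = 𝟙≤1 x
        point false x = ≤-reflexive (sym (+-identityʳ (𝟙 x)))
        D≤ : D ≤ # + #P⁺
        D≤ = ≤-trans (codeg a b a≢b) (≤-trans (∑-mono V (λ v → point (p⁺ v) (e a b v))) (≤-reflexive (∑-+ V _ _)))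
        g≤2# : g ≤ 2 * #
        g≤2# = *-cancelˡ-≤ E {{>-nonZero 0<E}} (lin 0
          ((2 * E) ⊙ D≤ ⊕ E ⊙ half ⊕ 2 ⊙ stable ⊕ small ⊕ 3 ⊙ dense ⊕ g ⊙ 3k≤E) (eq′ E D n g k # #P #P⁺))
          where
          eq′ : ∀ E D n g k x P P⁺ →
            E * (2 * x) + (2 * E * D + E * (n + 2 * g) + 2 * (E * P⁺) + E * (2 * P) + 3 * n + g * (3 * k))
            ≡ E * g + (2 * E * (x + P⁺) + E * (2 * D) + 2 * (E * P + n) + (E * n + n) + 3 * (k * g) + g * E) + 0
          eq′ = solve-∀

      ∑⁶ : (Fin n → Fin n → Fin n → Fin n → Fin n → Fin n → ℕ) → ℕ
      ∑⁶ F = ∑[ a ← V ] ∑³ V (λ b c d → ∑[ e′ ← V ] ∑[ f ← V ] F a b c d e′ f)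

      ∑⁶-mono : ∀ {F G} → (∀ a b c d e′ f → F a b c d e′ f ≤ G a b c d e′ f) → ∑⁶ F ≤ ∑⁶ G
      ∑⁶-mono h = ∑-mono V (λ a → ∑³-mono V (λ b c d → ∑-mono V (λ e′ → ∑-mono V (h a b c d e′))))

      ∑⁶-+ : ∀ F G → ∑⁶ (λ a b c d e′ f → F a b c d e′ f + G a b c d e′ f) ≡ ∑⁶ F + ∑⁶ G
      ∑⁶-+ F G = trans (∑-cong V (λ a → trans (∑³-cong V (λ b c d →
        trans (∑-cong V (λ e′ → ∑-+ V _ _)) (∑-+ V _ _))) (∑³-+ V _ _))) (∑-+ V _ _)

      X : ℕ
      X = ∑⁶ (λ a b c d e′ f → 𝟙 (spoke a b c d ∧ fan a b e′ f))

      X-large : n ^ 6 ≤ 30 * (k * k * k * k) * X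
      X-large = begin
        n * (n * n ^ 4)
          ≤⟨ *-mono-≤ dense (*-mono-≤ dense Ω-large) ⟩
        k * g * (k * g * (30 * (k * k) * Ω))
          ≡⟨ eq k g Ω ⟩
        30 * (k * k * k * k) * (g * g * Ω)
          ≤⟨ (30 * (k * k * k * k)) ⊙ Ωg² ⟩
        30 * (k * k * k * k) * X ∎
        where
        open ≤-Reasoning
        eq : ∀ k g o → k * g * (k * g * (30 * (k * k) * o)) ≡ 30 * (k * k * k * k) * (g * g * o)
        eq = solve-∀
        Ωg² : g * g * Ω ≤ X
        Ωg² = begin
          g * g * Ω
            ≡⟨ trans (sym (∑-*ˡ (g * g) V _)) (∑-cong V (λ a → sym (∑³-*ˡ (g * g) V (λ b c d → 𝟙 (spoke a b c d))))) ⟩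
          ∑[ a ← V ] ∑³ V (λ b c d → g * g * 𝟙 (spoke a b c d))
            ≤⟨ ∑-mono V (λ a → ∑³-mono V (λ b c d → each a b c d)) ⟩
          X ∎
          where
          each : ∀ a b c d → g * g * 𝟙 (spoke a b c d) ≤ ∑[ e′ ← V ] ∑[ f ← V ] 𝟙 (spoke a b c d ∧ fan a b e′ f)
          each a b c d = begin
            g * g * 𝟙 (spoke a b c d)
              ≡⟨ *-comm (g * g) _ ⟩
            𝟙 (spoke a b c d) * (g * g)
              ≤⟨ guard (spoke a b c d) (λ h → let _ , _ , _ , t , _ = spoke-tile {a} {b} {c} {d} h in
                   fan-many (tile-≢₁₂ {a} {b} {c} {d} t)) ⟩
            𝟙 (spoke a b c d) * ∑[ e′ ← V ] ∑[ f ← V ] 𝟙 (fan a b e′ f)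
              ≡⟨ trans (sym (∑-*ˡ (𝟙 (spoke a b c d)) V _)) (∑-cong V (λ e′ → sym (∑-∧ (spoke a b c d) V (fan a b e′)))) ⟩
            ∑[ e′ ← V ] ∑[ f ← V ] 𝟙 (spoke a b c d ∧ fan a b e′ f) ∎

      -- `R₁` places `f` in the thin shell between `P` and `P⁺`. For `f` in `P`, either `c` and `f`
      -- are exchangeable, which is `R₂`, or they are not, which is `R₃`. For `f` outside `P⁺`, one
      -- of the edges `a b e′`, `a b f`, `a e′ f` is bad, which gives `R₄`, `R₅`, `R₆`.
      R₁ R₂ R₃ R₄ R₅ R₆ : Fin n → Fin n → Fin n → Fin n → Fin n → Fin n → Bool
      R₁ a b c d e′ f = p⁺ f ∧ not (p f)
      R₂ a b c d e′ f = q e′ ∧ (p d ∧ near c f ∧ tile a b c d ∧ tile a b f e′)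
      R₃ a b c d e′ f = p c ∧ p f ∧ not (near c f)
      R₄ a b c d e′ f = badB a b e′ f
      R₅ a b c d e′ f = badB a b f e′
      R₆ a b c d e′ f = badA a e′ f b

      -- If a spoke and a fan avoid all exceptional sets, then a b, a e′ and a b, a f have few common
      -- neighbours in P, while a e′ and a f have few common neighbours outside P.
      no-typical-fan : ∀ {a b e′ f} → #P ≤ 2 * N a b → θ * α a b e′ < n → θ * α a b f < n → θ * β a e′ f < n →
                       a ≢ e′ → a ≢ f → ⊥
      no-typical-fan {a} {b} {e′} {f} hbig h₁ h₂ h₃ a≢e′ a≢f = <⇒≱ 0<2kEg (lin 0
        ((E * (3 * k)) ⊙ (hbig ⊕ N-overlap a b e′ ⊕ N-overlap a b f ⊕ N-sum a≢e′ a≢f ⊕ half)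
          ⊕ E ⊙ (<⇒≤ h₁ ⊕ <⇒≤ h₂ ⊕ <⇒≤ h₃) ⊕ (3 * k) ⊙ stable ⊕ (3 * E + 3 * k) ⊙ dense ⊕ (k * g) ⊙ 3k≤E)
        (eq D g n k E #P #P⁺ (N a b) (N a e′) (N a f) (α a b e′) (α a b f) (β a e′ f)))
        where
        0<2kEg : 0 < 2 * (k * (E * g))
        0<2kEg = *-mono-≤ (s≤s {0} {1} z≤n) (*-mono-≤ 0<k (*-mono-≤ 0<E (≤-trans (s≤s z≤n) 6≤g)))
        eq : ∀ D g n k E P P⁺ N N′ N″ x y z →
          0 + (E * (3 * k) * (P + (N + N′) + (N + N″) + (2 * D + 2 * P) + (n + 2 * g))
            + E * (3 * k * x + 3 * k * y + 3 * k * z) + 3 * k * (E * P⁺) + (3 * E + 3 * k) * n + k * g * (3 * k))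
          ≡ 2 * (k * (E * g)) + (E * (3 * k) * (2 * N + (P + x) + (P + y) + (N′ + N″ + P⁺ + n + z) + 2 * D)
            + E * (n + n + n) + 3 * k * (E * P + n) + (3 * E + 3 * k) * (k * g) + k * g * E) + 0
        eq = solve-∀

      exceptional : ∀ a b c d e′ f → 𝟙 (spoke a b c d ∧ fan a b e′ f) ≤
        𝟙 (R₁ a b c d e′ f) + 𝟙 (R₂ a b c d e′ f) + 𝟙 (R₃ a b c d e′ f)
        + (𝟙 (R₄ a b c d e′ f) + 𝟙 (R₅ a b c d e′ f) + 𝟙 (R₆ a b c d e′ f))
      exceptional a b c d e′ f = 𝟙-one-of-3 _ _ _ _ _ _ _ λ h r₁ r₂ r₃ r₄ r₅ r₆ →
        let hs , hf = ∧-true {spoke a b c d} h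
            pb , pc , pd , t , bg = spoke-tile {a} {b} {c} {d} hs
            f₁ , f₂ = ∧-true {q e′ ∧ e a b e′} hf
            qe , abe = ∧-true {q e′} f₁
            abf , aef = ∧-true {e a b f} f₂
        in cases pb pc pd t bg qe abe abf aef r₁ r₂ r₃ r₄ r₅ r₆ (bool-cases (p f)) (bool-cases (near c f)) (bool-cases (p⁺ f))
        where
        cases : p b ≡ true → p c ≡ true → p d ≡ true → tile a b c d ≡ true → big a b ≡ true →
                q e′ ≡ true → e a b e′ ≡ true → e a b f ≡ true → e a e′ f ≡ true →
                R₁ a b c d e′ f ≡ false → R₂ a b c d e′ f ≡ false → R₃ a b c d e′ f ≡ false →
                R₄ a b c d e′ f ≡ false → R₅ a b c d e′ f ≡ false → R₆ a b c d e′ f ≡ false →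
                (p f ≡ true) ⊎ (p f ≡ false) → (near c f ≡ true) ⊎ (near c f ≡ false) →
                (p⁺ f ≡ true) ⊎ (p⁺ f ≡ false) → ⊥
        cases pb pc pd t bg qe abe abf aef r₁ r₂ r₃ r₄ r₅ r₆ (inj₁ pf) (inj₁ nr) _ =
          true≢false (qe ∧ᵗ pd ∧ᵗ nr ∧ᵗ t ∧ᵗ at-least-3-∧₁₂₃ (e b f e′) abf abe (trans (sym (sym₂₃ a e′ f)) aef)) r₂
        cases pb pc pd t bg qe abe abf aef r₁ r₂ r₃ r₄ r₅ r₆ (inj₁ pf) (inj₂ nr) _ =
          true≢false (pc ∧ᵗ pf ∧ᵗ not-true nr) r₃
        cases pb pc pd t bg qe abe abf aef r₁ r₂ r₃ r₄ r₅ r₆ (inj₂ pf) _ (inj₁ p⁺f) =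
          true≢false (p⁺f ∧ᵗ not-true pf) r₁
        cases pb pc pd t bg qe abe abf aef r₁ r₂ r₃ r₄ r₅ r₆ (inj₂ pf) _ (inj₂ p⁺f) =
          no-typical-fan {a} {b} {e′} {f} (true-≤ᵇ bg)
            (θ-small (e a b e′) (α a b e′) r₄ abe (not-true p⁺f ∧ᵗ at-least-2-∧ (e f b e′) (trans (rot f a b) abf) (trans (rot f a e′) aef)))
            (θ-small (e a b f) (α a b f) r₅ abf (qe ∧ᵗ at-least-2-∧ (e e′ b f) (trans (rot e′ a b) abe) (trans (sym₁₂ e′ a f) aef)))
            (θ-small (e a e′ f) (β a e′ f) r₆ aef (pb ∧ᵗ at-least-2-∧ (e b e′ f) (trans (sym₁₂ b a e′) abe) (trans (sym₁₂ b a f) abf)))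
            (e-≢ aef) (e-≢₁₃ aef)

      E-∑⁶-∑ : ∀ (F : Fin n → Fin n → ℕ) B → E * ∑[ c ← V ] ∑[ f ← V ] F c f ≤ B →
               E * ∑⁶ (λ a b c d e′ f → F c f) ≤ n ^ 4 * B
      E-∑⁶-∑ F B h = begin
        E * ∑⁶ (λ a b c d e′ f → F c f)
          ≡⟨ cong (E *_) (trans (∑-V-const _) (cong (n *_) (trans (∑-V-const _) (cong (n *_)
               (trans (∑-cong V (λ c → trans (∑-V-const _) (cong (n *_) (∑-V-const _))))
                 (trans (∑-*ˡ n V _) (cong (n *_) (∑-*ˡ n V _)))))))) ⟩
        E * (n * (n * (n * (n * ∑[ c ← V ] ∑[ f ← V ] F c f))))
          ≡⟨ eq E n _ ⟩
        n ^ 4 * (E * ∑[ c ← V ] ∑[ f ← V ] F c f)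
          ≤⟨ (n ^ 4) ⊙ h ⟩
        n ^ 4 * B ∎
        where
        open ≤-Reasoning
        eq : ∀ E n x → E * (n * (n * (n * (n * x)))) ≡ n * (n * (n * (n * 1))) * (E * x)
        eq = solve-∀

      E-∑⁶-∑⁴ : ∀ (F : Fin n → Fin n → Fin n → Fin n → ℕ) B → E * ∑³ V (λ a b c → ∑[ d ← V ] F a b c d) ≤ B →
                E * ∑⁶ (λ a b c d e′ f → F a b e′ f) ≤ n * n * B
      E-∑⁶-∑⁴ F B h = begin
        E * ∑⁶ (λ a b c d e′ f → F a b e′ f)
          ≡⟨ cong (E *_) (trans (∑-cong V (λ a → trans (∑-cong V (λ b → trans (∑-V-const _) (cong (n *_) (∑-V-const _))))
               (trans (∑-*ˡ n V _) (cong (n *_) (∑-*ˡ n V _))))) (trans (∑-*ˡ n V _) (cong (n *_) (∑-*ˡ n V _)))) ⟩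
        E * (n * (n * ∑³ V (λ a b c → ∑[ d ← V ] F a b c d)))
          ≡⟨ eq E n _ ⟩
        n * n * (E * ∑³ V (λ a b c → ∑[ d ← V ] F a b c d))
          ≤⟨ (n * n) ⊙ h ⟩
        n * n * B ∎
        where
        open ≤-Reasoning
        eq : ∀ E n x → E * (n * (n * x)) ≡ n * n * (E * x)
        eq = solve-∀

      R₁-few : E * ∑⁶ (λ a b c d e′ f → 𝟙 (R₁ a b c d e′ f)) ≤ n ^ 4 * (n * n)
      R₁-few = E-∑⁶-∑ (λ c f → 𝟙 (p⁺ f ∧ not (p f))) (n * n) (begin
        E * ∑[ c ← V ] ∑[ f ← V ] 𝟙 (p⁺ f ∧ not (p f))
          ≡⟨ cong (E *_) (∑-V-const Δ) ⟩
        E * (n * Δ)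
          ≡⟨ eq E n Δ ⟩
        n * (E * Δ)
          ≤⟨ n ⊙ lin 0 (E ⊙ Δ≤ ⊕ stable) (eq′ E n Δ #P #P⁺) ⟩
        n * n ∎)
        where
        open ≤-Reasoning
        Δ = ∑[ f ← V ] 𝟙 (p⁺ f ∧ not (p f))
        eq : ∀ E n x → E * (n * x) ≡ n * (E * x)
        eq = solve-∀
        eq′ : ∀ E n x P P⁺ → n + (E * (x + P) + E * P⁺) ≡ E * x + (E * P⁺ + (E * P + n)) + 0
        eq′ = solve-∀
        point : ∀ p p⁺ → (p ≡ true → p⁺ ≡ true) → 𝟙 (p⁺ ∧ not p) + 𝟙 p ≤ 𝟙 p⁺
        point true  p⁺ h rewrite h refl = ≤-refl
        point false true  h = ≤-refl
        point false false h = ≤-refl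
        Δ≤ : Δ + #P ≤ #P⁺
        Δ≤ = ≤-trans (≤-reflexive (sym (∑-+ V _ _))) (∑-mono V (λ v → point (p v) (p⁺ v) (p⊆p⁺ v)))

      R₂-few : E * ∑⁶ (λ a b c d e′ f → 𝟙 (R₂ a b c d e′ f)) ≤ n * n ^ 5
      R₂-few = begin
        E * ∑[ a ← V ] ∑³ V (λ b c d → ∑[ e′ ← V ] ∑[ f ← V ] 𝟙 (R₂ a b c d e′ f))
          ≡⟨ cong (E *_) (trans (∑-cong V (λ a → sym (∑-∑³-swap V V (λ e′ b c d → ∑[ f ← V ] 𝟙 (R₂ a b c d e′ f)))))
               (∑-swap V V (λ a e′ → ∑³ V (λ b c d → ∑[ f ← V ] 𝟙 (R₂ a b c d e′ f))))) ⟩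
        E * ∑[ e′ ← V ] ∑[ a ← V ] ∑³ V (λ b c d → ∑[ f ← V ] 𝟙 (R₂ a b c d e′ f))
          ≡⟨ sym (∑-*ˡ E V _) ⟩
        ∑[ e′ ← V ] (E * ∑[ a ← V ] ∑³ V (λ b c d → ∑[ f ← V ] 𝟙 (R₂ a b c d e′ f)))
          ≤⟨ ∑-V-≤const (n ^ 5) per-e ⟩
        n * n ^ 5 ∎
        where
        open ≤-Reasoning
        F : Fin n → Fin n → Fin n → Fin n → Fin n → Fin n → Bool
        F a b c d e′ f = p d ∧ near c f ∧ tile a b c d ∧ tile a b f e′
        per-e : ∀ e′ → E * ∑[ a ← V ] ∑³ V (λ b c d → ∑[ f ← V ] 𝟙 (R₂ a b c d e′ f)) ≤ n ^ 5
        per-e e′ = by-cases (bool-cases (q e′))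
          where
          drop : ∀ x y → 𝟙 (x ∧ y) ≤ 𝟙 y
          drop true  y = ≤-refl
          drop false y = z≤n
          zero-of : ∀ x y → x ≡ false → 𝟙 (x ∧ y) ≤ 0
          zero-of false y refl = z≤n
          by-cases : (q e′ ≡ true) ⊎ (q e′ ≡ false) → E * ∑[ a ← V ] ∑³ V (λ b c d → ∑[ f ← V ] 𝟙 (R₂ a b c d e′ f)) ≤ n ^ 5
          by-cases (inj₁ h) = ≤-trans (E ⊙ ∑-mono V (λ a → ∑-mono V (λ b → ∑-mono V (λ c →
              ≤-trans (≤-reflexive (∑-swap V V (λ d f → 𝟙 (R₂ a b c d e′ f))))
                      (∑-mono V (λ f → ∑-mono V (λ d → drop (q e′) (F a b c d e′ f)))))))) (transfer e′ h)
          by-cases (inj₂ h) = ≤-trans (E ⊙ ∑-V-≤const 0 (λ a → ≤-trans (∑-V-≤const 0 (λ b → ≤-trans (∑-V-≤const 0 (λ c →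
              ≤-trans (∑-V-≤const 0 (λ d → ≤-trans (∑-V-≤const 0 (λ f → zero-of (q e′) (F a b c d e′ f) h)) n0)) n0)) n0)) n0))
              (≤-trans (≤-reflexive (trans (cong (E *_) (*-zeroʳ n)) (*-zeroʳ E))) z≤n)
            where
            n0 : n * 0 ≤ 0
            n0 = ≤-reflexive (*-zeroʳ n)

      R₃-few : E * ∑⁶ (λ a b c d e′ f → 𝟙 (R₃ a b c d e′ f)) ≤ n ^ 4 * (8 * k * n ^ 2)
      R₃-few = E-∑⁶-∑ (λ c f → 𝟙 (p c ∧ p f ∧ not (near c f))) (8 * k * n ^ 2) mostly-near

      R₄-few : E * ∑⁶ (λ a b c d e′ f → 𝟙 (R₄ a b c d e′ f)) ≤ n * n * (2 * θ * n ^ 4)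
      R₄-few = E-∑⁶-∑⁴ (λ a b e′ f → 𝟙 (badB a b e′ f)) (2 * θ * n ^ 4) badB-few

      R₅-few : E * ∑⁶ (λ a b c d e′ f → 𝟙 (R₅ a b c d e′ f)) ≤ n * n * (2 * θ * n ^ 4)
      R₅-few = E-∑⁶-∑⁴ (λ a b e′ f → 𝟙 (badB a b f e′)) (2 * θ * n ^ 4)
        (≤-trans (≤-reflexive (cong (E *_) (∑-cong V (λ a → ∑-cong V (λ b → ∑-swap V V (λ e′ f → 𝟙 (badB a b f e′))))))) badB-few)

      R₆-few : E * ∑⁶ (λ a b c d e′ f → 𝟙 (R₆ a b c d e′ f)) ≤ n * n * (2 * θ * n ^ 4)
      R₆-few = E-∑⁶-∑⁴ (λ a b e′ f → 𝟙 (badA a e′ f b)) (2 * θ * n ^ 4)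
        (≤-trans (≤-reflexive (cong (E *_) (∑-cong V (λ a → ∑³-rotˡ V (λ e′ f b → 𝟙 (badA a e′ f b)))))) badA-few)

      X-small : E * X ≤ 27 * k * n ^ 6
      X-small = begin
        E * X
          ≤⟨ E ⊙ ∑⁶-mono exceptional ⟩
        E * ∑⁶ (λ a b c d e′ f → 𝟙 (R₁ a b c d e′ f) + 𝟙 (R₂ a b c d e′ f) + 𝟙 (R₃ a b c d e′ f)
                                 + (𝟙 (R₄ a b c d e′ f) + 𝟙 (R₅ a b c d e′ f) + 𝟙 (R₆ a b c d e′ f)))
          ≡⟨ cong (E *_) (trans (∑⁶-+ _ _) (cong₂ _+_ (trans (∑⁶-+ _ _) (cong (_+ T₃) (∑⁶-+ _ _)))
                                                     (trans (∑⁶-+ _ _) (cong (_+ T₆) (∑⁶-+ _ _))))) ⟩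
        E * (T₁ + T₂ + T₃ + (T₄ + T₅ + T₆))
          -- The bounds add up to `26 * k + 2`: one each from `R₁` and `R₂`, `8 * k` from `R₃`, and
          -- `2 * θ = 6 * k` from each of `R₄`, `R₅`, `R₆`.
          ≤⟨ lin (n ^ 6 * (k ∸ 2)) (R₁-few ⊕ R₂-few ⊕ R₃-few ⊕ R₄-few ⊕ R₅-few ⊕ R₆-few) total ⟩
        27 * k * n ^ 6 ∎
        where
        open ≤-Reasoning
        T₁ = ∑⁶ (λ a b c d e′ f → 𝟙 (R₁ a b c d e′ f))
        T₂ = ∑⁶ (λ a b c d e′ f → 𝟙 (R₂ a b c d e′ f))
        T₃ = ∑⁶ (λ a b c d e′ f → 𝟙 (R₃ a b c d e′ f))
        T₄ = ∑⁶ (λ a b c d e′ f → 𝟙 (R₄ a b c d e′ f))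
        T₅ = ∑⁶ (λ a b c d e′ f → 𝟙 (R₅ a b c d e′ f))
        T₆ = ∑⁶ (λ a b c d e′ f → 𝟙 (R₆ a b c d e′ f))
        eq : ∀ E n N j x y z u v w →
          27 * (2 + j) * (n * (n * N)) + (E * x + E * y + E * z + E * u + E * v + E * w)
          ≡ E * (x + y + z + (u + v + w)) + (N * (n * n) + n * (n * N) + N * (8 * (2 + j) * (n * (n * 1)))
            + n * n * (2 * (3 * (2 + j)) * N) + n * n * (2 * (3 * (2 + j)) * N) + n * n * (2 * (3 * (2 + j)) * N)) + n * (n * N) * j
        eq = solve-∀
        2≤k : 2 ≤ k
        2≤k = ≤-trans (m≤m+n 2 58) 60≤k
        total : 27 * k * n ^ 6 + (E * T₁ + E * T₂ + E * T₃ + E * T₄ + E * T₅ + E * T₆)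
                ≡ E * (T₁ + T₂ + T₃ + (T₄ + T₅ + T₆)) + (n ^ 4 * (n * n) + n * n ^ 5 + n ^ 4 * (8 * k * n ^ 2)
                  + n * n * (2 * θ * n ^ 4) + n * n * (2 * θ * n ^ 4) + n * n * (2 * θ * n ^ 4)) + n ^ 6 * (k ∸ 2)
        total = subst (λ k → 27 * k * n ^ 6 + (E * T₁ + E * T₂ + E * T₃ + E * T₄ + E * T₅ + E * T₆)
                ≡ E * (T₁ + T₂ + T₃ + (T₄ + T₅ + T₆)) + (n ^ 4 * (n * n) + n * n ^ 5 + n ^ 4 * (8 * k * n ^ 2)
                  + n * n * (2 * (3 * k) * n ^ 4) + n * n * (2 * (3 * k) * n ^ 4) + n * n * (2 * (3 * k) * n ^ 4)) + n ^ 6 * (k₀ ∸ 2))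
                (m+[n∸m]≡n 2≤k) (eq E n (n ^ 4) (k ∸ 2) T₁ T₂ T₃ T₄ T₅ T₆)
          where k₀ = k

      -- `X-large` and `X-small` together force `E ≤ 810 k⁵`, whereas `E ≥ k⁷ ≥ 60 k⁶`; with
      -- `k ≥ 60` this is impossible.
      contradiction : ⊥
      contradiction = <⇒≱ (m≤m+n 811 2789) (≤-trans (60 ⊙ 60≤k) (*-cancelʳ-≤ (60 * k) 810 (k⁵ * n ^ 6)
          {{m*n≢0 k⁵ (n ^ 6) {{>-nonZero 0<k⁵}} {{m^n≢0 n 6 {{>-nonZero (≤-trans (s≤s z≤n) 2≤n)}}}}}} (begin
        60 * k * (k⁵ * n ^ 6)
          ≡⟨ eq₀ k (n ^ 6) ⟩
        60 * (k * k * k * k * k * k) * n ^ 6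
          ≤⟨ *-monoˡ-≤ (n ^ 6) 60k⁵≤E ⟩
        E * n ^ 6
          ≤⟨ E ⊙ X-large ⟩
        E * (30 * (k * k * k * k) * X)
          ≡⟨ eq₁ E k X ⟩
        30 * (k * k * k * k) * (E * X)
          ≤⟨ (30 * (k * k * k * k)) ⊙ X-small ⟩
        30 * (k * k * k * k) * (27 * k * n ^ 6)
          ≡⟨ eq₂ k (n ^ 6) ⟩
        810 * (k⁵ * n ^ 6) ∎)))
        where
        open ≤-Reasoning
        k⁵ = k * k * k * k * k
        0<k⁵ : 0 < k⁵
        0<k⁵ = *-mono-≤ (*-mono-≤ (*-mono-≤ (*-mono-≤ 0<k 0<k) 0<k) 0<k) 0<k
        eq₀ : ∀ k m → 60 * k * (k * k * k * k * k * m) ≡ 60 * (k * k * k * k * k * k) * m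
        eq₀ = solve-∀
        eq₁ : ∀ E k x → E * (30 * (k * k * k * k) * x) ≡ 30 * (k * k * k * k) * (E * x)
        eq₁ = solve-∀
        eq₂ : ∀ k m → 30 * (k * k * k * k) * (27 * k * m) ≡ 810 * (k * k * k * k * k * m)
        eq₂ = solve-∀

-- Passing to the next level takes two connecting words, of length 3 + 4 h each, and five more letters.
level-h : ℕ → ℕ
level-h zero    = 0
level-h (suc j) = 2 + (level-h j + level-h j)

-- The factor `E * c²` pays for a composition, the power of `2 * k` for padding: a word of one level
-- needs `2 + level-h j` extra tiles to reach the length of the next.
level-c : ℕ → ℕ → ℕ → ℕ
level-c k E zero    = E
level-c k E (suc j) = (2 * k) ^ (2 + level-h j) * (E * (level-c k E j * level-c k E j))

-- A step that is not slow raises `f` by more than `n / E`, and `2 * E` such steps would exceed the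
-- bound `2 * n`.
slow-step : ∀ E n (f : ℕ → ℕ) → 0 < E → (∀ j → f j ≤ 2 * n) →
            ∃ λ i → i < 2 * E × E * f (suc i) ≤ E * f i + n
slow-step E n f 0<E f≤ = case (search (2 * E))
  where
  search : ∀ m → (∃ λ i → i < m × E * f (suc i) ≤ E * f i + n) ⊎ (m * suc n ≤ E * f m)
  search zero    = inj₂ z≤n
  search (suc m) with search m
  ... | inj₁ (i , i<m , h) = inj₁ (i , m<n⇒m<1+n i<m , h)
  ... | inj₂ h with E * f (suc m) ≤? E * f m + n
  ...   | yes le = inj₁ (m , n<1+n m , le)
  ...   | no ¬le = inj₂ (≤-trans (≤-reflexive (cong suc (+-comm n (m * suc n))))
                                 (≤-trans (s≤s (+-monoˡ-≤ n h)) (≰⇒> ¬le)))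
  case : (∃ λ i → i < 2 * E × E * f (suc i) ≤ E * f i + n) ⊎ (2 * E * suc n ≤ E * f (2 * E)) →
         ∃ λ i → i < 2 * E × E * f (suc i) ≤ E * f i + n
  case (inj₁ r) = r
  case (inj₂ h) = ⊥-elim (<⇒≱ (*-mono-≤ (s≤s {0} {1} z≤n) 0<E) (lin 0 (h ⊕ E ⊙ f≤ (2 * E)) (eq E n (f (2 * E)))))
    where
    eq : ∀ E n x → 0 + (2 * E * (1 + n) + E * x) ≡ 2 * E + (E * x + E * (2 * n)) + 0
    eq = solve-∀

-- All vertices are exchangeable

module Closure {n : ℕ} (e : Fin n → Fin n → Fin n → Bool)
  (sym₁₂ : ∀ x y z → e x y z ≡ e y x z) (sym₂₃ : ∀ x y z → e x y z ≡ e x z y)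
  (irr : ∀ x z → e x x z ≡ false)
  (D g k : ℕ) (codeg : ∀ x y → x ≢ y → D ≤ ∑[ z ← Tiles.V e ] 𝟙 (e x y z))
  (half : n + 2 * g ≤ 2 * D) (dense : n ≤ k * g) (2≤n : 2 ≤ n)
  (E : ℕ) (D≤n : D ≤ n) (6≤g : 6 ≤ g) (60≤k : 60 ≤ k) (E-large : k * k * k * k * k * k * k ≤ E) where

  open Codegree e sym₁₂ sym₂₃ irr D g k codeg half dense 2≤n
  open Padding (2 * k) many-tiles

  0<k : 0 < k
  0<k = ≤-trans (s≤s z≤n) 60≤k

  4k²≤E : 4 * (k * k) ≤ E
  4k²≤E = ≤-trans (≤-trans (≤-reflexive (eq (k * k)))
    (*-mono-≤ (*-mono-≤ (*-mono-≤ (*-mono-≤ ((k * k) ⊙ 4≤k) 0<k) 0<k) 0<k) 0<k)) E-large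
    where
    4≤k : 4 ≤ k
    4≤k = ≤-trans (m≤m+n 4 56) 60≤k
    eq : ∀ m → 4 * m ≡ m * 4 * 1 * 1 * 1 * 1
    eq = solve-∀

  3k≤E : 3 * k ≤ E
  3k≤E = ≤-trans (*-mono-≤ (m≤m+n 3 1) (≤-trans (≤-reflexive (sym (*-identityʳ k))) (k ⊙ 0<k))) 4k²≤E

  0<E : 0 < E
  0<E = ≤-trans (≤-trans 0<k (m≤m+n k _)) 3k≤E

  h c : ℕ → ℕ
  h = level-h
  c = level-c k E

  0<2k : 0 < 2 * k
  0<2k = *-mono-≤ (s≤s {0} {1} z≤n) 0<k

  0<^ : ∀ i → 0 < (2 * k) ^ i
  0<^ i = m^n>0 (2 * k) {{>-nonZero 0<2k}} i

  0<c : ∀ j → 0 < c j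
  0<c zero    = 0<E
  0<c (suc j) = *-mono-≤ (0<^ (2 + h j)) (*-mono-≤ 0<E (*-mono-≤ (0<c j) (0<c j)))

  ρ : ℕ → Fin n → Fin n → Bool
  ρ j = reachᵇ (h j) (c j)

  ρ-suc : ∀ j {x y} → ρ j x y ≡ true → ρ (suc j) x y ≡ true
  ρ-suc j {x} {y} r = reachᵇ-complete (Reach-weaken
    (((2 * k) ^ (2 + h j)) ⊙ ≤-trans (≤-reflexive (sym (*-identityˡ (c j)))) (*-mono-≤ 0<E
      (≤-trans (≤-reflexive (sym (*-identityʳ (c j)))) (c j ⊙ 0<c j))))
    (Reach-pads (2 + h j) (reachᵇ-sound {h j} {c j} {x} {y} r)))

  ρ-+ : ∀ i j {x y} → ρ j x y ≡ true → ρ (i + j) x y ≡ true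
  ρ-+ zero    j r = r
  ρ-+ (suc i) j r = ρ-suc (i + j) (ρ-+ i j r)

  ρ-≤ : ∀ {i j} → i ≤ j → ∀ {x y} → ρ i x y ≡ true → ρ j x y ≡ true
  ρ-≤ {i} {j} i≤j {x} {y} r = subst (λ m → ρ m x y ≡ true) (m∸n+n≡m i≤j) (ρ-+ (j ∸ i) i r)

  ρ-sym : ∀ j {x y} → ρ j x y ≡ true → ρ j y x ≡ true
  ρ-sym j {x} {y} r = reachᵇ-complete (Reach-sym (reachᵇ-sound {h j} {c j} {x} {y} r))

  ρ-compose : ∀ j {x y} → n ≤ E * ∑[ z ← V ] 𝟙 (ρ j x z ∧ ρ j z y) → ρ (suc j) x y ≡ true
  ρ-compose j {x} {y} many-z = reachᵇ-complete (Reach-weaken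
    (≤-trans ((2 * k) ⊙ ≤-trans (≤-reflexive (sym (*-identityˡ _))) (*-monoˡ-≤ _ (0<^ (1 + h j))))
             (≤-reflexive (sym (*-assoc (2 * k) ((2 * k) ^ (1 + h j)) _))))
    (Reach-pad (Reach-compose (h j) (c j) E many-z)))

  ρ-transfer : ∀ j {x y} →
    n ^ 5 ≤ E * ∑[ a ← V ] ∑[ b ← V ] ∑[ c′ ← V ] ∑[ f ← V ] ∑[ d ← V ]
      𝟙 (ρ j x d ∧ ρ j c′ f ∧ tile a b c′ d ∧ tile a b f y) → ρ (suc j) x y ≡ true
  ρ-transfer j {x} {y} many-u = reachᵇ-complete (Reach-weaken
    (≤-trans (≤-reflexive (sym (*-identityˡ _))) (*-monoˡ-≤ _ (0<^ (2 + h j))))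
    (Reach-transfer (h j) (c j) E many-u))

  #ρ : ℕ → Fin n → ℕ
  #ρ j x = ∑[ y ← V ] 𝟙 (ρ j x y)

  #ρ-≤ : ∀ {i j} → i ≤ j → ∀ x → #ρ i x ≤ #ρ j x
  #ρ-≤ {i} {j} i≤j x = ∑-mono V (λ y → 𝟙-mono {ρ i x y} {ρ j x y} (ρ-≤ i≤j))

  #ρ₀ : ∀ x → n + 4 * g ≤ 4 * #ρ 0 x
  #ρ₀ x = reached-many x E 4k²≤E 0<E

  ¬compose : ∀ j {x y} → ρ (suc j) x y ≡ false → E * ∑[ z ← V ] 𝟙 (ρ j x z ∧ ρ j z y) ≤ n
  ¬compose j {x} {y} r with ≤-total n (E * ∑[ z ← V ] 𝟙 (ρ j x z ∧ ρ j z y))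
  ... | inj₂ le = le
  ... | inj₁ ge with trans (sym r) (ρ-compose j ge)
  ...   | ()

  not-false : ∀ {b} → not b ≡ true → b ≡ false
  not-false {false} _ = refl

  module _ (j : ℕ) (z : Fin n)
    (slow : E * #ρ (2 + j) z ≤ E * #ρ (1 + j) z + n) (small : E * (2 * #ρ (1 + j) z) ≤ E * n + n) where

    p p⁺ q : Fin n → Bool
    p  = ρ (1 + j) z
    p⁺ = ρ (2 + j) z
    q v = not (p⁺ v)

    near : Fin n → Fin n → Bool
    near = ρ 1

    -- Otherwise `z` could be exchanged with `v` through the vertices `d`, which would put `v` into
    -- `P⁺`. For this the relation between `d` and `v` may be of any level up to `1 + j`.
    to-q : ∀ v → q v ≡ true → E * ∑[ d ← V ] 𝟙 (p d ∧ ρ 0 d v) ≤ n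
    to-q v h = ≤-trans (E ⊙ ∑-mono V (λ d → 𝟙-mono {p d ∧ ρ 0 d v} (λ r →
        let r₁ , r₂ = ∧-true {p d} r in r₁ ∧ᵗ ρ-≤ {0} {1 + j} z≤n r₂)))
      (¬compose (1 + j) (not-false h))

    -- Few `d` in `P` are related to `v` at level 0, by `to-q`; every other `d` shares fewer than
    -- `n³ / E` triples with `v`. Each kind contributes at most `n⁴`.
    monochrome : ∀ v → q v ≡ true →
      E * ∑[ d ← V ] ∑³ V (λ a b c → 𝟙 (p d ∧ tile d a b c ∧ tile v a b c)) ≤ 2 * n ^ 4
    monochrome v h = begin
      E * ∑[ d ← V ] ∑³ V (λ a b c → 𝟙 (p d ∧ tile d a b c ∧ tile v a b c))
        ≡⟨ sym (∑-*ˡ E V _) ⟩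
      ∑[ d ← V ] (E * ∑³ V (λ a b c → 𝟙 (p d ∧ tile d a b c ∧ tile v a b c)))
        ≤⟨ ∑-mono V each ⟩
      ∑[ d ← V ] (E * n ^ 3 * 𝟙 (p d ∧ ρ 0 d v) + n ^ 3)
        ≡⟨ trans (∑-+ V _ _) (cong₂ _+_ (∑-*ˡ (E * n ^ 3) V (λ d → 𝟙 (p d ∧ ρ 0 d v))) (∑-V-const (n ^ 3))) ⟩
      E * n ^ 3 * ∑[ d ← V ] 𝟙 (p d ∧ ρ 0 d v) + n * n ^ 3
        ≤⟨ lin 0 ((n ^ 3) ⊙ to-q v h) (eq E n (n ^ 3) (∑[ d ← V ] 𝟙 (p d ∧ ρ 0 d v))) ⟩
      2 * n ^ 4 ∎
      where
      open ≤-Reasoning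
      eq : ∀ E n m x → 2 * (n * m) + m * (E * x) ≡ E * m * x + n * m + m * n + 0
      eq = solve-∀
      C : Fin n → ℕ
      C d = ∑³ V (λ a b c → 𝟙 (tile d a b c ∧ tile v a b c))
      C≤Ex : ∀ d → C d ≤ Ex 3 d v
      C≤Ex d = ∑³-mono V (λ a b c → 𝟙-mono {tile d a b c ∧ tile v a b c} (λ t →
        let t₁ , t₂ = ∧-true {tile d a b c} t in
        joins-complete {d} {v} {a ∷ b ∷ c ∷ []} (Fac-tile {d} {a} {b} {c} t₁) (Fac-tile {v} {a} {b} {c} t₂)))
      C≤n³ : ∀ d → C d ≤ n ^ 3
      C≤n³ d = ≤-trans (∑-V-≤const (n * (n * 1)) (λ a → ∑-V-≤const (n * 1) (λ b → ∑-V-≤const 1 (λ c → 𝟙≤1 _)))) ≤-refl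
      each : ∀ d → E * ∑³ V (λ a b c → 𝟙 (p d ∧ tile d a b c ∧ tile v a b c)) ≤ E * n ^ 3 * 𝟙 (p d ∧ ρ 0 d v) + n ^ 3
      each d = begin
        E * ∑³ V (λ a b c → 𝟙 (p d ∧ tile d a b c ∧ tile v a b c))
          ≡⟨ cong (E *_) (trans (∑³-cong V (λ a b c → 𝟙-* (p d) _)) (∑³-*ˡ (𝟙 (p d)) V _)) ⟩
        E * (𝟙 (p d) * C d)
          ≤⟨ by-cases (p d) (ρ 0 d v) refl ⟩
        E * n ^ 3 * 𝟙 (p d ∧ ρ 0 d v) + n ^ 3 ∎
        where
        by-cases : ∀ x y → ρ 0 d v ≡ y → E * (𝟙 x * C d) ≤ E * n ^ 3 * 𝟙 (x ∧ y) + n ^ 3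
        by-cases false y _ = ≤-trans (≤-reflexive (*-zeroʳ E)) z≤n
        by-cases true true _ = ≤-trans (E ⊙ ≤-trans (≤-reflexive (*-identityˡ (C d))) (C≤n³ d))
          (≤-trans (≤-reflexive (sym (*-identityʳ (E * n ^ 3)))) (m≤m+n _ (n ^ 3)))
        by-cases true false r = ≤-trans (E ⊙ ≤-trans (≤-reflexive (*-identityˡ (C d))) (C≤Ex d))
          (≤-trans (<⇒≤ (≰⇒> (λ le → does-false (reach? 0 E d v) r (reach le)))) (m≤n+m (n ^ 3) (E * n ^ 3 * 0)))

    transfer : ∀ v → q v ≡ true →
      E * ∑[ a ← V ] ∑[ b ← V ] ∑[ c′ ← V ] ∑[ f ← V ] ∑[ d ← V ]
        𝟙 (p d ∧ near c′ f ∧ tile a b c′ d ∧ tile a b f v) ≤ n ^ 5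
    transfer v h = by-total (≤-total (n ^ 5) (E * total))
      where
      total = ∑[ a ← V ] ∑[ b ← V ] ∑[ c′ ← V ] ∑[ f ← V ] ∑[ d ← V ]
        𝟙 (p d ∧ near c′ f ∧ tile a b c′ d ∧ tile a b f v)
      near⇒ : ∀ {c′ f} → near c′ f ≡ true → ρ (1 + j) c′ f ≡ true
      near⇒ = ρ-≤ {1} {1 + j} (s≤s z≤n)
      by-total : (n ^ 5 ≤ E * total) ⊎ (E * total ≤ n ^ 5) → E * total ≤ n ^ 5
      by-total (inj₂ le) = le
      by-total (inj₁ ge) = ⊥-elim (true≢false (ρ-transfer (1 + j) (≤-trans ge (E ⊙
        ∑-mono V (λ a → ∑-mono V (λ b → ∑-mono V (λ c′ → ∑-mono V (λ f → ∑-mono V (λ d →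
          𝟙-mono {p d ∧ near c′ f ∧ tile a b c′ d ∧ tile a b f v} (λ r →
            let r₁ , r₂ = ∧-true {p d} r ; r₃ , r₄ = ∧-true {near c′ f} r₂ in r₁ ∧ᵗ near⇒ r₃ ∧ᵗ r₄)))))))))
        (not-false h))

    far : Fin n → ℕ
    far c′ = ∑[ v ← V ] 𝟙 (q v ∧ ρ 0 c′ v)

    exc : Fin n → Bool
    exc c′ = p c′ ∧ (n ≤ᵇ 4 * k * far c′)

    -- Double counting of the pairs in `to-q`, followed by Markov's inequality with the threshold
    -- `n / 4k ≤ g / 4`.
    exc-few : E * ∑[ c′ ← V ] 𝟙 (exc c′) ≤ 4 * k * n
    exc-few = *-cancelʳ-≤ _ _ n {{>-nonZero (≤-trans (s≤s z≤n) 2≤n)}} (begin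
      E * ∑[ c′ ← V ] 𝟙 (exc c′) * n
        ≡⟨ trans (*-assoc E _ n) (cong (E *_) (sym (∑-*ʳ n V (λ c′ → 𝟙 (exc c′))))) ⟩
      E * ∑[ c′ ← V ] (𝟙 (exc c′) * n)
        ≤⟨ E ⊙ ∑-mono V each ⟩
      E * ∑[ c′ ← V ] (4 * k * (𝟙 (p c′) * far c′))
        ≡⟨ trans (cong (E *_) (∑-*ˡ (4 * k) V _)) (eq E (4 * k) _) ⟩
      4 * k * (E * ∑[ c′ ← V ] (𝟙 (p c′) * far c′))
        ≡⟨ cong (λ x → 4 * k * (E * x)) (trans (∑-cong V (λ c′ → sym (∑-*ˡ (𝟙 (p c′)) V _)))
             (∑-swap V V (λ c′ v → 𝟙 (p c′) * 𝟙 (q v ∧ ρ 0 c′ v)))) ⟩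
      4 * k * (E * ∑[ v ← V ] ∑[ c′ ← V ] (𝟙 (p c′) * 𝟙 (q v ∧ ρ 0 c′ v)))
        ≡⟨ cong (4 * k *_) (sym (∑-*ˡ E V _)) ⟩
      4 * k * ∑[ v ← V ] (E * ∑[ c′ ← V ] (𝟙 (p c′) * 𝟙 (q v ∧ ρ 0 c′ v)))
        ≤⟨ (4 * k) ⊙ ∑-V-≤const n per-v ⟩
      4 * k * (n * n)
        ≡⟨ sym (*-assoc (4 * k) n n) ⟩
      4 * k * n * n ∎)
      where
      open ≤-Reasoning
      eq : ∀ E k x → E * (k * x) ≡ k * (E * x)
      eq = solve-∀
      each : ∀ c′ → 𝟙 (exc c′) * n ≤ 4 * k * (𝟙 (p c′) * far c′)
      each c′ = by-cases (p c′) (n ≤ᵇ 4 * k * far c′) refl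
        where
        by-cases : ∀ x y → (n ≤ᵇ 4 * k * far c′) ≡ y → 𝟙 (x ∧ y) * n ≤ 4 * k * (𝟙 x * far c′)
        by-cases false y     _ = z≤n
        by-cases true  false _ = z≤n
        by-cases true  true  r = ≤-trans (≤-reflexive (*-identityˡ n))
          (≤-trans (true-≤ᵇ r) (≤-reflexive (cong (4 * k *_) (sym (*-identityˡ (far c′))))))
      swap∧ : ∀ x y z → 𝟙 x * 𝟙 (y ∧ z) ≡ 𝟙 y * 𝟙 (x ∧ z)
      swap∧ true  true  z = refl
      swap∧ true  false z = refl
      swap∧ false true  z = refl
      swap∧ false false z = refl
      per-v : ∀ v → E * ∑[ c′ ← V ] (𝟙 (p c′) * 𝟙 (q v ∧ ρ 0 c′ v)) ≤ n
      per-v v = begin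
        E * ∑[ c′ ← V ] (𝟙 (p c′) * 𝟙 (q v ∧ ρ 0 c′ v))
          ≡⟨ cong (E *_) (trans (∑-cong V (λ c′ → swap∧ (p c′) (q v) (ρ 0 c′ v))) (∑-*ˡ (𝟙 (q v)) V _)) ⟩
        E * (𝟙 (q v) * ∑[ c′ ← V ] 𝟙 (p c′ ∧ ρ 0 c′ v))
          ≡⟨ eq E (𝟙 (q v)) _ ⟩
        𝟙 (q v) * (E * ∑[ c′ ← V ] 𝟙 (p c′ ∧ ρ 0 c′ v))
          ≤⟨ guard (q v) (to-q v) ⟩
        𝟙 (q v) * n
          ≤⟨ *-monoˡ-≤ n (𝟙≤1 (q v)) ⟩
        1 * n
          ≡⟨ *-identityˡ n ⟩
        n ∎

    -- Two members of P with few level-0 neighbours outside P⁺ have many of them in common, as |P⁺|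
    -- hardly exceeds n/2.
    near-of : ∀ c′ f → 4 * k * far c′ < n → 4 * k * far f < n → near c′ f ≡ true
    near-of c′ f hc hf = ρ-compose 0 {c′} {f} (≤-trans dense (*-mono-≤ k≤E g≤I))
      where
      k≤E : k ≤ E
      k≤E = ≤-trans (m≤m+n k _) 3k≤E
      I = ∑[ v ← V ] 𝟙 (ρ 0 c′ v ∧ ρ 0 v f)
      point : ∀ p⁺ x y w → (y ≡ true → w ≡ true) → 𝟙 x + 𝟙 y ≤ 𝟙 (x ∧ w) + 𝟙 (not p⁺ ∧ x) + 𝟙 (not p⁺ ∧ y) + 𝟙 p⁺
      point true  true  true  w h rewrite h refl = ≤-refl
      point true  true  false w h = ≤-trans (≤-refl {1}) (m≤n+m 1 _)
      point true  false true  w h = ≤-refl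
      point true  false false w h = z≤n
      point false x     y     w h = ≤-trans (m≤n+m (𝟙 x + 𝟙 y) (𝟙 (x ∧ w))) (≤-reflexive (eq (𝟙 (x ∧ w)) (𝟙 x) (𝟙 y)))
        where
        eq : ∀ i x y → i + (x + y) ≡ i + x + y + 0
        eq = solve-∀
      total : #ρ 0 c′ + #ρ 0 f ≤ I + far c′ + far f + #ρ (2 + j) z
      total = ≤-trans (≤-reflexive (sym (∑-+ V _ _)))
        (≤-trans (∑-mono V (λ v → point (p⁺ v) (ρ 0 c′ v) (ρ 0 f v) (ρ 0 v f) (ρ-sym 0)))
          (≤-reflexive (trans (∑-+ V _ _) (cong (_+ #ρ (2 + j) z) (trans (∑-+ V _ _) (cong (_+ far f) (∑-+ V _ _)))))))
      g≤I : g ≤ I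
      g≤I = *-cancelˡ-≤ (4 * E * k) {{m*n≢0 (4 * E) k {{m*n≢0 4 E {{_}} {{>-nonZero 0<E}}}} {{>-nonZero 0<k}}}} (lin 0
        ((E * k) ⊙ (#ρ₀ c′ ⊕ #ρ₀ f) ⊕ (4 * E * k) ⊙ total ⊕ E ⊙ (<⇒≤ hc ⊕ <⇒≤ hf) ⊕ (4 * k) ⊙ slow ⊕ (2 * k) ⊙ small
          ⊕ (2 * E + 6 * k) ⊙ dense ⊕ (2 * k * g) ⊙ 3k≤E)
        (eq E k n g (#ρ 0 c′) (#ρ 0 f) I (far c′) (far f) (#ρ (2 + j) z) (#ρ (1 + j) z)))
        where
        eq : ∀ E k n g x y I u w P⁺ P →
          4 * E * k * I + (E * k * ((n + 4 * g) + (n + 4 * g)) + 4 * E * k * (x + y) + E * (4 * k * u + 4 * k * w)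
            + 4 * k * (E * P⁺) + 2 * k * (E * (2 * P)) + (2 * E + 6 * k) * n + 2 * k * g * (3 * k))
          ≡ 4 * E * k * g + (E * k * (4 * x + 4 * y) + 4 * E * k * (I + u + w + P⁺) + E * (n + n)
            + 4 * k * (E * P + n) + 2 * k * (E * n + n) + (2 * E + 6 * k) * (k * g) + 2 * k * g * E) + 0
        eq = solve-∀

    mostly-near : E * ∑[ c′ ← V ] ∑[ f ← V ] 𝟙 (p c′ ∧ p f ∧ not (near c′ f)) ≤ 8 * k * n ^ 2
    mostly-near = begin
      E * ∑[ c′ ← V ] ∑[ f ← V ] 𝟙 (p c′ ∧ p f ∧ not (near c′ f))
        ≤⟨ E ⊙ ∑-mono V (λ c′ → ∑-mono V (λ f → each c′ f)) ⟩
      E * ∑[ c′ ← V ] ∑[ f ← V ] (𝟙 (exc c′) + 𝟙 (exc f))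
        ≡⟨ cong (E *_) (trans (∑-cong V (λ c′ → trans (∑-+ V _ _) (cong (_+ x) (∑-V-const _))))
             (trans (∑-+ V _ _) (cong₂ _+_ (∑-*ˡ n V _) (∑-V-const x)))) ⟩
      E * (n * x + n * x)
        ≡⟨ eq₁ E n x ⟩
      2 * n * (E * x)
        ≤⟨ (2 * n) ⊙ exc-few ⟩
      2 * n * (4 * k * n)
        ≡⟨ eq₂ n k ⟩
      8 * k * n ^ 2 ∎
      where
      open ≤-Reasoning
      x = ∑[ c′ ← V ] 𝟙 (exc c′)
      eq₁ : ∀ E n x → E * (n * x + n * x) ≡ 2 * n * (E * x)
      eq₁ = solve-∀
      eq₂ : ∀ n k → 2 * n * (4 * k * n) ≡ 8 * k * (n * (n * 1))
      eq₂ = solve-∀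
      each : ∀ c′ f → 𝟙 (p c′ ∧ p f ∧ not (near c′ f)) ≤ 𝟙 (exc c′) + 𝟙 (exc f)
      each c′ f = point (p c′) (p f) (near c′ f) (n ≤ᵇ 4 * k * far c′) (n ≤ᵇ 4 * k * far f)
        (λ h₁ h₂ → near-of c′ f (false-≤ᵇ h₁) (false-≤ᵇ h₂))
        where
        point : ∀ a b r s t → (s ≡ false → t ≡ false → r ≡ true) → 𝟙 (a ∧ b ∧ not r) ≤ 𝟙 (a ∧ s) + 𝟙 (b ∧ t)
        point false b     r     s     t     h = z≤n
        point true  false r     s     t     h = z≤n
        point true  true  r     true  t     h = ≤-trans (𝟙≤1 (not r)) (s≤s z≤n)
        point true  true  r     false true  h = 𝟙≤1 (not r)
        point true  true  r     false false h rewrite h refl refl = z≤n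

    no-small-class : ⊥
    no-small-class = Class.Contradiction.contradiction e sym₁₂ sym₂₃ irr D g k codeg half dense 2≤n
      p p⁺ near E (λ v → ρ-suc (1 + j))
      (≤-trans (#ρ₀ z) (4 ⊙ #ρ-≤ {0} {1 + j} z≤n z)) small slow monochrome transfer mostly-near D≤n 6≤g 60≤k E-large

  -- The slow step has an index `i < 2 * E`, and non-exchangeability is needed up to level `2 + i`.
  K : ℕ
  K = 1 + 2 * E

  -- If `x` and `y` are not exchangeable at level `K`, their classes at all lower levels almost
  -- avoid each other, so the smaller one has at most `n/2 + n/2E` vertices. `slow-step` is applied
  -- to the sum of the two sizes: as neither decreases, a slow step of the sum is slow for both,
  -- whichever class is the smaller.
  reach-all : ∀ x y → Reach (h K) (c K) x y
  reach-all x y = by-cases (ρ K x y) refl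
    where
    by-cases : ∀ b → ρ K x y ≡ b → Reach (h K) (c K) x y
    by-cases true  r = reachᵇ-sound {h K} {c K} {x} {y} r
    by-cases false r = ⊥-elim (use (slow-step E n f 0<E f≤))
      where
      f : ℕ → ℕ
      f i = #ρ (1 + i) x + #ρ (1 + i) y
      #ρ≤n : ∀ i z → #ρ i z ≤ n
      #ρ≤n i z = ≤-trans (∑-V-≤const 1 (λ v → 𝟙≤1 (ρ i z v))) (≤-reflexive (*-identityʳ n))
      f≤ : ∀ i → f i ≤ 2 * n
      f≤ i = ≤-trans (#ρ≤n (1 + i) x ⊕ #ρ≤n (1 + i) y) (≤-reflexive (cong (n +_) (sym (+-identityʳ n))))
      use : (∃ λ i → i < 2 * E × E * f (suc i) ≤ E * f i + n) → ⊥
      use (i , i<2E , slow) = choose (≤-total (#ρ (1 + i) x) (#ρ (1 + i) y))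
        where
        A  = #ρ (1 + i) x
        B  = #ρ (1 + i) y
        A⁺ = #ρ (2 + i) x
        B⁺ = #ρ (2 + i) y
        I  = ∑[ v ← V ] 𝟙 (ρ (1 + i) x v ∧ ρ (1 + i) v y)
        apart : ρ (2 + i) x y ≡ false
        apart with ρ (2 + i) x y in r′
        ... | false = refl
        ... | true  = ⊥-elim (true≢false (ρ-≤ {2 + i} {K} (s≤s i<2E) r′) r)
        meet : A + B ≤ n + I
        meet = ≤-trans (#∧ (ρ (1 + i) x) (ρ (1 + i) y)) (+-monoʳ-≤ n (∑-mono V (λ v →
          𝟙-mono {ρ (1 + i) x v ∧ ρ (1 + i) y v} (λ r → let r₁ , r₂ = ∧-true {ρ (1 + i) x v} r in r₁ ∧ᵗ ρ-sym (1 + i) r₂))))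
        EI≤n : E * I ≤ n
        EI≤n = ¬compose (1 + i) apart
        A≤A⁺ : A ≤ A⁺
        A≤A⁺ = #ρ-≤ {1 + i} {2 + i} (n≤1+n (1 + i)) x
        B≤B⁺ : B ≤ B⁺
        B≤B⁺ = #ρ-≤ {1 + i} {2 + i} (n≤1+n (1 + i)) y
        eq₁ : ∀ E n A B A⁺ B⁺ → E * A + n + (E * (A⁺ + B⁺) + E * B) ≡ E * A⁺ + (E * (A + B) + n + E * B⁺) + 0
        eq₁ = solve-∀
        eq₂ : ∀ E n A B I → E * n + n + (E * (A + B) + E * I + E * A) ≡ E * (2 * A) + (E * (n + I) + n + E * B) + 0
        eq₂ = solve-∀
        eq₃ : ∀ E n A B A⁺ B⁺ → E * B + n + (E * (A⁺ + B⁺) + E * A) ≡ E * B⁺ + (E * (A + B) + n + E * A⁺) + 0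
        eq₃ = solve-∀
        eq₄ : ∀ E n A B I → E * n + n + (E * (A + B) + E * I + E * B) ≡ E * (2 * B) + (E * (n + I) + n + E * A) + 0
        eq₄ = solve-∀
        choose : (A ≤ B) ⊎ (B ≤ A) → ⊥
        choose (inj₁ A≤B) = no-small-class i x (lin 0 (slow ⊕ E ⊙ B≤B⁺) (eq₁ E n A B A⁺ B⁺))
                                               (lin 0 (E ⊙ meet ⊕ EI≤n ⊕ E ⊙ A≤B) (eq₂ E n A B I))
        choose (inj₂ B≤A) = no-small-class i y (lin 0 (slow ⊕ E ⊙ A≤A⁺) (eq₃ E n A B A⁺ B⁺))
                                               (lin 0 (E ⊙ meet ⊕ EI≤n ⊕ E ⊙ B≤A) (eq₄ E n A B I))

-- Selecting a word whose letters lie in distinct classes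

module _ {n : ℕ} (rep : Fin n → Fin n) where

  reps : List (Fin n) → List (Fin n)
  reps []      = []
  reps (x ∷ s) = rep x ∷ reps s

  record Spread (F s : List (Fin n)) : Set where
    field
      distinct : ∀ r → mult (reps s) r ≤ 1
      avoids   : ∀ r → 1 ≤ mult (reps s) r → mult F r ≡ 0

  open Spread public

  -- Letters are chosen one by one. A class has at most four letters, so `F` and the earlier choices
  -- exclude at most `K` letters in each of the `m` positions. This destroys at most `m * K` times
  -- `length xs ^ (m - 1)` words, fewer than satisfy `P`.
  rainbow : ∀ m (xs F : List (Fin n)) (P : List (Fin n) → Bool) K →
            (∀ u → ∑[ x ← xs ] 𝟙 (u == rep x) ≤ 4) → 4 * (length F + m) ≤ K →
            m * K * length xs ^ m < length xs * ∑ʷ xs m (λ s → 𝟙 (P s)) →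
            ∃ λ s → length s ≡ m × All (_∈ xs) s × P s ≡ true × Spread F s
  rainbow zero xs F P K _ _ h = [] , refl , [] , 𝟙-pos (positive (length xs) (𝟙 (P [])) h) ,
    record { distinct = λ _ → z≤n ; avoids = λ _ () }
    where
    positive : ∀ t x → 0 < t * x → 1 ≤ x
    positive t zero    h = ⊥-elim (<⇒≱ h (≤-reflexive (*-zeroʳ t)))
    positive t (suc x) h = s≤s z≤n
  rainbow (suc m) xs F P K small K≥ h =
    let x , x∈ , lt = ∑-witness xs {λ x → t * (good x * cnt x)} {λ _ → m * K * t ^ m} sum-good in
    finish x x∈ (mult F (rep x)) refl lt
    where
    t = length xs
    cnt : Fin n → ℕ
    cnt x = ∑ʷ xs m (λ s → 𝟙 (P (x ∷ s)))
    free : ℕ → ℕ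
    free zero    = 1
    free (suc _) = 0
    good : Fin n → ℕ
    good x = free (mult F (rep x))
    bad-few : ∑[ x ← xs ] mult F (rep x) ≤ K
    bad-few = begin
      ∑[ x ← xs ] ∑[ u ← F ] 𝟙 (u == rep x)  ≡⟨ ∑-swap xs F _ ⟩
      ∑[ u ← F ] ∑[ x ← xs ] 𝟙 (u == rep x)  ≤⟨ ∑-≤const F 4 small ⟩
      length F * 4                           ≡⟨ *-comm (length F) 4 ⟩
      4 * length F                           ≤⟨ 4 ⊙ m≤m+n (length F) (suc m) ⟩
      4 * (length F + suc m)                 ≤⟨ K≥ ⟩
      K                                      ∎
      where open ≤-Reasoning
    cnt≤ : ∀ x → cnt x ≤ t ^ m
    cnt≤ x = ≤-trans (∑ʷ-≤const xs m 1 (λ s → 𝟙≤1 _)) (≤-reflexive (*-identityʳ (t ^ m)))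
    split : ∀ x → cnt x ≤ good x * cnt x + mult F (rep x) * t ^ m
    split x with mult F (rep x)
    ... | zero  = ≤-reflexive (sym (trans (+-identityʳ (1 * cnt x)) (*-identityˡ (cnt x))))
    ... | suc i = ≤-trans (cnt≤ x) (m≤m+n (t ^ m) (i * t ^ m))
    total : ∑ xs cnt ≤ ∑[ x ← xs ] (good x * cnt x) + K * t ^ m
    total = ≤-trans (∑-mono xs split) (≤-trans (≤-reflexive (∑-+ xs _ _))
      (+-monoʳ-≤ (∑[ x ← xs ] (good x * cnt x))
        (≤-trans (≤-reflexive (∑-*ʳ (t ^ m) xs (λ x → mult F (rep x)))) (*-monoˡ-≤ (t ^ m) bad-few))))
    sum-good : ∑[ x ← xs ] (m * K * t ^ m) < ∑[ x ← xs ] (t * (good x * cnt x))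
    sum-good = begin-strict
      ∑[ x ← xs ] (m * K * t ^ m)          ≡⟨ ∑-const xs (m * K * t ^ m) ⟩
      t * (m * K * t ^ m)                  <⟨ lin 0 (h ⊕ t ⊙ total) (eq m K t (t ^ m) (∑ xs cnt) _) ⟩
      t * ∑[ x ← xs ] (good x * cnt x)     ≡⟨ sym (∑-*ˡ t xs (λ x → good x * cnt x)) ⟩
      ∑[ x ← xs ] (t * (good x * cnt x))   ∎
      where
      open ≤-Reasoning
      eq : ∀ m K t p c g → t * g + (1 + (1 + m) * K * (t * p) + t * c) ≡ 1 + t * (m * K * p) + (t * c + t * (g + K * p)) + 0
      eq = solve-∀
    finish : ∀ x → x ∈ xs → ∀ i → mult F (rep x) ≡ i → m * K * t ^ m < t * (free i * cnt x) →
             ∃ λ s → length s ≡ suc m × All (_∈ xs) s × P s ≡ true × Spread F s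
    finish x x∈ (suc i) _ lt = ⊥-elim (<⇒≱ lt (≤-trans (≤-reflexive (*-zeroʳ t)) z≤n))
    finish x x∈ zero Fx lt =
      let s , len , s∈ , Ps , sp = rainbow m xs (rep x ∷ F) (λ s → P (x ∷ s)) K small
            (≤-trans (≤-reflexive (cong (4 *_) (sym (+-suc (length F) m)))) K≥)
            (<-≤-trans lt (≤-reflexive (cong (t *_) (*-identityˡ (cnt x)))))
      in x ∷ s , cong suc len , x∈ ∷ s∈ , Ps , record
        { distinct = λ r → distinct-∷ (rep x == r) (mult (reps s) r) refl (distinct sp r)
            (λ eq h → clash {rep x} {r} eq (avoids sp r h))
        ; avoids = λ r → avoids-∷ r (rep x == r) refl (λ h → avoids sp r h) }
      where
      clash : ∀ {u r} → (u == r) ≡ true → 𝟙 (u == r) + mult F r ≡ 0 → ⊥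
      clash eq h rewrite eq with h
      ... | ()
      distinct-∷ : ∀ b i {c} → b ≡ c → i ≤ 1 → (b ≡ true → 1 ≤ i → ⊥) → 𝟙 b + i ≤ 1
      distinct-∷ false i       _ i≤1 _ = i≤1
      distinct-∷ true  zero    _ _   _ = s≤s z≤n
      distinct-∷ true  (suc i) _ _   f = ⊥-elim (f refl (s≤s z≤n))
      avoids-∷ : ∀ r b {i} → (rep x == r) ≡ b → (1 ≤ i → 𝟙 (rep x == r) + mult F r ≡ 0) → 1 ≤ 𝟙 b + i → mult F r ≡ 0
      avoids-∷ r true  eq f h = trans (cong (mult F) (sym (==-sound eq))) Fx
      avoids-∷ r false eq f h = trans (cong (λ b → 𝟙 b + mult F r) (sym eq)) (f h)

-- Greedy covering

module Greedy {n : ℕ} {R : Set} (m C₀ : ℕ) (ab : R → List (Fin n) → Bool)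
  (dense : ∀ r → n ^ m ≤ suc C₀ * ∑ʷ (allFin n) m (λ s → 𝟙 (ab r s))) where

  private
    V = allFin n
    C = suc C₀

  -- The proportion of the requirements that each pick satisfies is at least 1/(1 + Q).
  Q : ℕ
  Q = C₀ + C

  #ab : List R → List (Fin n) → ℕ
  #ab Rq s = ∑[ r ← Rq ] 𝟙 (ab r s)

  Fits : List (Fin n) → Set
  Fits F = 2 * C * (m * (4 * (length F + m))) < n

  -- A random word satisfies on average a proportion `1 / C` of the requirements, so a proportion of
  -- at least `1 / 2C` of all words satisfy `1 / 2C` of the requirements or more. `rainbow` finds
  -- one of these with distinct letters outside `F`.
  pick : ∀ F Rq → Fits F → 0 < length Rq →
         ∃ λ s → length s ≡ m × Spread id F s × length Rq ≤ suc Q * #ab Rq s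
  pick F Rq fits 0<Rq =
    let s , len , _ , Ps , sp = rainbow id m V F P (4 * (length F + m)) one-each ≤-refl enough in
    s , len , sp , ≤-trans (true-≤ᵇ Ps) (≤-reflexive (cong (_* #ab Rq s) (eq₀ C₀)))
    where
    ρ = length Rq
    eq₀ : ∀ c → 2 * (1 + c) ≡ 1 + (c + (1 + c))
    eq₀ = solve-∀
    P : List (Fin n) → Bool
    P s = ρ ≤ᵇ 2 * C * #ab Rq s
    cntP = ∑ʷ V m (λ s → 𝟙 (P s))
    one-each : ∀ u → ∑[ x ← V ] 𝟙 (u == x) ≤ 4
    one-each u = ≤-trans (≤-reflexive (trans (∑-cong V (λ x → sym (*-identityʳ _))) (∑-delta u (λ _ → 1)))) (s≤s z≤n)
    sum-w : ρ * n ^ m ≤ C * ∑ʷ V m (#ab Rq)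
    sum-w = begin
      ρ * n ^ m
        ≡⟨ sym (∑-const Rq (n ^ m)) ⟩
      ∑[ r ← Rq ] (n ^ m)
        ≤⟨ ∑-mono Rq dense ⟩
      ∑[ r ← Rq ] (C * ∑ʷ V m (λ s → 𝟙 (ab r s)))
        ≡⟨ trans (∑-*ˡ C Rq _) (cong (C *_) (∑-∑ʷ-swap Rq V m (λ r s → 𝟙 (ab r s)))) ⟩
      C * ∑ʷ V m (#ab Rq) ∎
      where open ≤-Reasoning
    #ab≤ρ : ∀ s → #ab Rq s ≤ ρ
    #ab≤ρ s = ≤-trans (∑-≤const Rq 1 (λ r → 𝟙≤1 _)) (≤-reflexive (*-identityʳ ρ))
    each : ∀ s → 2 * C * #ab Rq s ≤ 2 * C * ρ * 𝟙 (P s) + ρ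
    each s = by-cases (P s) refl
      where
      by-cases : ∀ b → P s ≡ b → 2 * C * #ab Rq s ≤ 2 * C * ρ * 𝟙 b + ρ
      by-cases true  _ = ≤-trans ((2 * C) ⊙ #ab≤ρ s) (≤-trans (≤-reflexive (sym (*-identityʳ (2 * C * ρ)))) (m≤m+n _ ρ))
      by-cases false h = ≤-trans (<⇒≤ (false-≤ᵇ h)) (m≤n+m ρ _)
    sum-each : 2 * C * ∑ʷ V m (#ab Rq) ≤ 2 * C * ρ * cntP + n ^ m * ρ
    sum-each = begin
      2 * C * ∑ʷ V m (#ab Rq)
        ≡⟨ sym (∑ʷ-*ˡ (2 * C) V m (#ab Rq)) ⟩
      ∑ʷ V m (λ s → 2 * C * #ab Rq s)
        ≤⟨ ∑ʷ-mono V m (λ s _ → each s) ⟩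
      ∑ʷ V m (λ s → 2 * C * ρ * 𝟙 (P s) + ρ)
        ≡⟨ trans (∑ʷ-+ V m _ _) (cong₂ _+_ (∑ʷ-*ˡ (2 * C * ρ) V m (λ s → 𝟙 (P s)))
             (trans (∑ʷ-const V m ρ) (cong (λ l → l ^ m * ρ) (length-allFin n)))) ⟩
      2 * C * ρ * cntP + n ^ m * ρ ∎
      where open ≤-Reasoning
    cntP-large : n ^ m ≤ 2 * C * cntP
    cntP-large = *-cancelˡ-≤ ρ {{>-nonZero 0<Rq}} (lin 0 (2 ⊙ sum-w ⊕ sum-each)
      (eq C ρ (n ^ m) (∑ʷ V m (#ab Rq)) cntP))
      where
      eq : ∀ C ρ N w c → ρ * (2 * C * c) + (2 * (ρ * N) + 2 * C * w) ≡ ρ * N + (2 * (C * w) + (2 * C * ρ * c + N * ρ)) + 0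
      eq = solve-∀
    0<n^m : 0 < n ^ m
    0<n^m = m^n>0 n {{>-nonZero (≤-<-trans z≤n fits)}} m
    enough : m * (4 * (length F + m)) * length V ^ m < length V * cntP
    enough rewrite length-allFin n = *-cancelˡ-< (2 * C) _ _ (begin-strict
      2 * C * (m * (4 * (length F + m)) * n ^ m)
        ≡⟨ sym (*-assoc (2 * C) (m * (4 * (length F + m))) (n ^ m)) ⟩
      2 * C * (m * (4 * (length F + m))) * n ^ m
        <⟨ *-monoˡ-< (n ^ m) {{>-nonZero 0<n^m}} fits ⟩
      n * n ^ m
        ≤⟨ n ⊙ cntP-large ⟩
      n * (2 * C * cntP)
        ≡⟨ eq n (2 * C) cntP ⟩
      2 * C * (n * cntP) ∎)
      where
      open ≤-Reasoning
      eq : ∀ a b c → a * (b * c) ≡ b * (a * c)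
      eq = solve-∀

  rest : List (Fin n) → List R → List R
  rest s []       = []
  rest s (r ∷ Rq) with ab r s
  ... | true  = rest s Rq
  ... | false = r ∷ rest s Rq

  length-rest : ∀ s Rq → length (rest s Rq) + #ab Rq s ≡ length Rq
  length-rest s []       = refl
  length-rest s (r ∷ Rq) with ab r s
  ... | true  = trans (+-suc (length (rest s Rq)) (#ab Rq s)) (cong suc (length-rest s Rq))
  ... | false = cong suc (length-rest s Rq)

  ∈-rest : ∀ s {r} Rq → r ∈ Rq → (ab r s ≡ true) ⊎ (r ∈ rest s Rq)
  ∈-rest s (r ∷ Rq) (here refl) with ab r s in eq
  ... | true  = inj₁ refl
  ... | false = inj₂ (here refl)
  ∈-rest s (r ∷ Rq) (there p) with ab r s | ∈-rest s Rq p
  ... | true  | inj₁ h = inj₁ h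
  ... | true  | inj₂ h = inj₂ h
  ... | false | inj₁ h = inj₁ h
  ... | false | inj₂ h = inj₂ (there h)

  some-satisfied : ∀ s Rq → 1 ≤ #ab Rq s → ∃ λ r → ab r s ≡ true
  some-satisfied s (r ∷ Rq) h with ab r s in eq
  ... | true  = r , eq
  ... | false = some-satisfied s Rq h

  -- `shrink` states that each of the `J` rounds leaves at most a proportion `Q / (1 + Q)` of the
  -- requirements. `useful` insists that every pick satisfies something: an absorber of any 4-set is
  -- itself a union of tiles.
  record Cover (J : ℕ) (F : List (Fin n)) (Rq : List R) : Set where
    field
      picks   : List (List (Fin n))
      few     : length (concat picks) ≤ J * m
      useful  : All (λ s → length s ≡ m × ∃ λ r → ab r s ≡ true) picks
      disjoint : Spread id F (concat picks)
      left    : List R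
      shrink  : suc Q ^ J * length left ≤ Q ^ J * length Rq
      covers  : ∀ {r} → r ∈ Rq → (r ∈ left) ⊎ Any (λ s → ab r s ≡ true) picks

  open Cover public

  spread-++ : ∀ (F s t : List (Fin n)) → Spread id F s → Spread id (s ++ F) t → Spread id F (s ++ t)
  spread-++ F s t p q = record { distinct = dist ; avoids = avoid }
    where
    reps-id : ∀ s → reps id s ≡ s
    reps-id []      = refl
    reps-id (x ∷ s) = cong (x ∷_) (reps-id s)
    one : ∀ i j → i ≤ 1 → j ≤ 1 → (1 ≤ j → i ≡ 0) → i + j ≤ 1
    one zero    j       h₁ h₂ f = h₂
    one (suc i) zero    h₁ h₂ f = ≤-trans (≤-reflexive (+-identityʳ (suc i))) h₁
    one (suc i) (suc j) h₁ h₂ f with f (s≤s z≤n)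
    ... | ()
    dist : ∀ r → mult (reps id (s ++ t)) r ≤ 1
    dist r rewrite reps-id (s ++ t) | ∑-++ s t (λ u → 𝟙 (u == r)) =
      one (mult s r) (mult t r) (subst (λ l → mult l r ≤ 1) (reps-id s) (distinct p r))
          (subst (λ l → mult l r ≤ 1) (reps-id t) (distinct q r))
          (λ h → m+n≡0⇒m≡0 (mult s r) (trans (sym (∑-++ s F _)) (avoids q r (subst (λ l → 1 ≤ mult l r) (sym (reps-id t)) h))))
    avoid : ∀ r → 1 ≤ mult (reps id (s ++ t)) r → mult F r ≡ 0
    avoid r h = by-cases (mult s r) refl
      where
      h′ : 1 ≤ mult s r + mult t r
      h′ = subst (1 ≤_) (∑-++ s t (λ u → 𝟙 (u == r))) (subst (λ l → 1 ≤ mult l r) (reps-id (s ++ t)) h)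
      by-cases : ∀ i → mult s r ≡ i → mult F r ≡ 0
      by-cases (suc i) eq = avoids p r (subst (λ l → 1 ≤ mult l r) (sym (reps-id s)) (≤-trans (s≤s z≤n) (≤-reflexive (sym eq))))
      by-cases zero    eq = m+n≡0⇒n≡0 (mult s r) (trans (sym (∑-++ s F _))
        (avoids q r (subst (λ l → 1 ≤ mult l r) (sym (reps-id t)) (subst (λ i → 1 ≤ i + mult t r) eq h′))))

  cover : ∀ J F Rq → 2 * C * (m * (4 * (J * m + length F + m))) < n → Cover J F Rq
  cover zero F Rq fits = record
    { picks = [] ; few = z≤n ; useful = [] ; disjoint = record { distinct = λ _ → z≤n ; avoids = λ _ () }
    ; left = Rq ; shrink = ≤-refl ; covers = inj₁ }
  cover (suc J) F [] fits = record
    { picks = [] ; few = z≤n ; useful = [] ; disjoint = record { distinct = λ _ → z≤n ; avoids = λ _ () }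
    ; left = [] ; shrink = ≤-trans (≤-reflexive (*-zeroʳ (suc Q ^ suc J))) z≤n ; covers = inj₁ }
  cover (suc J) F Rq@(_ ∷ _) fits = extend (pick F Rq fits-F (s≤s z≤n))
    where
    fits-F : Fits F
    fits-F = ≤-<-trans ((2 * C) ⊙ (m ⊙ (4 ⊙ +-monoˡ-≤ m (m≤n+m (length F) (suc J * m))))) fits
    extend : (∃ λ s → length s ≡ m × Spread id F s × length Rq ≤ suc Q * #ab Rq s) → Cover (suc J) F Rq
    extend (s , len , sp , hit) = record
      { picks = s ∷ picks rec
      ; few = ≤-trans (≤-reflexive (length-++ s)) (≤-reflexive len ⊕ few rec)
      ; useful = (len , some-satisfied s Rq (positive hit)) ∷ useful rec
      ; disjoint = spread-++ F s (concat (picks rec)) sp (disjoint rec)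
      ; left = left rec
      ; shrink = shrunk
      ; covers = λ r∈ → both (∈-rest s Rq r∈) }
      where
      positive : ∀ {x} → suc x ≤ suc Q * #ab Rq s → 1 ≤ #ab Rq s
      positive h with #ab Rq s
      ... | zero  = ⊥-elim (<⇒≱ (s≤s z≤n) (≤-trans h (≤-reflexive (*-zeroʳ (suc Q)))))
      ... | suc _ = s≤s z≤n
      rec : Cover J (s ++ F) (rest s Rq)
      rec = cover J (s ++ F) (rest s Rq) (≤-<-trans (≤-reflexive (cong (λ x → 2 * C * (m * (4 * x)))
        (trans (cong (λ l → J * m + l + m) (trans (length-++ s) (cong (_+ length F) len)))
               (eq (J * m) m (length F))))) fits)
        where
        eq : ∀ a m f → a + (m + f) + m ≡ m + a + f + m
        eq = solve-∀
      both : ∀ {r} → (ab r s ≡ true) ⊎ (r ∈ rest s Rq) → (r ∈ left rec) ⊎ Any (λ s → ab r s ≡ true) (s ∷ picks rec)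
      both (inj₁ h) = inj₂ (here h)
      both (inj₂ h) with covers rec h
      ... | inj₁ h′ = inj₁ h′
      ... | inj₂ h′ = inj₂ (there h′)
      shrunk : suc Q ^ suc J * length (left rec) ≤ Q ^ suc J * length Rq
      shrunk = begin
        suc Q * suc Q ^ J * length (left rec)
          ≡⟨ *-assoc (suc Q) (suc Q ^ J) _ ⟩
        suc Q * (suc Q ^ J * length (left rec))
          ≤⟨ suc Q ⊙ shrink rec ⟩
        suc Q * (Q ^ J * length (rest s Rq))
          ≡⟨ eq (suc Q) (Q ^ J) (length (rest s Rq)) ⟩
        Q ^ J * (suc Q * length (rest s Rq))
          ≤⟨ (Q ^ J) ⊙ per-pick ⟩
        Q ^ J * (Q * length Rq)
          ≡⟨ eq″ (Q ^ J) Q (length Rq) ⟩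
        Q * Q ^ J * length Rq ∎
        where
        open ≤-Reasoning
        eq : ∀ a b c → a * (b * c) ≡ b * (a * c)
        eq = solve-∀
        eq″ : ∀ a b c → a * (b * c) ≡ b * a * c
        eq″ = solve-∀
        eq′ : ∀ Q x y → Q * (x + y) + (x + y) ≡ (1 + Q) * x + (1 + Q) * y + 0
        eq′ = solve-∀
        per-pick : suc Q * length (rest s Rq) ≤ Q * length Rq
        per-pick = subst (λ l → suc Q * length (rest s Rq) ≤ Q * l) (length-rest s Rq)
          (lin 0 (≤-trans (≤-reflexive (length-rest s Rq)) hit) (eq′ Q (length (rest s Rq)) (#ab Rq s)))

Quad : ℕ → Set
Quad n = Fin n × Fin n × Fin n × Fin n

verts : ∀ {n} → Quad n → List (Fin n)
verts (a , b , c , d) = a ∷ b ∷ c ∷ d ∷ []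

flat : ∀ {n} → List (Quad n) → List (Fin n)
flat []       = []
flat (x ∷ xs) = verts x ++ flat xs

quads : ∀ n → List (Quad n)
quads n = cartesianProduct (allFin n) (cartesianProduct (allFin n) (cartesianProduct (allFin n) (allFin n)))

∈-quads : ∀ {n} (r : Quad n) → r ∈ quads n
∈-quads (a , b , c , d) =
  ∈-cartesianProduct⁺ (∈-allFin a) (∈-cartesianProduct⁺ (∈-allFin b) (∈-cartesianProduct⁺ (∈-allFin c) (∈-allFin d)))

length-cartesianProduct : ∀ {A B : Set} (xs : List A) (ys : List B) →
                          length (cartesianProduct xs ys) ≡ length xs * length ys
length-cartesianProduct []       ys = refl
length-cartesianProduct (x ∷ xs) ys =
  trans (length-++ (map (x ,_) ys)) (cong₂ _+_ (length-map (x ,_) ys) (length-cartesianProduct xs ys))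

length-quads : ∀ n → length (quads n) ≡ n ^ 4
length-quads n = trans (length-cartesianProduct V _) (cong₂ _*_ len
  (trans (length-cartesianProduct V _) (cong₂ _*_ len
    (trans (length-cartesianProduct V V) (cong₂ _*_ len (trans len (sym (*-identityʳ n))))))))
  where
  V = allFin n
  len = length-allFin n

-- Absorbers for 4-sets

module Absorbers {n : ℕ} (e : Fin n → Fin n → Fin n → Bool) (τ h c : ℕ)
  (many-tiles : n ^ 4 ≤ τ * ∑[ a ← allFin n ] ∑[ b ← allFin n ] ∑[ c ← allFin n ] ∑[ d ← allFin n ] 𝟙 (Tiles.tile e a b c d))
  (reach-all : ∀ x y → Tiles.Reach e h c x y) where

  open Tiles e

  M : ℕ
  M = 3 + 4 * h

  size : ℕ
  size = 4 + ((M + M) + (M + M))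

  C₀ : ℕ
  C₀ = τ * (1 * (c * c) * (1 * (c * c)))

  absorbs : Quad n → List (Fin n) → Bool
  absorbs r s = fac s ∧ fac (verts r ++ s)

  -- `∑ʷ-glue` appends two words at a time, so the four exchanges of an absorber are grouped in
  -- pairs and glued twice.
  exchange₂ : Fin n → Fin n → Fin n → Fin n → List (Fin n) → Bool
  exchange₂ x₁ x₂ y₁ y₂ s = fac (x₁ ∷ x₂ ∷ s) ∧ fac (y₁ ∷ y₂ ∷ s)

  exchange₂-dense : ∀ x₁ x₂ y₁ y₂ → n ^ (M + M) ≤ 1 * (c * c) * ∑ʷ V (M + M) (λ s → 𝟙 (exchange₂ x₁ x₂ y₁ y₂ s))
  exchange₂-dense x₁ x₂ y₁ y₂ = ∑ʷ-glue 0 M 1 c empty (λ _ s → joins x₁ y₁ s) (λ _ t → joins x₂ y₂ t)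
    (exchange₂ x₁ x₂ y₁ y₂) (λ _ _ → many (reach-all x₁ y₁) , many (reach-all x₂ y₂)) glue ≤-refl
    where
    empty : List (Fin n) → Bool
    empty []      = true
    empty (_ ∷ _) = false
    eq : ∀ x s y t → x + (s + (y + t)) ≡ x + (y + (s + t))
    eq = solve-∀
    both : ∀ x₁ x₂ s t → Fac (x₁ ∷ s) → Fac (x₂ ∷ t) → Fac (x₁ ∷ x₂ ∷ s ++ t)
    both x₁ x₂ s t p q = Fac-resp ((x₁ ∷ s) ++ x₂ ∷ t) (x₁ ∷ x₂ ∷ s ++ t) eqv (Fac-++ {x₁ ∷ s} {x₂ ∷ t} p q)
      where
      eqv : ∀ v → mult ((x₁ ∷ s) ++ x₂ ∷ t) v ≡ mult (x₁ ∷ x₂ ∷ s ++ t) v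
      eqv v rewrite mult-++ s (x₂ ∷ t) v | mult-++ s t v = eq (𝟙 (x₁ == v)) (mult s v) (𝟙 (x₂ == v)) (mult t v)
    glue : ∀ u s t → empty u ≡ true → joins x₁ y₁ s ≡ true → joins x₂ y₂ t ≡ true → exchange₂ x₁ x₂ y₁ y₂ (u ++ s ++ t) ≡ true
    glue [] s t _ p q =
      let p₁ , p₂ = joins-sound {x₁} {y₁} {s} p ; q₁ , q₂ = joins-sound {x₂} {y₂} {t} q in
      fac-complete (both x₁ x₂ s t p₁ q₁) ∧ᵗ fac-complete (both y₁ y₂ s t p₂ q₂)

  -- The absorber is a tile `y₁ y₂ y₃ y₄` with words that exchange each `xᵢ` with `yᵢ`. Alone, the
  -- words are completed by the `yᵢ`; in the presence of `r` they are completed by the `xᵢ`, and the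
  -- `yᵢ` form a tile of their own.
  absorbs-dense : ∀ r → n ^ size ≤ suc C₀ * ∑ʷ V size (λ s → 𝟙 (absorbs r s))
  absorbs-dense r@(x₁ , x₂ , x₃ , x₄) = ≤-trans
    (∑ʷ-glue 4 (M + M) τ (1 * (c * c)) rr P Q (absorbs r) dense glue many-tiles) (*-monoˡ-≤ _ (n≤1+n C₀))
    where
    rr : List (Fin n) → Bool
    rr (y₁ ∷ y₂ ∷ y₃ ∷ y₄ ∷ []) = tile y₁ y₂ y₃ y₄
    rr _                        = false
    P Q : List (Fin n) → List (Fin n) → Bool
    P (y₁ ∷ y₂ ∷ y₃ ∷ y₄ ∷ []) s = exchange₂ x₁ x₂ y₁ y₂ s
    P _                        s = false
    Q (y₁ ∷ y₂ ∷ y₃ ∷ y₄ ∷ []) s = exchange₂ x₃ x₄ y₃ y₄ s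
    Q _                        s = false
    dense : ∀ u → rr u ≡ true → _
    dense (y₁ ∷ y₂ ∷ y₃ ∷ y₄ ∷ []) _ = exchange₂-dense x₁ x₂ y₁ y₂ , exchange₂-dense x₃ x₄ y₃ y₄
    glue : ∀ u s t → rr u ≡ true → P u s ≡ true → Q u t ≡ true → absorbs r (u ++ s ++ t) ≡ true
    glue u@(y₁ ∷ y₂ ∷ y₃ ∷ y₄ ∷ []) s t hu hs ht =
      let p₁ , p₂ = ∧-true {fac (x₁ ∷ x₂ ∷ s)} hs ; q₁ , q₂ = ∧-true {fac (x₃ ∷ x₄ ∷ t)} ht in
      fac-complete (Fac-resp ((y₁ ∷ y₂ ∷ s) ++ y₃ ∷ y₄ ∷ t) (u ++ s ++ t) eqy
        (Fac-++ {y₁ ∷ y₂ ∷ s} {y₃ ∷ y₄ ∷ t} (fac-sound p₂) (fac-sound q₂)))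
      ∧ᵗ fac-complete (Fac-resp ((x₁ ∷ x₂ ∷ s) ++ x₃ ∷ x₄ ∷ u ++ t) (verts r ++ u ++ s ++ t) eqx
        (Fac-++ {x₁ ∷ x₂ ∷ s} {x₃ ∷ x₄ ∷ u ++ t} (fac-sound p₁)
          (Fac-resp (u ++ x₃ ∷ x₄ ∷ t) (x₃ ∷ x₄ ∷ u ++ t) eqt
            (Fac-++ {u} {x₃ ∷ x₄ ∷ t} (Fac-tile {y₁} {y₂} {y₃} {y₄} hu) (fac-sound q₁)))))
      where
      module _ (v : Fin n) where
        eq₁ : ∀ a b c d s t → a + (b + (s + (c + (d + t)))) ≡ a + (b + (c + (d + (s + t))))
        eq₁ = solve-∀
        eqy : mult ((y₁ ∷ y₂ ∷ s) ++ y₃ ∷ y₄ ∷ t) v ≡ mult (u ++ s ++ t) v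
        eqy rewrite mult-++ s (y₃ ∷ y₄ ∷ t) v | mult-++ s t v =
          eq₁ (𝟙 (y₁ == v)) (𝟙 (y₂ == v)) (𝟙 (y₃ == v)) (𝟙 (y₄ == v)) (mult s v) (mult t v)
        eq₂ : ∀ a b c d x y t → a + (b + (c + (d + (x + (y + t))))) ≡ x + (y + (a + (b + (c + (d + t)))))
        eq₂ = solve-∀
        eqt : mult (u ++ x₃ ∷ x₄ ∷ t) v ≡ mult (x₃ ∷ x₄ ∷ u ++ t) v
        eqt = eq₂ (𝟙 (y₁ == v)) (𝟙 (y₂ == v)) (𝟙 (y₃ == v)) (𝟙 (y₄ == v)) (𝟙 (x₃ == v)) (𝟙 (x₄ == v)) (mult t v)
        eq₃ : ∀ w x s y z a b c d t → w + (x + (s + (y + (z + (a + (b + (c + (d + t))))))))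
                                    ≡ w + (x + (y + (z + (a + (b + (c + (d + (s + t))))))))
        eq₃ = solve-∀
        eqx : mult ((x₁ ∷ x₂ ∷ s) ++ x₃ ∷ x₄ ∷ u ++ t) v ≡ mult (verts r ++ u ++ s ++ t) v
        eqx rewrite mult-++ s (x₃ ∷ x₄ ∷ u ++ t) v | mult-++ s t v =
          eq₃ (𝟙 (x₁ == v)) (𝟙 (x₂ == v)) (mult s v) (𝟙 (x₃ == v)) (𝟙 (x₄ == v))
              (𝟙 (y₁ == v)) (𝟙 (y₂ == v)) (𝟙 (y₃ == v)) (𝟙 (y₄ == v)) (mult t v)

  open Greedy size C₀ absorbs absorbs-dense

  -- A family serves one 4-set, whichever it turns out to be, while its other members are tiled by
  -- themselves. Several disjoint families absorb several 4-sets, so no matching between 4-sets and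
  -- absorbers within a family is required.
  record Family : Set where
    field
      members   : List (List (Fin n))
      balanced  : All Fac members
      universal : ∀ r → Any (λ s → absorbs r s ≡ true) members

  open Family public

  spare : ∀ {ps} → All Fac ps → Fac (concat ps)
  spare []              = [] , [] , λ _ → refl
  spare (_∷_ {x} p all) = Fac-++ {x} p (spare all)

  absorb : ∀ r {ps} → All Fac ps → Any (λ s → absorbs r s ≡ true) ps → Fac (verts r ++ concat ps)
  absorb r {s ∷ ps} (p ∷ all) (here h) =
    Fac-resp ((verts r ++ s) ++ concat ps) (verts r ++ s ++ concat ps) (λ v → refl)
      (Fac-++ {verts r ++ s} {concat ps} (fac-sound (proj₂ (∧-true {fac s} h))) (spare all))
  absorb r {s ∷ ps} (p ∷ all) (there a) =
    Fac-resp (s ++ verts r ++ concat ps) (verts r ++ s ++ concat ps) eqv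
      (Fac-++ {s} {verts r ++ concat ps} p (absorb r all a))
    where
    eq : ∀ a b c → a + (b + c) ≡ b + (a + c)
    eq = solve-∀
    eqv : ∀ v → mult (s ++ verts r ++ concat ps) v ≡ mult (verts r ++ s ++ concat ps) v
    eqv v rewrite mult-++ s (verts r ++ concat ps) v | mult-++ (verts r) (s ++ concat ps) v
                | mult-++ (verts r) (concat ps) v | mult-++ s (concat ps) v =
      eq (mult s v) (mult (verts r) v) (mult (concat ps) v)

  total : List Family → List (Fin n)
  total []       = []
  total (f ∷ fs) = concat (members f) ++ total fs

  absorb-all : ∀ fs L → length L ≤ length fs → Fac (flat L ++ total fs)
  absorb-all []       []      _ = [] , [] , λ _ → refl
  absorb-all (f ∷ fs) []      _ =
    Fac-++ {concat (members f)} {total fs} (spare (balanced f)) (absorb-all fs [] z≤n)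
  absorb-all (f ∷ fs) (r ∷ L) (s≤s le) =
    Fac-resp ((verts r ++ concat (members f)) ++ flat L ++ total fs)
             ((verts r ++ flat L) ++ concat (members f) ++ total fs) eqv
      (Fac-++ {verts r ++ concat (members f)} {flat L ++ total fs}
        (absorb r (balanced f) (universal f r)) (absorb-all fs L le))
    where
    P = concat (members f)
    eq : ∀ a b c d → a + b + (c + d) ≡ a + c + (b + d)
    eq = solve-∀
    eqv : ∀ v → mult ((verts r ++ P) ++ flat L ++ total fs) v ≡ mult ((verts r ++ flat L) ++ P ++ total fs) v
    eqv v rewrite mult-++ (verts r ++ P) (flat L ++ total fs) v | mult-++ (verts r ++ flat L) (P ++ total fs) v
                | mult-++ (verts r) P v | mult-++ (verts r) (flat L) v | mult-++ (flat L) (total fs) v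
                | mult-++ P (total fs) v = eq (mult (verts r) v) (mult P v) (mult (flat L) v) (mult (total fs) v)

  -- All `n ^ 4` quadruples are the requirements. After `J` rounds less than one of them is left,
  -- that is, none.
  families : ∀ J → Q ^ J * n ^ 4 < suc Q ^ J → ∀ q F →
    2 * suc C₀ * (size * (4 * (q * (J * size) + length F + size))) < n →
    ∃ λ fs → length fs ≡ q × length (total fs) ≤ q * (J * size) × Spread id F (total fs)
  families J big zero    F fits = [] , refl , z≤n , record { distinct = λ _ → z≤n ; avoids = λ _ () }
  families J big (suc q) F fits =
    let fs , len , few-fs , sp = families J big q (concat (picks cov) ++ F) fits′ in
    fam ∷ fs , cong suc len , ≤-trans (≤-reflexive (length-++ (concat (picks cov)))) (few cov ⊕ few-fs) ,
    spread-++ F (concat (picks cov)) (total fs) (disjoint cov) sp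
    where
    cov : Cover J F (quads n)
    cov = cover J F (quads n) (≤-<-trans ((2 * suc C₀) ⊙ (size ⊙ (4 ⊙ +-monoˡ-≤ size (+-monoˡ-≤ (length F) (m≤m+n (J * size) _))))) fits)
    nothing-left : ∀ {r} → r ∈ left cov → ⊥
    nothing-left r∈ = <⇒≱ big (≤-trans (≤-trans (≤-reflexive (sym (*-identityʳ (suc Q ^ J))))
      ((suc Q ^ J) ⊙ positive r∈)) (≤-trans (shrink cov) (≤-reflexive (cong (Q ^ J *_) (length-quads n)))))
      where
      positive : ∀ {l : List (Quad n)} {r} → r ∈ l → 1 ≤ length l
      positive (here _)  = s≤s z≤n
      positive (there _) = s≤s z≤n
    fam : Family
    fam = record
      { members = picks cov
      ; balanced = all-map (useful cov)
      ; universal = λ r → only-right (covers cov (∈-quads r)) }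
      where
      all-map : ∀ {ps} → All (λ s → length s ≡ size × ∃ λ r → absorbs r s ≡ true) ps → All Fac ps
      all-map [] = []
      all-map (_∷_ {s} (_ , r , h) all) = fac-sound (proj₁ (∧-true {fac s} h)) ∷ all-map all
      only-right : ∀ {r} {B : Set} → (r ∈ left cov) ⊎ B → B
      only-right (inj₁ r∈) = ⊥-elim (nothing-left r∈)
      only-right (inj₂ b)  = b
    fits′ : 2 * suc C₀ * (size * (4 * (q * (J * size) + length (concat (picks cov) ++ F) + size))) < n
    fits′ = ≤-<-trans ((2 * suc C₀) ⊙ (size ⊙ (4 ⊙ +-monoˡ-≤ size
      (≤-trans (+-monoʳ-≤ (q * (J * size)) (≤-trans (≤-reflexive (length-++ (concat (picks cov)))) (+-monoˡ-≤ (length F) (few cov))))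
        (≤-reflexive (eq (q * (J * size)) (J * size) (length F))))))) fits
      where
      eq : ∀ a b f → a + (b + f) ≡ b + a + f
      eq = solve-∀

-- An exponential eventually beats n⁴, with a number of steps that is a small fraction of n.

bernoulli : ∀ Q j → (Q + j) * Q ^ j ≤ Q * suc Q ^ j
bernoulli Q zero    = ≤-reflexive (cong (_* 1) (+-identityʳ Q))
bernoulli Q (suc j) = lin (j * Q ^ j) (suc Q ⊙ bernoulli Q j) (eq Q j (Q ^ j) (suc Q ^ j))
  where
  eq : ∀ Q j b a → Q * ((1 + Q) * a) + (1 + Q) * ((Q + j) * b) ≡ (Q + (1 + j)) * (Q * b) + (1 + Q) * (Q * a) + j * b
  eq = solve-∀

^5-distrib-* : ∀ a b → (a * b) ^ 5 ≡ a ^ 5 * b ^ 5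
^5-distrib-* = eq
  where
  eq : ∀ a b → a * b * (a * b * (a * b * (a * b * (a * b * 1)))) ≡ a * (a * (a * (a * (a * 1)))) * (b * (b * (b * (b * (b * 1)))))
  eq = solve-∀

-- The fifth power of Bernoulli's inequality bounds `(1 + 1/Q) ^ (j * 5)` below by `(j / Q)⁵`, and
-- `j⁵` beats `n⁴ ≤ (B j)⁴` as soon as `j` exceeds `Q⁵ B⁴`.
exponential-large : ∀ Q n B j → 0 < Q → n ≤ B * j → Q ^ 5 * B ^ 4 < j → Q ^ (j * 5) * n ^ 4 < suc Q ^ (j * 5)
exponential-large Q n B j 0<Q n≤Bj j-large = *-cancelˡ-< (Q ^ 5) _ _ (begin-strict
  Q ^ 5 * (Q ^ (j * 5) * n ^ 4)
    ≤⟨ (Q ^ 5) ⊙ ((Q ^ (j * 5)) ⊙ ^-monoˡ-≤ 4 n≤Bj) ⟩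
  Q ^ 5 * (Q ^ (j * 5) * (B * j) ^ 4)
    ≡⟨ eq₁ (Q ^ 5) (Q ^ (j * 5)) B j ⟩
  Q ^ 5 * B ^ 4 * (j ^ 4 * Q ^ (j * 5))
    <⟨ *-monoˡ-< (j ^ 4 * Q ^ (j * 5)) {{m*n≢0 (j ^ 4) (Q ^ (j * 5)) {{m^n≢0 j 4 {{>-nonZero (≤-<-trans z≤n j-large)}}}} {{m^n≢0 Q (j * 5) {{>-nonZero 0<Q}}}}}} j-large ⟩
  j * (j ^ 4 * Q ^ (j * 5))
    ≡⟨ sym (*-assoc j (j ^ 4) _) ⟩
  j ^ 5 * Q ^ (j * 5)
    ≤⟨ *-monoˡ-≤ (Q ^ (j * 5)) (^-monoˡ-≤ 5 (m≤n+m j Q)) ⟩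
  (Q + j) ^ 5 * Q ^ (j * 5)
    ≡⟨ cong ((Q + j) ^ 5 *_) (sym (^-*-assoc Q j 5)) ⟩
  (Q + j) ^ 5 * (Q ^ j) ^ 5
    ≡⟨ sym (^5-distrib-* (Q + j) (Q ^ j)) ⟩
  ((Q + j) * Q ^ j) ^ 5
    ≤⟨ ^-monoˡ-≤ 5 (bernoulli Q j) ⟩
  (Q * suc Q ^ j) ^ 5
    ≡⟨ ^5-distrib-* Q (suc Q ^ j) ⟩
  Q ^ 5 * (suc Q ^ j) ^ 5
    ≡⟨ cong (Q ^ 5 *_) (^-*-assoc (suc Q) j 5) ⟩
  Q ^ 5 * suc Q ^ (j * 5) ∎)
  where
  open ≤-Reasoning
  eq₁ : ∀ q r B j → q * (r * (B * j * (B * j * (B * j * (B * j * 1))))) ≡ q * (B * (B * (B * (B * 1)))) * (j * (j * (j * (j * 1))) * r)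
  eq₁ = solve-∀

few-picks : ∀ C Q m q κ → 0 < Q → ∃ λ n₀ → ∀ n → n₀ ≤ n → ∃ λ J →
            Q ^ J * n ^ 4 < suc Q ^ J × 2 * C * (m * (4 * (q * (J * m) + 0 + m))) < n × κ * (q * (J * m)) ≤ n
few-picks C Q m q κ 0<Q = B * (1 + Q ^ 5 * (2 * B) ^ 4) , λ n n≥ → choose n n≥
  where
  -- The summand `8 * C * m` serves `fits` and the summand `κ` serves `small`: both left sides are
  -- at most `B′ * j`, where `j = n / B`.
  B′ = (8 * C * m + κ) * (5 * q * m + m)
  B = suc B′
  choose : ∀ n → B * (1 + Q ^ 5 * (2 * B) ^ 4) ≤ n → ∃ λ J →
           Q ^ J * n ^ 4 < suc Q ^ J × 2 * C * (m * (4 * (q * (J * m) + 0 + m))) < n × κ * (q * (J * m)) ≤ n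
  choose n n≥ = j * 5 , exponential-large Q n (2 * B) j 0<Q n≤2Bj j-large , fits , small
    where
    open ≤-Reasoning
    j = n / B
    jB≤n : j * B ≤ n
    jB≤n = m/n*n≤m n B
    n<jB+B : n < B + j * B
    n<jB+B = begin-strict
      n                    ≡⟨ m≡m%n+[m/n]*n n B ⟩
      n % B + j * B        <⟨ +-monoˡ-< (j * B) (m%n<n n B) ⟩
      B + j * B            ∎
    j-large : Q ^ 5 * (2 * B) ^ 4 < j
    j-large = *-cancelˡ-< B _ _ (+-cancelˡ-< B _ _ (begin-strict
      B + B * (Q ^ 5 * (2 * B) ^ 4)   ≡⟨ sym (*-suc B _) ⟩
      B * (1 + Q ^ 5 * (2 * B) ^ 4)   ≤⟨ n≥ ⟩
      n                               <⟨ n<jB+B ⟩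
      B + j * B                       ≡⟨ cong (B +_) (*-comm j B) ⟩
      B + B * j                       ∎))
    1≤j : 1 ≤ j
    1≤j = ≤-trans (s≤s z≤n) j-large
    n≤2Bj : n ≤ 2 * B * j
    n≤2Bj = <⇒≤ (<-≤-trans n<jB+B (≤-trans (+-monoˡ-≤ (j * B) (≤-trans (≤-reflexive (sym (*-identityˡ B))) (*-monoˡ-≤ B 1≤j)))
      (≤-reflexive (eq j B))))
      where
      eq : ∀ j B → j * B + j * B ≡ 2 * B * j
      eq = solve-∀
    B′j<n : B′ * j < n
    B′j<n = <-≤-trans (≤-trans (+-monoˡ-≤ (B′ * j) 1≤j) (≤-reflexive (*-comm B j))) jB≤n
    m≤mj : m ≤ m * j
    m≤mj = ≤-trans (≤-reflexive (sym (*-identityʳ m))) (m ⊙ 1≤j)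
    fits : 2 * C * (m * (4 * (q * (j * 5 * m) + 0 + m))) < n
    fits = ≤-<-trans (lin (κ * (5 * q * m + m) * j) ((8 * C * m) ⊙ m≤mj) (eq C m q j κ)) B′j<n
      where
      eq : ∀ C m q j κ → (8 * C * m + κ) * (5 * q * m + m) * j + 8 * C * m * m
        ≡ 2 * C * (m * (4 * (q * (j * 5 * m) + 0 + m))) + 8 * C * m * (m * j) + κ * (5 * q * m + m) * j
      eq = solve-∀
    small : κ * (q * (j * 5 * m)) ≤ n
    small = <⇒≤ (≤-<-trans (lin (κ * m * j + 8 * C * m * (5 * q * m + m) * j) (≤-refl {0}) (eq C m q j κ)) B′j<n)
      where
      eq : ∀ C m q j κ → (8 * C * m + κ) * (5 * q * m + m) * j + 0
        ≡ κ * (q * (j * 5 * m)) + 0 + (κ * m * j + 8 * C * m * (5 * q * m + m) * j)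
      eq = solve-∀

-- Blocks of a tiling

first : ∀ {n} → Quad n → Fin n
first = proj₁

flat-++ : ∀ {n} (ps qs : List (Quad n)) (f : Fin n → ℕ) → ∑ (flat (ps ++ qs)) f ≡ ∑ (flat ps) f + ∑ (flat qs) f
flat-++ []       qs f = refl
flat-++ ((a , b , c , d) ∷ ps) qs f =
  trans (cong (λ x → f a + (f b + (f c + (f d + x)))) (flat-++ ps qs f)) (eq (f a) (f b) (f c) (f d) _ _)
  where
  eq : ∀ a b c d x y → a + (b + (c + (d + (x + y)))) ≡ a + (b + (c + (d + x))) + y
  eq = solve-∀

flat-∑ : ∀ {n} (ts : List (Quad n)) (f : Fin n → ℕ) → ∑ (flat ts) f ≡ ∑[ q ← ts ] ∑ (verts q) f
flat-∑ []       f = refl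
flat-∑ (q ∷ ts) f = trans (∑-++ (verts q) (flat ts) f) (cong (∑ (verts q) f +_) (flat-∑ ts f))

length-flat : ∀ {n} (ts : List (Quad n)) → length (flat ts) ≡ 4 * length ts
length-flat []       = refl
length-flat (q ∷ ts) = trans (cong (4 +_) (length-flat ts)) (eq (length ts))
  where
  eq : ∀ t → 4 + 4 * t ≡ 4 * (1 + t)
  eq = solve-∀

-- The classes are the tiles, represented by their first vertices, and the single vertices outside
-- all tiles.
rep : ∀ {n} → List (Quad n) → Fin n → Fin n
rep []       v = v
rep (q ∷ ts) v = if 1 ≤ᵇ mult (verts q) v then first q else rep ts v

module _ {n : ℕ} where

  mult-verts≤flat : ∀ {q v} {ts : List (Quad n)} → q ∈ ts → mult (verts q) v ≤ mult (flat ts) v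
  mult-verts≤flat {q} {v} {ts} q∈ =
    ≤-trans (∑-∈ (λ q → mult (verts q) v) q∈) (≤-reflexive (sym (flat-∑ ts (λ u → 𝟙 (u == v)))))

  Simple : List (Quad n) → Set
  Simple ts = ∀ v → mult (flat ts) v ≤ 1

  mult-flat-∷ : ∀ q (ts : List (Quad n)) v → mult (flat (q ∷ ts)) v ≡ mult (verts q) v + mult (flat ts) v
  mult-flat-∷ q ts v = ∑-++ (verts q) (flat ts) _

  simple-tail : ∀ {q ts} → Simple (q ∷ ts) → Simple ts
  simple-tail {q} {ts} s v = ≤-trans (m≤n+m _ (mult (verts q) v)) (≤-trans (≤-reflexive (sym (mult-flat-∷ q ts v))) (s v))

  exclusive : ∀ {q ts v} → Simple (q ∷ ts) → 1 ≤ mult (verts q) v → 1 ≤ mult (flat ts) v → ⊥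
  exclusive {q} {ts} {v} s h₁ h₂ = <⇒≱ (h₁ ⊕ h₂) (≤-trans (≤-reflexive (sym (mult-flat-∷ q ts v))) (s v))

  rep-here : ∀ (q : Quad n) ts v → 1 ≤ mult (verts q) v → rep (q ∷ ts) v ≡ first q
  rep-here q ts v h rewrite ≤ᵇ-true h = refl

  rep-skip : ∀ (q : Quad n) ts v → mult (verts q) v < 1 → rep (q ∷ ts) v ≡ rep ts v
  rep-skip q ts v h rewrite ≤ᵇ-false h = refl

  rep-in : ∀ (ts : List (Quad n)) {q v} → Simple ts → q ∈ ts → 1 ≤ mult (verts q) v → rep ts v ≡ first q
  rep-in (q ∷ ts) {v = v} s (here refl) h = rep-here q ts v h
  rep-in (q′ ∷ ts) {q} {v} s (there q∈) h =
    trans (rep-skip q′ ts v (≰⇒> λ h′ → exclusive {q′} {ts} s h′ (≤-trans h (mult-verts≤flat q∈))))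
          (rep-in ts (simple-tail {q′} {ts} s) q∈ h)

  first-verts : ∀ (q : Quad n) → 1 ≤ mult (verts q) (first q)
  first-verts (a , b , c , d) = ≤-trans (≤-reflexive (sym (𝟙-true (==-refl a)))) (m≤m+n _ _)

  rep-out : ∀ (ts : List (Quad n)) {v} → mult (flat ts) v ≡ 0 → rep ts v ≡ v
  rep-out []       h = refl
  rep-out (q ∷ ts) {v} h =
    let h′ = trans (sym (mult-flat-∷ q ts v)) h in
    trans (rep-skip q ts v (s≤s (≤-reflexive (m+n≡0⇒m≡0 _ h′)))) (rep-out ts (m+n≡0⇒n≡0 (mult (verts q) v) h′))

  covering : ∀ ts {v} → 1 ≤ mult (flat ts) v → ∃ λ (q : Quad n) → q ∈ ts × 1 ≤ mult (verts q) v
  covering (q ∷ ts) {v} h with 1 ≤? mult (verts q) v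
  ... | yes h′ = q , here refl , h′
  ... | no ¬h  =
    let q′ , q∈ , h″ = covering ts (≤-trans h (≤-trans (≤-reflexive (mult-flat-∷ q ts v))
                         (+-monoˡ-≤ (mult (flat ts) v) (≤-pred (≰⇒> ¬h)))))
    in q′ , there q∈ , h″

  rep-covered : ∀ (ts : List (Quad n)) {v} → Simple ts → 1 ≤ mult (flat ts) v → 1 ≤ mult (flat ts) (rep ts v)
  rep-covered ts {v} s h with covering ts h
  ... | q , q∈ , h′ rewrite rep-in ts s q∈ h′ = ≤-trans (first-verts q) (mult-verts≤flat q∈)

  same-block : ∀ {q q′ ts v} → Simple ts → q ∈ ts → q′ ∈ ts → 1 ≤ mult (verts q) v → 1 ≤ mult (verts q′) v → q ≡ q′
  same-block s (here refl) (here refl) h h′ = refl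
  same-block {ts = x ∷ ts} s (here refl) (there p) h h′ = ⊥-elim (exclusive {x} {ts} s h (≤-trans h′ (mult-verts≤flat p)))
  same-block {ts = x ∷ ts} s (there p) (here refl) h h′ = ⊥-elim (exclusive {x} {ts} s h′ (≤-trans h (mult-verts≤flat p)))
  same-block {ts = x ∷ ts} s (there p) (there p′) h h′ = same-block (simple-tail {x} {ts} s) p p′ h h′

  rep-class : ∀ ts → Simple ts → ∀ u → ∃ λ cl → length cl ≤ 4 × (∀ v → rep ts v ≡ u → 1 ≤ mult cl v)
  rep-class ts s u with 1 ≤? mult (flat ts) u
  ... | no ¬h = u ∷ [] , s≤s z≤n , single
    where
    single : ∀ v → rep ts v ≡ u → 1 ≤ mult (u ∷ []) v
    single v eq with 1 ≤? mult (flat ts) v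
    ... | yes h = ⊥-elim (¬h (subst (λ r → 1 ≤ mult (flat ts) r) eq (rep-covered ts s h)))
    ... | no ¬h′ = subst (λ w → 1 ≤ mult (u ∷ []) w)
        (trans (sym eq) (rep-out ts (n<1⇒n≡0 (≰⇒> ¬h′)))) (first≥ u)
      where
      first≥ : ∀ u → 1 ≤ mult (u ∷ []) u
      first≥ u = ≤-trans (≤-reflexive (sym (𝟙-true (==-refl u)))) (m≤m+n _ 0)
  ... | yes h with covering ts h
  ...   | q , q∈ , hq = verts q , ≤-refl , inside
    where
    inside : ∀ v → rep ts v ≡ u → 1 ≤ mult (verts q) v
    inside v eq with 1 ≤? mult (flat ts) v
    ... | no ¬h′ = subst (λ w → 1 ≤ mult (verts q) w) (trans (sym eq) (rep-out ts (n<1⇒n≡0 (≰⇒> ¬h′)))) hq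
    ... | yes h′ with covering ts h′
    ...   | q′ , q′∈ , hv =
      subst (λ x → 1 ≤ mult (verts x) v)
        (same-block s q′∈ q∈ (subst (λ w → 1 ≤ mult (verts q′) w) (trans (sym (rep-in ts s q′∈ hv)) eq) (first-verts q′)) hq) hv

  class-small : ∀ ts → Simple ts → ∀ xs → (∀ v → mult xs v ≤ 1) → ∀ u → ∑[ x ← xs ] 𝟙 (u == rep ts x) ≤ 4
  class-small ts s xs xs≤1 u with rep-class ts s u
  ... | cl , len , h = begin
    ∑[ x ← xs ] 𝟙 (u == rep ts x)
      ≤⟨ ∑-mono xs (λ x → in-class x (u == rep ts x) refl) ⟩
    ∑[ x ← xs ] ∑[ w ← cl ] 𝟙 (w == x)
      ≡⟨ ∑-swap xs cl (λ x w → 𝟙 (w == x)) ⟩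
    ∑[ w ← cl ] ∑[ x ← xs ] 𝟙 (w == x)
      ≤⟨ ∑-≤const cl 1 (λ w → ≤-trans (≤-reflexive (∑-cong xs (λ x → cong 𝟙 (==-sym w x)))) (xs≤1 w)) ⟩
    length cl * 1
      ≡⟨ *-identityʳ _ ⟩
    length cl
      ≤⟨ len ⟩
    4 ∎
    where
    open ≤-Reasoning
    in-class : ∀ x b → (u == rep ts x) ≡ b → 𝟙 b ≤ mult cl x
    in-class x true  eq = h x (sym (==-sound eq))
    in-class x false eq = z≤n

-- Freeing vertices of a tiling by exchanging tiles

module Improve {n : ℕ} (e : Fin n → Fin n → Fin n → Bool)
  (sym₁₂ : ∀ x y z → e x y z ≡ e y x z) (sym₂₃ : ∀ x y z → e x y z ≡ e x z y)
  (irr : ∀ x z → e x x z ≡ false)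
  (D g k : ℕ) (codeg : ∀ x y → x ≢ y → D ≤ ∑[ z ← Tiles.V e ] 𝟙 (e x y z))
  (half : n + 2 * g ≤ 2 * D) (dense : n ≤ k * g) (2≤n : 2 ≤ n) (D≤n : D ≤ n) (0<k : 0 < k) where

  open Codegree e sym₁₂ sym₂₃ irr D g k codeg half dense 2≤n

  IsTile : Quad n → Set
  IsTile (a , b , c , d) = tile a b c d ≡ true

  record Tiling (A : List (Fin n)) (ts : List (Quad n)) : Set where
    field
      tiles  : All IsTile ts
      simple : ∀ v → mult A v + mult (flat ts) v ≤ 1

  open Tiling public

  module Freeing (A : List (Fin n)) (ts : List (Quad n)) (𝒯 : Tiling A ts) where

    ts-simple : Simple ts
    ts-simple v = ≤-trans (m≤n+m _ (mult A v)) (simple 𝒯 v)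

    ϱ : Fin n → Fin n
    ϱ = rep ts

    hit : List (Fin n) → ℕ
    hit C = ∑[ q ← ts ] mult C (first q)

    -- The blocks with representatives in C can be replaced by at least as many new tiles that leave the
    -- vertices of Y uncovered.
    record Free (c : ℕ) (Y F : List (Fin n)) : Set where
      field
        C      : List (Fin n)
        new    : List (Quad n)
        few    : length C ≤ c
        unique : ∀ r → mult C r ≤ 1
        avoidF : ∀ r → 1 ≤ mult C r → mult F r ≡ 0
        avoidA : ∀ r → 1 ≤ mult C r → mult A r ≡ 0
        tiled  : All IsTile new
        value  : hit C ≤ length new
        fits   : ∀ v → mult (flat new) v + mult Y v ≤ mult C (ϱ v)

    open Free public

    free-[] : ∀ F → Free 0 [] F
    free-[] F = record
      { C = [] ; new = [] ; few = z≤n ; unique = λ _ → z≤n ; avoidF = λ _ () ; avoidA = λ _ () ; tiled = []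
      ; value = ≤-reflexive (trans (∑-const ts 0) (*-zeroʳ (length ts))) ; fits = λ _ → z≤n }

    free-weaken : ∀ {c c′ Y F} → c ≤ c′ → Free c Y F → Free c′ Y F
    free-weaken c≤c′ f = record
      { C = C f ; new = new f ; few = ≤-trans (few f) c≤c′ ; unique = unique f ; avoidF = avoidF f ; avoidA = avoidA f
      ; tiled = tiled f ; value = value f ; fits = fits f }

    free-shrink : ∀ {c Y} G F → Free c Y (G ++ F) → Free c Y F
    free-shrink G F f = record
      { C = C f ; new = new f ; few = few f ; unique = unique f
      ; avoidF = λ r h → m+n≡0⇒n≡0 (mult G r) (trans (sym (mult-++ G F r)) (avoidF f r h)) ; avoidA = avoidA f
      ; tiled = tiled f ; value = value f ; fits = fits f }

    free-++ : ∀ {c c′ Y Y′ F} (f : Free c Y F) → Free c′ Y′ (C f ++ F) → Free (c + c′) (Y ++ Y′) F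
    free-++ {c} {c′} {Y} {Y′} {F} f f′ = record
      { C = C f ++ C f′
      ; new = new f ++ new f′
      ; few = ≤-trans (≤-reflexive (length-++ (C f))) (few f ⊕ few f′)
      ; unique = λ r → ≤-trans (≤-reflexive (mult-++ (C f) (C f′) r))
          (one (mult (C f) r) (mult (C f′) r) (unique f r) (unique f′ r)
            (λ h → m+n≡0⇒m≡0 (mult (C f) r) (trans (sym (mult-++ (C f) F r)) (avoidF f′ r h))))
      ; avoidF = λ r h → either r (λ h₁ → avoidF f r h₁)
          (λ h₂ → m+n≡0⇒n≡0 (mult (C f) r) (trans (sym (mult-++ (C f) F r)) (avoidF f′ r h₂)))
          (≤-trans h (≤-reflexive (mult-++ (C f) (C f′) r)))
      ; avoidA = λ r h → either r (avoidA f r) (avoidA f′ r) (≤-trans h (≤-reflexive (mult-++ (C f) (C f′) r)))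
      ; tiled = All.++⁺ (tiled f) (tiled f′)
      ; value = ≤-trans (≤-reflexive (trans (∑-cong ts (λ q → mult-++ (C f) (C f′) (first q))) (∑-+ ts _ _)))
          (≤-trans (value f ⊕ value f′) (≤-reflexive (sym (length-++ (new f)))))
      ; fits = λ v → ≤-trans (≤-reflexive (trans (cong₂ _+_ (flat-++ (new f) (new f′) (λ u → 𝟙 (u == v))) (mult-++ Y Y′ v))
            (eq (mult (flat (new f)) v) (mult (flat (new f′)) v) (mult Y v) (mult Y′ v))))
          (≤-trans (fits f v ⊕ fits f′ v) (≤-reflexive (sym (mult-++ (C f) (C f′) (ϱ v))))) }
      where
      eq : ∀ a b c d → a + b + (c + d) ≡ a + c + (b + d)
      eq = solve-∀
      one : ∀ i j → i ≤ 1 → j ≤ 1 → (1 ≤ j → i ≡ 0) → i + j ≤ 1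
      one zero    j       h₁ h₂ f = h₂
      one (suc i) zero    h₁ h₂ f = ≤-trans (≤-reflexive (+-identityʳ (suc i))) h₁
      one (suc i) (suc j) h₁ h₂ f with f (s≤s z≤n)
      ... | ()
      either : ∀ {X : Set} r → (1 ≤ mult (C f) r → X) → (1 ≤ mult (C f′) r → X) → 1 ≤ mult (C f) r + mult (C f′) r → X
      either r p q h with mult (C f) r
      ... | suc _ = p (s≤s z≤n)
      ... | zero  = q h

    -- By `value`, at least as many tiles are inserted as are removed, and `y` comes on top.
    enlarge : ∀ {c F} y → IsTile y → Free c (verts y) F → ∃ λ ts′ → Tiling A ts′ × length ts < length ts′
    enlarge {c} {F} y y-tile f = kept ts ++ y ∷ new f , record { tiles = All.++⁺ (kept-tiles ts (tiles 𝒯)) (y-tile ∷ tiled f)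
                                                            ; simple = fine } , longer
      where
      keep : ℕ → Quad n → List (Quad n) → List (Quad n)
      keep zero    q l = q ∷ l
      keep (suc _) q l = l
      kept : List (Quad n) → List (Quad n)
      kept []       = []
      kept (q ∷ ts) = keep (mult (C f) (first q)) q (kept ts)
      kept-tiles : ∀ ts → All IsTile ts → All IsTile (kept ts)
      kept-tiles []       []       = []
      kept-tiles (q ∷ ts) (p ∷ ps) with mult (C f) (first q)
      ... | zero  = p ∷ kept-tiles ts ps
      ... | suc _ = kept-tiles ts ps
      length-kept : ∀ ts → length ts ≤ length (kept ts) + ∑[ q ← ts ] mult (C f) (first q)
      length-kept []       = z≤n
      length-kept (q ∷ ts) with mult (C f) (first q)
      ... | zero  = s≤s (length-kept ts)
      ... | suc i = ≤-trans (s≤s (length-kept ts)) (≤-trans (≤-reflexive (sym (+-suc (length (kept ts)) _)))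
                      (+-monoʳ-≤ (length (kept ts)) (s≤s (m≤n+m _ i))))
      longer : length ts < length (kept ts ++ y ∷ new f)
      longer = begin-strict
        length ts                              ≤⟨ length-kept ts ⟩
        length (kept ts) + hit (C f)           ≤⟨ +-monoʳ-≤ (length (kept ts)) (value f) ⟩
        length (kept ts) + length (new f)      <⟨ n<1+n _ ⟩
        suc (length (kept ts) + length (new f)) ≡⟨ sym (+-suc (length (kept ts)) (length (new f))) ⟩
        length (kept ts) + suc (length (new f)) ≡⟨ sym (length-++ (kept ts)) ⟩
        length (kept ts ++ y ∷ new f)          ∎
        where open ≤-Reasoning
      kept≤ : ∀ ts v → mult (flat (kept ts)) v ≤ mult (flat ts) v
      kept≤ []       v = z≤n
      kept≤ (q ∷ ts) v with mult (C f) (first q)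
      ... | zero  = subst₂ _≤_ (sym (mult-flat-∷ q (kept ts) v)) (sym (mult-flat-∷ q ts v)) (+-monoʳ-≤ (mult (verts q) v) (kept≤ ts v))
      ... | suc _ = ≤-trans (kept≤ ts v) (≤-trans (m≤n+m _ (mult (verts q) v)) (≤-reflexive (sym (mult-flat-∷ q ts v))))
      kept-avoids : ∀ ts′ v → (∀ {q} → q ∈ ts′ → q ∈ ts) → 1 ≤ mult (C f) (ϱ v) → mult (flat (kept ts′)) v ≡ 0
      kept-avoids []        v sub h = refl
      kept-avoids (q ∷ ts′) v sub h with mult (C f) (first q) in eq
      ... | suc _ = kept-avoids ts′ v (λ p → sub (there p)) h
      ... | zero  = trans (mult-flat-∷ q (kept ts′) v) (cong₂ _+_ (absent (mult (verts q) v) refl) (kept-avoids ts′ v (λ p → sub (there p)) h))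
        where
        absent : ∀ i → mult (verts q) v ≡ i → mult (verts q) v ≡ 0
        absent zero    p = p
        absent (suc i) p = ⊥-elim (<⇒≱ h (≤-reflexive (trans (cong (mult (C f))
          (rep-in ts ts-simple (sub (here refl)) (≤-trans (s≤s z≤n) (≤-reflexive (sym p))))) eq)))
      fine : ∀ v → mult A v + mult (flat (kept ts ++ y ∷ new f)) v ≤ 1
      fine v = ≤-trans (≤-reflexive (cong (mult A v +_) (trans (flat-++ (kept ts) (y ∷ new f) (λ u → 𝟙 (u == v)))
          (cong (mult (flat (kept ts)) v +_) (trans (mult-flat-∷ y (new f) v) (+-comm (mult (verts y) v) _))))))
        (by-cases (mult (C f) (ϱ v)) refl)
        where
        nw = mult (flat (new f)) v + mult (verts y) v
        by-cases : ∀ i → mult (C f) (ϱ v) ≡ i → mult A v + (mult (flat (kept ts)) v + nw) ≤ 1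
        by-cases zero    eq = ≤-trans (+-monoʳ-≤ (mult A v) (kept≤ ts v ⊕ ≤-trans (fits f v) (≤-reflexive eq)))
          (≤-trans (≤-reflexive (cong (mult A v +_) (+-identityʳ _))) (simple 𝒯 v))
        by-cases (suc i) eq = ≤-trans (≤-reflexive (cong₂ _+_ (noA (mult A v) refl) (cong (_+ nw) (kept-avoids ts v id pos))))
          (≤-trans (fits f v) (unique f (ϱ v)))
          where
          pos : 1 ≤ mult (C f) (ϱ v)
          pos = ≤-trans (s≤s z≤n) (≤-reflexive (sym eq))
          noA : ∀ j → mult A v ≡ j → mult A v ≡ 0
          noA zero    p = p
          noA (suc j) p = avoidA f v (subst (λ r → 1 ≤ mult (C f) r) (rep-out ts flat0) pos)
            where
            flat0 : mult (flat ts) v ≡ 0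
            flat0 = n<1⇒n≡0 (+-cancelˡ-< 1 _ _ (s≤s (≤-trans (+-monoˡ-≤ (mult (flat ts) v) (≤-trans (s≤s z≤n) (≤-reflexive (sym p)))) (simple 𝒯 v))))

    module Budget (B : ℕ) where

      -- `F` lists blocks already claimed elsewhere. The part `d` of the budget `B` is kept for the
      -- blocks that nested exchanges will add to `F`.
      FreeAll : ℕ → ℕ → List (Fin n) → Set
      FreeAll c d T = ∀ {y} → y ∈ T → ∀ F → length F + d ≤ B → mult F (ϱ y) ≡ 0 → Free c (y ∷ []) F

      length-reps : ∀ Y → length (reps ϱ Y) ≡ length Y
      length-reps []      = refl
      length-reps (y ∷ Y) = cong suc (length-reps Y)

      -- While one vertex is freed, the blocks of the vertices still waiting are forbidden too;
      -- otherwise they could be dissolved before their turn.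
      free-many : ∀ {c d T} → FreeAll c d T → ∀ Y F → All (_∈ T) Y → Spread ϱ F Y →
                  length F + length Y * (c + 1) + d ≤ B → Free (length Y * c) Y F
      free-many {c} {d} all []      F []         sp le = free-[] F
      free-many {c} {d} all (y ∷ Y) F (y∈ ∷ Y∈) sp le = free-++ (free-shrink (reps ϱ Y) F f) (free-many all Y (C f ++ F) Y∈ sp′ le′)
        where
        f : Free c (y ∷ []) (reps ϱ Y ++ F)
        f = all y∈ (reps ϱ Y ++ F)
          (≤-trans (≤-reflexive (cong (_+ d) (trans (length-++ (reps ϱ Y)) (cong (_+ length F) (length-reps Y)))))
            (lin (c + length Y * c + 1) le (eq (length F) (length Y) c d B)))
          (trans (mult-++ (reps ϱ Y) F (ϱ y)) (cong₂ _+_ (not-later (distinct sp (ϱ y))) (avoids sp (ϱ y) here-y)))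
          where
          eq : ∀ f y c d B → B + (f + (1 + y) * (c + 1) + d) ≡ y + f + d + B + (c + y * c + 1)
          eq = solve-∀
          here-y : 1 ≤ 𝟙 (ϱ y == ϱ y) + mult (reps ϱ Y) (ϱ y)
          here-y = ≤-trans (≤-reflexive (sym (𝟙-true (==-refl (ϱ y))))) (m≤m+n _ _)
          not-later : 𝟙 (ϱ y == ϱ y) + mult (reps ϱ Y) (ϱ y) ≤ 1 → mult (reps ϱ Y) (ϱ y) ≡ 0
          not-later h rewrite ==-refl (ϱ y) = n≤0⇒n≡0 (≤-pred h)
        le′ : length (C f ++ F) + length Y * (c + 1) + d ≤ B
        le′ = ≤-trans (≤-reflexive (cong (λ l → l + length Y * (c + 1) + d) (length-++ (C f))))
          (lin 1 (le ⊕ few f) (eq (length F) (length Y) c d B (length (C f))))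
          where
          eq : ∀ f y c d B x → B + (f + (1 + y) * (c + 1) + d + x) ≡ x + f + y * (c + 1) + d + (B + c) + 1
          eq = solve-∀
        sp′ : Spread ϱ (C f ++ F) Y
        sp′ = record
          { distinct = λ r → ≤-trans (m≤n+m _ (𝟙 (ϱ y == r))) (distinct sp r)
          ; avoids = λ r h → trans (mult-++ (C f) F r) (cong₂ _+_ (noC r h (mult (C f) r) refl)
              (avoids sp r (≤-trans h (m≤n+m _ (𝟙 (ϱ y == r)))))) }
          where
          noC : ∀ r → 1 ≤ mult (reps ϱ Y) r → ∀ i → mult (C f) r ≡ i → mult (C f) r ≡ 0
          noC r h zero    eq = eq
          noC r h (suc i) eq = ⊥-elim (<⇒≱ h (≤-reflexive (m+n≡0⇒m≡0 (mult (reps ϱ Y) r)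
            (trans (sym (mult-++ (reps ϱ Y) F r)) (avoidF f r (≤-trans (s≤s z≤n) (≤-reflexive (sym eq))))))))

      -- The selected letters lie in pairwise different blocks, as simultaneous freeing requires;
      -- this is why `rainbow` works with classes instead of single letters.
      select : ∀ θ m T F P → (∀ v → mult T v ≤ 1) → m * (4 * (length F + m)) * θ < length T →
               length T ^ m ≤ θ * ∑ʷ T m (λ s → 𝟙 (P s)) →
               ∃ λ s → length s ≡ m × All (_∈ T) s × P s ≡ true × Spread ϱ F s
      select θ m T F P T≤1 large many-P = rainbow ϱ m T F P (4 * (length F + m)) (class-small ts ts-simple T T≤1) ≤-refl
        (*-cancelˡ-< θ _ _ (begin-strict
          θ * (m * (4 * (length F + m)) * t ^ m)
            ≡⟨ eq θ (m * (4 * (length F + m))) (t ^ m) ⟩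
          m * (4 * (length F + m)) * θ * t ^ m
            <⟨ *-monoˡ-< (t ^ m) {{m^n≢0 t m {{>-nonZero (≤-<-trans z≤n large)}}}} large ⟩
          t * t ^ m
            ≤⟨ t ⊙ many-P ⟩
          t * (θ * ∑ʷ T m (λ s → 𝟙 (P s)))
            ≡⟨ eq′ t θ _ ⟩
          θ * (t * ∑ʷ T m (λ s → 𝟙 (P s))) ∎))
        where
        open ≤-Reasoning
        t = length T
        eq : ∀ a b c → a * (b * c) ≡ b * a * c
        eq = solve-∀
        eq′ : ∀ a b c → a * (b * c) ≡ b * (a * c)
        eq′ = solve-∀

      -- Blocks get reordered to put a super vertex first. What is retained of such a block is only
      -- that its four vertices have one representative.
      Cell : Quad n → Set
      Cell (s , a , b , c) = ϱ a ≡ ϱ s × ϱ b ≡ ϱ s × ϱ c ≡ ϱ s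

      triangle : Fin n → List (Fin n) → Bool
      triangle v (a ∷ b ∷ c ∷ []) = e v a b ∧ (e v a c ∧ e v b c)
      triangle v _                = false

      Super : ℕ → List (Fin n) → Fin n → Set
      Super θ T v = length T ^ 3 ≤ θ * ∑ʷ T 3 (λ s → 𝟙 (triangle v s))

      -- The block of s is replaced by s and a triangle of its link in T.
      free-super : ∀ {θ c d T} → (∀ v → mult T v ≤ 1) → FreeAll c d T → 3 * (4 * (B + 3)) * θ < length T →
                   ∀ s y → s ≢ y → ϱ y ≡ ϱ s → 1 ≤ mult (flat ts) s → Super θ T s →
                   ∀ F → length F + (d + 4 + 3 * c) ≤ B → mult F (ϱ y) ≡ 0 → Free (1 + 3 * c) (y ∷ []) F
      free-super {θ} {c} {d} {T} T≤1 all large s y s≢y same covered sup F le Fy =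
        build (select θ 3 T (q ∷ F) (triangle s) T≤1
          (≤-<-trans (*-monoˡ-≤ θ (3 ⊙ (4 ⊙ +-monoˡ-≤ 3 F<B))) large) sup)
        where
        q = ϱ s
        F<B : suc (length F) ≤ B
        F<B = lin (d + 3 + 3 * c) le (eq (length F) d c B)
          where
          eq : ∀ f d c B → B + (f + (d + 4 + 3 * c)) ≡ 1 + f + B + (d + 3 + 3 * c)
          eq = solve-∀
        build : (∃ λ w → length w ≡ 3 × All (_∈ T) w × triangle s w ≡ true × Spread ϱ (q ∷ F) w) → Free (1 + 3 * c) (y ∷ []) F
        build (x₁ ∷ x₂ ∷ x₃ ∷ [] , len , w∈ , tri , sp) = record
          { C = q ∷ C f
          ; new = (s , x₁ , x₂ , x₃) ∷ new f
          ; few = s≤s (few f)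
          ; unique = λ r → unique-∷ r (q == r) refl
          ; avoidF = λ r → avoidF-∷ r (q == r) refl
          ; avoidA = λ r → avoidA-∷ r (q == r) refl
          ; tiled = tri-tile ∷ tiled f
          ; value = value-∷
          ; fits = fits-∷ }
          where
          f : Free (3 * c) (x₁ ∷ x₂ ∷ x₃ ∷ []) (q ∷ F)
          f = free-many all (x₁ ∷ x₂ ∷ x₃ ∷ []) (q ∷ F) w∈ sp
                (≤-trans (≤-reflexive (eq (length F) c d)) le)
            where
            eq : ∀ f c d → 1 + f + 3 * (c + 1) + d ≡ f + (d + 4 + 3 * c)
            eq = solve-∀
          tri-tile : tile s x₁ x₂ x₃ ≡ true
          tri-tile = let h₁ , h′ = ∧-true {e s x₁ x₂} tri ; h₂ , h₃ = ∧-true {e s x₁ x₃} h′ in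
            at-least-3-∧₁₂₃ (e x₁ x₂ x₃) h₁ h₂ h₃
          Cq : mult (C f) q ≡ 0
          Cq = zero-of (mult (C f) q) refl
            where
            zero-of : ∀ i → mult (C f) q ≡ i → mult (C f) q ≡ 0
            zero-of zero    p = p
            zero-of (suc i) p = ⊥-elim (<⇒≱ (m≤m+n 1 (mult F q)) (≤-reflexive (trans (cong (_+ mult F q) (sym (𝟙-true (==-refl q))))
              (avoidF f q (≤-trans (s≤s z≤n) (≤-reflexive (sym p)))))))
          unique-∷ : ∀ r b → (q == r) ≡ b → 𝟙 b + mult (C f) r ≤ 1
          unique-∷ r true  eq = ≤-reflexive (cong suc (trans (cong (mult (C f)) (sym (==-sound eq))) Cq))
          unique-∷ r false eq = unique f r
          avoidF-∷ : ∀ r b → (q == r) ≡ b → 1 ≤ 𝟙 b + mult (C f) r → mult F r ≡ 0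
          avoidF-∷ r true  eq h = trans (cong (mult F) (trans (sym (==-sound eq)) (sym same))) Fy
          avoidF-∷ r false eq h = m+n≡0⇒n≡0 (𝟙 (q == r)) (avoidF f r h)
          A0 : mult A q ≡ 0
          A0 = n<1⇒n≡0 (+-cancelʳ-< 1 _ _ (s≤s (≤-trans (+-monoʳ-≤ (mult A q) (rep-covered ts ts-simple covered)) (simple 𝒯 q))))
          avoidA-∷ : ∀ r b → (q == r) ≡ b → 1 ≤ 𝟙 b + mult (C f) r → mult A r ≡ 0
          avoidA-∷ r true  eq h = trans (cong (mult A) (sym (==-sound eq))) A0
          avoidA-∷ r false eq h = avoidA f r h
          value-∷ : hit (q ∷ C f) ≤ suc (length (new f))
          value-∷ = ≤-trans (≤-reflexive (∑-+ ts (λ x → 𝟙 (q == first x)) (λ x → mult (C f) (first x))))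
            (≤-trans (∑-mono ts (λ x → first≤ x)) (≤-trans (≤-reflexive (sym (flat-∑ ts (λ u → 𝟙 (u == q))))) (ts-simple q)) ⊕ value f)
            where
            first≤ : ∀ x → 𝟙 (q == first x) ≤ mult (verts x) q
            first≤ (a , b , c , d) = ≤-trans (≤-reflexive (cong 𝟙 (==-sym q a))) (m≤m+n _ _)
          fits-∷ : ∀ v → mult (flat ((s , x₁ , x₂ , x₃) ∷ new f)) v + mult (y ∷ []) v ≤ 𝟙 (q == ϱ v) + mult (C f) (ϱ v)
          fits-∷ v = lin 0 (sy (s == v) (y == v) refl refl ⊕ fits f v)
            (eq (𝟙 (s == v)) (𝟙 (y == v)) (𝟙 (x₁ == v)) (𝟙 (x₂ == v)) (𝟙 (x₃ == v)) (mult (flat (new f)) v)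
                (𝟙 (q == ϱ v)) (mult (C f) (ϱ v)))
            where
            eq : ∀ s y a b c w i j → i + j + (s + y + (w + (a + (b + (c + 0))))) ≡ s + (a + (b + (c + w))) + (y + 0) + (i + j) + 0
            eq = solve-∀
            sy : ∀ i j → (s == v) ≡ i → (y == v) ≡ j → 𝟙 i + 𝟙 j ≤ 𝟙 (q == ϱ v)
            sy true  true  p r = ⊥-elim (s≢y (trans (==-sound p) (sym (==-sound r))))
            sy true  false p r = ≤-reflexive (sym (𝟙-true (subst (λ w → (q == ϱ w) ≡ true) (==-sound p) (==-refl q))))
            sy false true  p r = ≤-reflexive (sym (𝟙-true (subst (λ w → (w == ϱ v) ≡ true)
              (trans (cong ϱ (sym (==-sound r))) same) (==-refl (ϱ v)))))
            sy false false p r = z≤n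

-- Counting degrees into the freeable vertices

centers bodies : ∀ {n} → List (Quad n) → List (Fin n)
centers []                   = []
centers ((s , _) ∷ ps)       = s ∷ centers ps
bodies []                    = []
bodies ((_ , a , b , c) ∷ ps) = a ∷ b ∷ c ∷ bodies ps

flat-split : ∀ {n} (ps : List (Quad n)) (f : Fin n → ℕ) → ∑ (flat ps) f ≡ ∑ (centers ps) f + ∑ (bodies ps) f
flat-split []                    f = refl
flat-split ((s , a , b , c) ∷ ps) f =
  trans (cong (λ x → f s + (f a + (f b + (f c + x)))) (flat-split ps f)) (eq (f s) (f a) (f b) (f c) _ _)
  where
  eq : ∀ s a b c x y → s + (a + (b + (c + (x + y)))) ≡ s + x + (a + (b + (c + y)))
  eq = solve-∀

length-centers : ∀ {n} (ps : List (Quad n)) → length (centers ps) ≡ length ps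
length-centers []       = refl
length-centers (p ∷ ps) = cong suc (length-centers ps)

length-bodies : ∀ {n} (ps : List (Quad n)) → length (bodies ps) ≡ 3 * length ps
length-bodies []       = refl
length-bodies (p ∷ ps) = trans (cong (3 +_) (length-bodies ps)) (eq (length ps))
  where
  eq : ∀ t → 3 + 3 * t ≡ 3 * (1 + t)
  eq = solve-∀

bodies-++ : ∀ {n} (ps qs : List (Quad n)) → bodies (ps ++ qs) ≡ bodies ps ++ bodies qs
bodies-++ []                     qs = refl
bodies-++ ((_ , a , b , c) ∷ ps) qs = cong (λ l → a ∷ b ∷ c ∷ l) (bodies-++ ps qs)

module Count {n : ℕ} (e : Fin n → Fin n → Fin n → Bool)
  (sym₁₂ : ∀ x y z → e x y z ≡ e y x z) (sym₂₃ : ∀ x y z → e x y z ≡ e x z y)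
  (irr : ∀ x z → e x x z ≡ false)
  (D g k : ℕ) (codeg : ∀ x y → x ≢ y → D ≤ ∑[ z ← Tiles.V e ] 𝟙 (e x y z))
  (half : n + 2 * g ≤ 2 * D) (dense : n ≤ k * g) (2≤n : 2 ≤ n) (D≤n : D ≤ n) (T : List (Fin n)) where

  open Codegree e sym₁₂ sym₂₃ irr D g k codeg half dense 2≤n

  t : ℕ
  t = length T

  #T∧ : ∀ (p q : Fin n → Bool) →
        ∑[ z ← T ] 𝟙 (p z) + ∑[ z ← T ] 𝟙 (q z) ≤ t + ∑[ z ← T ] 𝟙 (p z ∧ q z)
  #T∧ p q = ≤-trans (≤-reflexive (sym (∑-+ T _ _))) (≤-trans (∑-mono T (λ z → 𝟙-∧ (p z) (q z)))
    (≤-reflexive (trans (∑-+ T (λ _ → 1) _) (cong (_+ ∑[ z ← T ] 𝟙 (p z ∧ q z)) (trans (∑-const T 1) (*-identityʳ t))))))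

  d : Fin n → ℕ
  d v = ∑[ y ← T ] ∑[ z ← T ] 𝟙 (e v y z)

  -- Mantel's theorem for the link of v in T, with the number of triangles as error term.
  module _ (v : Fin n) where

    tri : ℕ
    tri = ∑³ T (λ a b c → 𝟙 (e v a b ∧ (e v a c ∧ e v b c)))

    N : Fin n → ℕ
    N y = ∑[ z ← T ] 𝟙 (e v y z)

    squares≤ : 2 * ∑[ y ← T ] (N y * N y) ≤ t * d v + tri
    squares≤ = begin
      2 * S
        ≡⟨ cong (S +_) (+-identityʳ S) ⟩
      S + S
        ≡⟨ cong₂ _+_ left right ⟩
      ∑[ y ← T ] ∑[ z ← T ] (𝟙 (e v y z) * N y) + ∑[ y ← T ] ∑[ z ← T ] (𝟙 (e v y z) * N z)
        ≡⟨ trans (sym (∑-+ T _ _)) (∑-cong T (λ y → trans (sym (∑-+ T _ _)) (∑-cong T (λ z → sym (*-distribˡ-+ (𝟙 (e v y z)) (N y) (N z)))))) ⟩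
      ∑[ y ← T ] ∑[ z ← T ] (𝟙 (e v y z) * (N y + N z))
        ≤⟨ ∑-mono T (λ y → ∑-mono T (λ z → 𝟙 (e v y z) ⊙ #T∧ (e v y) (e v z))) ⟩
      ∑[ y ← T ] ∑[ z ← T ] (𝟙 (e v y z) * (t + ∑[ x ← T ] 𝟙 (e v y x ∧ e v z x)))
        ≡⟨ ∑-cong T (λ y → trans (∑-cong T (λ z → trans (*-distribˡ-+ (𝟙 (e v y z)) t _)
             (cong₂ _+_ (*-comm (𝟙 (e v y z)) t) (sym (∑-∧ (e v y z) T (λ x → e v y x ∧ e v z x)))))) (∑-+ T _ _)) ⟩
      ∑[ y ← T ] (∑[ z ← T ] (t * 𝟙 (e v y z)) + ∑[ z ← T ] ∑[ x ← T ] 𝟙 (e v y z ∧ (e v y x ∧ e v z x)))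
        ≡⟨ trans (∑-+ T _ _) (cong (_+ tri) (trans (∑-cong T (λ y → ∑-*ˡ t T (λ z → 𝟙 (e v y z)))) (∑-*ˡ t T N))) ⟩
      t * d v + tri ∎
      where
      open ≤-Reasoning
      S = ∑[ y ← T ] (N y * N y)
      left : S ≡ ∑[ y ← T ] ∑[ z ← T ] (𝟙 (e v y z) * N y)
      left = ∑-cong T (λ y → sym (∑-*ʳ (N y) T (λ z → 𝟙 (e v y z))))
      right : S ≡ ∑[ y ← T ] ∑[ z ← T ] (𝟙 (e v y z) * N z)
      right = trans left (trans (∑-swap T T (λ y z → 𝟙 (e v y z) * N y))
        (∑-cong T (λ z → ∑-cong T (λ y → cong (λ b → 𝟙 b * N y) (sym₂₃ v y z)))))

    mantel : 2 * (t * d v) ≤ t * (t * t) + 2 * tri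
    mantel = lin 0 (2 ⊙ squares≤ ⊕ bound) (eq t (d v) tri (∑[ y ← T ] (N y * N y)))
      where
      eq : ∀ t d x s → t * (t * t) + 2 * x + (2 * (2 * s) + 4 * (t * d)) ≡ 2 * (t * d) + (2 * (t * d + x) + (4 * s + t * (t * t))) + 0
      eq = solve-∀
      eq′ : ∀ t m → 2 * (2 * m * t) ≡ 4 * (t * m)
      eq′ = solve-∀
      eq″ : ∀ t m → 2 * m * (2 * m) + t * t ≡ 4 * (m * m) + t * t
      eq″ = solve-∀
      bound : 4 * (t * d v) ≤ 4 * ∑[ y ← T ] (N y * N y) + t * (t * t)
      bound = begin
        4 * (t * d v)
          ≡⟨ trans (cong (4 *_) (sym (∑-*ˡ t T N))) (sym (∑-*ˡ 4 T _)) ⟩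
        ∑[ y ← T ] (4 * (t * N y))
          ≤⟨ ∑-mono T (λ y → ≤-trans (≤-reflexive (sym (eq′ t (N y)))) (≤-trans (2ab≤a²+b² (2 * N y) t) (≤-reflexive (eq″ t (N y))))) ⟩
        ∑[ y ← T ] (4 * (N y * N y) + t * t)
          ≡⟨ trans (∑-+ T _ _) (cong₂ _+_ (∑-*ˡ 4 T _) (∑-const T (t * t))) ⟩
        4 * ∑[ y ← T ] (N y * N y) + t * (t * t) ∎
        where open ≤-Reasoning

  few-triangles : ∀ θ v → 0 < t → θ * tri v ≤ t * (t * t) → 2 * θ * d v ≤ (θ + 2) * (t * t)
  few-triangles θ v 0<t h = *-cancelˡ-≤ t {{>-nonZero 0<t}} (lin 0 (θ ⊙ mantel v ⊕ 2 ⊙ h) (eq θ t (d v) (tri v)))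
    where
    eq : ∀ θ t d x → t * ((θ + 2) * (t * t)) + (θ * (2 * (t * d)) + 2 * (θ * x))
                   ≡ t * (2 * θ * d) + (θ * (t * (t * t) + 2 * x) + 2 * (t * (t * t))) + 0
    eq = solve-∀

  -- Edges and extended edges inside T: an edge without extensions has codegree sum at most t.
  E₃ K₄ : ℕ
  E₃ = ∑³ T (λ a b c → 𝟙 (e a b c))
  K₄ = ∑[ v ← T ] ∑³ T (λ a b c → 𝟙 (e a b c ∧ ext v a b c))

  N₂ : Fin n → Fin n → ℕ
  N₂ a b = ∑[ v ← T ] 𝟙 (e v a b)

  S₂ : ℕ
  S₂ = ∑[ a ← T ] ∑[ b ← T ] (N₂ a b * N₂ a b)

  S₂-12 : ∑³ T (λ a b c → 𝟙 (e a b c) * N₂ a b) ≡ S₂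
  S₂-12 = ∑-cong T (λ a → ∑-cong T (λ b → trans (∑-*ʳ (N₂ a b) T (λ c → 𝟙 (e a b c)))
    (cong (_* N₂ a b) (∑-cong T (λ c → cong 𝟙 (sym (rot c a b)))))))

  S₂-13 : ∑³ T (λ a b c → 𝟙 (e a b c) * N₂ a c) ≡ S₂
  S₂-13 = trans (∑³-cong T (λ a b c → cong (λ x → 𝟙 x * N₂ a c) (sym₂₃ a b c)))
    (trans (∑³-swap₂₃ T (λ a b c → 𝟙 (e a b c) * N₂ a b)) S₂-12)

  S₂-23 : ∑³ T (λ a b c → 𝟙 (e a b c) * N₂ b c) ≡ S₂
  S₂-23 = trans (∑³-cong T (λ a b c → cong (λ x → 𝟙 x * N₂ b c) (rot a b c)))
    (trans (∑³-rotˡ T (λ a b c → 𝟙 (e a b c) * N₂ a b)) S₂-12)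

  S₂≤ : 3 * S₂ ≤ t * E₃ + 2 * K₄
  S₂≤ = begin
    3 * S₂
      ≡⟨ eq S₂ ⟩
    S₂ + S₂ + S₂
      ≡⟨ sym (cong₂ _+_ (cong₂ _+_ S₂-12 S₂-13) S₂-23) ⟩
    ∑³ T F₁ + ∑³ T F₂ + ∑³ T F₃
      ≡⟨ sym (trans (∑³-+ T _ F₃) (cong (_+ ∑³ T F₃) (∑³-+ T F₁ F₂))) ⟩
    ∑³ T (λ a b c → F₁ a b c + F₂ a b c + F₃ a b c)
      ≤⟨ ∑³-mono T each ⟩
    ∑³ T (λ a b c → t * 𝟙 (e a b c) + 2 * ∑[ v ← T ] 𝟙 (e a b c ∧ ext v a b c))
      ≡⟨ trans (∑³-+ T _ _) (cong₂ _+_ (∑³-*ˡ t T (λ a b c → 𝟙 (e a b c)))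
           (trans (∑³-*ˡ 2 T _) (cong (2 *_) (sym (∑-∑³-swap T T (λ v a b c → 𝟙 (e a b c ∧ ext v a b c))))))) ⟩
    t * E₃ + 2 * K₄ ∎
    where
    open ≤-Reasoning
    F₁ F₂ F₃ : Fin n → Fin n → Fin n → ℕ
    F₁ a b c = 𝟙 (e a b c) * N₂ a b
    F₂ a b c = 𝟙 (e a b c) * N₂ a c
    F₃ a b c = 𝟙 (e a b c) * N₂ b c
    eq : ∀ s → 3 * s ≡ s + s + s
    eq = solve-∀
    eq₁ : ∀ i x y z → i * x + i * y + i * z ≡ i * (x + y + z)
    eq₁ = solve-∀
    eq₂ : ∀ i t x → i * (t + 2 * x) ≡ t * i + 2 * (i * x)
    eq₂ = solve-∀
    total : ∀ a b c → N₂ a b + N₂ a c + N₂ b c ≤ t + 2 * ∑[ v ← T ] 𝟙 (ext v a b c)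
    total a b c = begin
      N₂ a b + N₂ a c + N₂ b c
        ≡⟨ sym (trans (∑-+ T _ _) (cong (_+ N₂ b c) (∑-+ T _ _))) ⟩
      ∑[ v ← T ] (𝟙 (e v a b) + 𝟙 (e v a c) + 𝟙 (e v b c))
        ≤⟨ ∑-mono T (λ v → 𝟙-at-least-2 (e v a b) (e v a c) (e v b c)) ⟩
      ∑[ v ← T ] (1 + 2 * 𝟙 (ext v a b c))
        ≡⟨ trans (∑-+ T (λ _ → 1) _) (cong₂ _+_ (trans (∑-const T 1) (*-identityʳ t)) (∑-*ˡ 2 T (λ v → 𝟙 (ext v a b c)))) ⟩
      t + 2 * ∑[ v ← T ] 𝟙 (ext v a b c) ∎
    each : ∀ a b c → F₁ a b c + F₂ a b c + F₃ a b c ≤ t * 𝟙 (e a b c) + 2 * ∑[ v ← T ] 𝟙 (e a b c ∧ ext v a b c)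
    each a b c = begin
      F₁ a b c + F₂ a b c + F₃ a b c
        ≡⟨ eq₁ (𝟙 (e a b c)) (N₂ a b) (N₂ a c) (N₂ b c) ⟩
      𝟙 (e a b c) * (N₂ a b + N₂ a c + N₂ b c)
        ≤⟨ 𝟙 (e a b c) ⊙ total a b c ⟩
      𝟙 (e a b c) * (t + 2 * ∑[ v ← T ] 𝟙 (ext v a b c))
        ≡⟨ eq₂ (𝟙 (e a b c)) t _ ⟩
      t * 𝟙 (e a b c) + 2 * (𝟙 (e a b c) * ∑[ v ← T ] 𝟙 (ext v a b c))
        ≡⟨ cong (λ x → t * 𝟙 (e a b c) + 2 * x) (sym (∑-∧ (e a b c) T (λ v → ext v a b c))) ⟩
      t * 𝟙 (e a b c) + 2 * ∑[ v ← T ] 𝟙 (e a b c ∧ ext v a b c) ∎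

  -- The inequality of Cauchy and Schwarz in linear form, as the tangent of the square at the
  -- codegree `t / 3`, which is the extremal one.
  S₂≥ : 6 * (t * E₃) ≤ 9 * S₂ + t * t * (t * t)
  S₂≥ = begin
    6 * (t * E₃)
      ≡⟨ sym (trans (∑-cong T (λ a → trans (∑-cong T (λ b → refl)) (trans (∑-*ˡ 6 T (λ b → t * N₂ a b)) (cong (6 *_) (∑-*ˡ t T (N₂ a))))))
           (trans (∑-*ˡ 6 T _) (cong (6 *_) (trans (∑-*ˡ t T _) (cong (t *_) E₃-N₂))))) ⟩
    ∑[ a ← T ] ∑[ b ← T ] (6 * (t * N₂ a b))
      ≤⟨ ∑-mono T (λ a → ∑-mono T (λ b → ≤-trans (≤-reflexive (sym (eq′ t (N₂ a b))))
           (≤-trans (2ab≤a²+b² (3 * N₂ a b) t) (≤-reflexive (eq″ t (N₂ a b)))))) ⟩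
    ∑[ a ← T ] ∑[ b ← T ] (9 * (N₂ a b * N₂ a b) + t * t)
      ≡⟨ trans (∑-cong T (λ a → trans (∑-+ T _ _) (cong₂ _+_ (∑-*ˡ 9 T _) (∑-const T (t * t)))))
           (trans (∑-+ T _ _) (cong₂ _+_ (∑-*ˡ 9 T _) (trans (∑-const T _) (eq t)))) ⟩
    9 * S₂ + t * t * (t * t) ∎
    where
    open ≤-Reasoning
    E₃-N₂ : ∑[ a ← T ] ∑[ b ← T ] N₂ a b ≡ E₃
    E₃-N₂ = ∑³-cong T (λ a b c → cong 𝟙 (rot c a b))
    eq : ∀ t → t * (t * (t * t)) ≡ t * t * (t * t)
    eq = solve-∀
    eq′ : ∀ t m → 2 * (3 * m * t) ≡ 6 * (t * m)
    eq′ = solve-∀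
    eq″ : ∀ t m → 3 * m * (3 * m) + t * t ≡ 9 * (m * m) + t * t
    eq″ = solve-∀

  few-extensions : ∀ θ → 0 < t → θ * K₄ ≤ t * t * (t * t) → 3 * θ * E₃ ≤ (θ + 6) * t * (t * t)
  few-extensions θ 0<t h = *-cancelˡ-≤ t {{>-nonZero 0<t}} (lin 0 (θ ⊙ S₂≥ ⊕ (3 * θ) ⊙ S₂≤ ⊕ 6 ⊙ h) (eq θ t E₃ K₄ S₂))
    where
    eq : ∀ θ t x y s → t * ((θ + 6) * t * (t * t)) + (θ * (6 * (t * x)) + 3 * θ * (3 * s) + 6 * (θ * y))
      ≡ t * (3 * θ * x) + (θ * (9 * s + t * t * (t * t)) + 3 * θ * (t * x + 2 * y) + 6 * (t * t * (t * t))) + 0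
    eq = solve-∀

  E₃-d : ∑ T d ≡ E₃
  E₃-d = refl

  d≤ : ∀ v → d v ≤ t * t
  d≤ v = ∑-≤const T t (λ y → ≤-trans (∑-≤const T 1 (λ z → 𝟙≤1 (e v y z))) (≤-reflexive (*-identityʳ t)))

  degree-sum : (∀ v → mult T v ≤ 1) → D * (t * t) ≤ ∑ V d + D * t
  degree-sum T≤1 = begin
    D * (t * t)
      ≡⟨ eq D t ⟩
    t * (t * D)
      ≡⟨ sym (trans (∑-cong T (λ y → ∑-const T D)) (∑-const T (t * D))) ⟩
    ∑[ y ← T ] ∑[ z ← T ] D
      ≤⟨ ∑-mono T (λ y → ∑-mono T (λ z → each y z)) ⟩
    ∑[ y ← T ] ∑[ z ← T ] (∑[ v ← V ] 𝟙 (e v y z) + D * 𝟙 (y == z))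
      ≡⟨ trans (∑-cong T (λ y → ∑-+ T _ _)) (∑-+ T _ _) ⟩
    ∑[ y ← T ] ∑[ z ← T ] ∑[ v ← V ] 𝟙 (e v y z) + ∑[ y ← T ] ∑[ z ← T ] (D * 𝟙 (y == z))
      ≡⟨ cong (_+ ∑[ y ← T ] ∑[ z ← T ] (D * 𝟙 (y == z)))
           (trans (∑-cong T (λ y → ∑-swap T V (λ z v → 𝟙 (e v y z)))) (∑-swap T V (λ y v → ∑[ z ← T ] 𝟙 (e v y z)))) ⟩
    ∑ V d + ∑[ y ← T ] ∑[ z ← T ] (D * 𝟙 (y == z))
      ≤⟨ +-monoʳ-≤ (∑ V d) (≤-trans (∑-≤const T D (λ y → ≤-trans (≤-reflexive (trans (∑-*ˡ D T (λ z → 𝟙 (y == z)))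
           (cong (D *_) (∑-cong T (λ z → cong 𝟙 (==-sym y z)))))) (≤-trans (D ⊙ T≤1 y) (≤-reflexive (*-identityʳ D)))))
           (≤-reflexive (*-comm t D))) ⟩
    ∑ V d + D * t ∎
    where
    open ≤-Reasoning
    eq : ∀ D t → D * (t * t) ≡ t * (t * D)
    eq = solve-∀
    each : ∀ y z → D ≤ ∑[ v ← V ] 𝟙 (e v y z) + D * 𝟙 (y == z)
    each y z = by-cases (y == z) refl
      where
      by-cases : ∀ b → (y == z) ≡ b → D ≤ ∑[ v ← V ] 𝟙 (e v y z) + D * 𝟙 b
      by-cases true  _ = ≤-trans (≤-reflexive (sym (*-identityʳ D))) (m≤n+m (D * 1) _)
      by-cases false h = ≤-trans (codeg₁ y z (==-false h)) (m≤m+n _ _)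

  -- The final count: A are the absorbing vertices, L the uncovered ones, P the blocks with a super
  -- vertex (of which the other three vertices belong to T), W the new such blocks and U the others.
  module _ (A L : List (Fin n)) (P W U : List (Quad n)) (T≡ : T ≡ L ++ bodies P)
    (all-vertices : ∀ v → mult A v + (mult L v + (mult (flat P) v + (mult (flat W) v + mult (flat U) v))) ≡ 1)
    (T≤1 : ∀ v → mult T v ≤ 1) (θ : ℕ) (θ≥ : 12 * k ≤ θ) (t≥ : 6 * k < t) (0<g : 0 < g) (0<θ : 0 < θ)
    (no-K₄ : θ * K₄ ≤ t * t * (t * t))
    (normal : ∀ {v} → v ∈ flat U → θ * tri v ≤ t * (t * t))
    (few-A : 3 * k * length A ≤ n) (few-W : 12 * k * length W ≤ n) (0<k : 0 < k) where

    private
      a = length A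
      l = length L
      m = length P
      ν = length W
      u = length U

    everything : List (Fin n)
    everything = A ++ L ++ flat P ++ flat W ++ flat U

    mult-everything : ∀ v → mult V v ≡ mult everything v
    mult-everything v = trans (mult-allFin v) (sym (trans (eq v) (all-vertices v)))
      where
      eq : ∀ v → mult everything v ≡ mult A v + (mult L v + (mult (flat P) v + (mult (flat W) v + mult (flat U) v)))
      eq v rewrite mult-++ A (L ++ flat P ++ flat W ++ flat U) v | mult-++ L (flat P ++ flat W ++ flat U) v
                 | mult-++ (flat P) (flat W ++ flat U) v | mult-++ (flat W) (flat U) v = refl

    sum-everything : ∀ f → ∑ V f ≡ ∑ A f + (∑ L f + (∑ (flat P) f + (∑ (flat W) f + ∑ (flat U) f)))
    sum-everything f = trans (∑-mult-cong V everything f mult-everything)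
      (trans (∑-++ A _ f) (cong (∑ A f +_) (trans (∑-++ L _ f) (cong (∑ L f +_)
        (trans (∑-++ (flat P) _ f) (cong (∑ (flat P) f +_) (∑-++ (flat W) (flat U) f)))))))

    n≡ : n ≡ a + (l + (4 * m + (4 * ν + 4 * u)))
    n≡ = trans (sym length-V) (trans (length-∑ V) (trans (sum-everything (λ _ → 1))
      (cong₂ _+_ (sym (length-∑ A)) (cong₂ _+_ (sym (length-∑ L)) (cong₂ _+_ (len P) (cong₂ _+_ (len W) (len U)))))))
      where
      len : ∀ ps → ∑[ v ← flat ps ] 1 ≡ 4 * length ps
      len ps = trans (sym (length-∑ (flat ps))) (length-flat ps)

    t≡ : t ≡ l + 3 * m
    t≡ = trans (cong length T≡) (trans (length-++ L) (cong (l +_) (length-bodies P)))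

    0<t : 0 < t
    0<t = ≤-<-trans z≤n t≥

    normal-sum : ∀ ps → (∀ {v} → v ∈ ps → θ * tri v ≤ t * (t * t)) → 2 * θ * ∑ ps d ≤ length ps * ((θ + 2) * (t * t))
    normal-sum ps h = ≤-trans (≤-reflexive (sym (∑-*ˡ (2 * θ) ps d)))
      (≤-trans (∑-mono∈ ps (λ v v∈ → few-triangles θ v 0<t (h v∈))) (≤-reflexive (∑-const ps _)))

    -- An upper bound for the sum of all degrees, scaled by `6θ / t²`. Up to errors of order `1/θ`,
    -- a vertex of `A` or `W` and a first vertex of `P` weighs 1, the vertices of `T` weigh `1/3` on
    -- average, and those of `U` weigh `1/2`.
    Br : ℕ
    Br = 6 * θ * a + 2 * (θ + 6) * t + 6 * θ * m + 24 * θ * ν + 12 * (θ + 2) * u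

    LB : ∑ L d + ∑ (bodies P) d ≡ E₃
    LB = trans (sym (∑-++ L (bodies P) d)) (trans (cong (λ x → ∑ x d) (sym T≡)) E₃-d)

    degree-bound : 6 * θ * D * t ≤ 6 * θ * D + t * Br
    degree-bound = *-cancelˡ-≤ t {{>-nonZero 0<t}} (lin 0
      ((6 * θ) ⊙ degree-sum T≤1 ⊕ (6 * θ) ⊙ ≤-reflexive (sum-everything d)
        ⊕ (6 * θ) ⊙ ∑-≤const A (t * t) d≤
        ⊕ (6 * θ) ⊙ ≤-reflexive LB
        ⊕ 2 ⊙ few-extensions θ 0<t no-K₄
        ⊕ (6 * θ) ⊙ ≤-reflexive (flat-split P d)
        ⊕ (6 * θ) ⊙ ≤-trans (∑-≤const (centers P) (t * t) d≤) (≤-reflexive (cong (_* (t * t)) (length-centers P)))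
        ⊕ (6 * θ) ⊙ ≤-trans (∑-≤const (flat W) (t * t) d≤) (≤-reflexive (cong (_* (t * t)) (length-flat W)))
        ⊕ 3 ⊙ ≤-trans (normal-sum (flat U) normal) (≤-reflexive (cong (_* ((θ + 2) * (t * t))) (length-flat U))))
      (eq D θ t a m ν u (∑ V d) (∑ A d) (∑ L d) (∑ (flat P) d) (∑ (bodies P) d) (∑ (centers P) d) (∑ (flat W) d) (∑ (flat U) d) E₃))
      where
      eq : ∀ D θ t a m w u X XA XL XP XB XC XW XU E →
        t * (6 * θ * D + t * (6 * θ * a + 2 * (θ + 6) * t + 6 * θ * m + 24 * θ * w + 12 * (θ + 2) * u))
          + (6 * θ * (D * (t * t)) + 6 * θ * X + 6 * θ * XA + 6 * θ * (XL + XB) + 2 * (3 * θ * E) + 6 * θ * XP + 6 * θ * XC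
             + 6 * θ * XW + 3 * (2 * θ * XU))
        ≡ t * (6 * θ * D * t) + (6 * θ * (X + D * t) + 6 * θ * (XA + (XL + (XP + (XW + XU)))) + 6 * θ * (a * (t * t))
             + 6 * θ * E + 2 * ((θ + 6) * t * (t * t)) + 6 * θ * (XC + XB) + 6 * θ * (m * (t * t)) + 6 * θ * (4 * w * (t * t))
             + 3 * (4 * u * ((θ + 2) * (t * t)))) + 0
      eq = solve-∀

    -- A block of `P` weighs 1 for its first vertex and three times `1/3` for the others, in total
    -- 2, exactly as much as a block of `U`. Vertices of `L` weigh only `1/3`. Hence the average
    -- weight is at most `1/2`, apart from `A`, `W` and the errors.
    Br≤ : Br ≤ 3 * θ * n + 3 * θ * a + 12 * θ * ν + 12 * n
    Br≤ = lin (θ * l + 12 * a + 12 * m + 48 * ν + 24 * u)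
      ((2 * θ + 12) ⊙ ≤-reflexive t≡ ⊕ (3 * θ + 12) ⊙ ≤-reflexive (sym n≡)) (eq θ n t a l m ν u)
      where
      eq : ∀ θ n t a l m w u →
        3 * θ * n + 3 * θ * a + 12 * θ * w + 12 * n + ((2 * θ + 12) * t + (3 * θ + 12) * (a + (l + (4 * m + (4 * w + 4 * u)))))
        ≡ 6 * θ * a + 2 * (θ + 6) * t + 6 * θ * m + 24 * θ * w + 12 * (θ + 2) * u
          + ((2 * θ + 12) * (l + 3 * m) + (3 * θ + 12) * n) + (θ * l + 12 * a + 12 * m + 48 * w + 24 * u)
      eq = solve-∀

    -- The codegree excess contributes `6θgt`. It meets four errors of at most `θgt` each: the
    -- diagonal pairs (`t > 6k`), the set `A`, the blocks `W`, and the deviations from the densities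
    -- `1/3` and `1/2` (`θ ≥ 12k`).
    absurd : ⊥
    absurd = <⇒≱ 0<2θgt (lin 0
        ((3 * θ * t) ⊙ half ⊕ degree-bound ⊕ t ⊙ Br≤ ⊕ (6 * θ) ⊙ D≤n ⊕ (6 * θ + 12 * t) ⊙ dense ⊕ (θ * g) ⊙ <⇒≤ t≥
          ⊕ (θ * t) ⊙ 3a≤g ⊕ (θ * t) ⊙ 12w≤g ⊕ (t * g) ⊙ θ≥)
        (eq D g n k θ t a ν Br))
      where
      0<2θgt : 0 < 2 * (θ * (g * t))
      0<2θgt = *-mono-≤ (s≤s {0} {1} z≤n) (*-mono-≤ 0<θ (*-mono-≤ 0<g 0<t))
      3a≤g : 3 * a ≤ g
      3a≤g = *-cancelˡ-≤ k {{>-nonZero 0<k}} (≤-trans (≤-reflexive (eq k a)) (≤-trans few-A dense))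
        where
        eq : ∀ k a → k * (3 * a) ≡ 3 * k * a
        eq = solve-∀
      12w≤g : 12 * ν ≤ g
      12w≤g = *-cancelˡ-≤ k {{>-nonZero 0<k}} (≤-trans (≤-reflexive (eq k ν)) (≤-trans few-W dense))
        where
        eq : ∀ k a → k * (12 * a) ≡ 12 * k * a
        eq = solve-∀
      eq : ∀ D g n k θ t a w B →
        0 + (3 * θ * t * (n + 2 * g) + 6 * θ * D * t + t * B + 6 * θ * D + (6 * θ + 12 * t) * n + θ * g * (6 * k)
             + θ * t * (3 * a) + θ * t * (12 * w) + t * g * (12 * k))
        ≡ 2 * (θ * (g * t)) + (3 * θ * t * (2 * D) + (6 * θ * D + t * B) + t * (3 * θ * n + 3 * θ * a + 12 * θ * w + 12 * n)
             + 6 * θ * n + (6 * θ + 12 * t) * (k * g) + θ * g * t + θ * t * g + θ * t * g + t * g * θ) + 0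
      eq = solve-∀

-- Freeing a vertex added in round j + 1 takes its block and three vertices freed at the cost of round j.
cost reserve : ℕ → ℕ
cost zero       = 1
cost (suc j)    = 1 + 3 * cost j
reserve zero    = 0
reserve (suc j) = reserve j + 4 + 3 * cost j

cost-mono : ∀ f j → cost j ≤ cost (f + j)
cost-mono zero    j = ≤-refl
cost-mono (suc f) j = ≤-trans (cost-mono f j) (≤-trans (m≤m+n (cost (f + j)) _) (n≤1+n _))

reserve-mono : ∀ f j → reserve j ≤ reserve (f + j)
reserve-mono zero    j = ≤-refl
reserve-mono (suc f) j = ≤-trans (reserve-mono f j) (≤-trans (m≤m+n (reserve (f + j)) 4) (m≤m+n _ _))

-- Sufficient to free the four vertices of one additional tile after `R` rounds.
budget : ℕ → ℕ
budget R = 4 * (cost R + 1) + reserve R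

-- What `select` demands of `T` for four letters at density `1 / 12k` with at most `budget` blocks
-- forbidden. As `T` contains `L`, it is imposed on `L`.
leftover : ℕ → ℕ
leftover k = 16 * (budget (1 + 12 * k) + 4) * (12 * k)

-- Growing the set of freeable vertices

module Enlarging {n : ℕ} (e : Fin n → Fin n → Fin n → Bool)
  (sym₁₂ : ∀ x y z → e x y z ≡ e y x z) (sym₂₃ : ∀ x y z → e x y z ≡ e x z y)
  (irr : ∀ x z → e x x z ≡ false)
  (D g k : ℕ) (codeg : ∀ x y → x ≢ y → D ≤ ∑[ z ← Tiles.V e ] 𝟙 (e x y z))
  (half : n + 2 * g ≤ 2 * D) (dense : n ≤ k * g) (2≤n : 2 ≤ n) (D≤n : D ≤ n) (0<k : 0 < k) (0<g : 0 < g) where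

  open Codegree e sym₁₂ sym₂₃ irr D g k codeg half dense 2≤n
  open Improve e sym₁₂ sym₂₃ irr D g k codeg half dense 2≤n D≤n 0<k

  module _ (A : List (Fin n)) (few-A : 3 * k * length A ≤ n) where

   module _ (ts : List (Quad n)) (𝒯 : Tiling A ts) (L : List (Fin n))
    (all-vertices : ∀ v → mult A v + (mult L v + mult (flat ts) v) ≡ 1) (many-left : leftover k < length L) where

    open Freeing A ts 𝒯

    -- A round adds more than `n / 12k` blocks to `Pr`, which never has more than `n`, so round
    -- `1 + 12 * k` is not reached.
    θ R B : ℕ
    θ = 12 * k
    R = 1 + 12 * k
    B = budget R

    open Budget B

    -- In a block of `Pr` the first vertex was found to be super and the other three became
    -- freeable; the first one itself does not enter `T`. The blocks of `Un` are unaffected so far.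
    record State (j : ℕ) : Set where
      field
        Pr Un  : List (Quad n)
        total  : ∀ v → mult (flat Pr) v + mult (flat Un) v ≡ mult (flat ts) v
        cellsP : All Cell Pr
        cellsU : All Cell Un
        free   : FreeAll (cost j) (reserve j) (L ++ bodies Pr)
        progress : j * n ≤ 12 * k * length Pr

    open State

    0<n : 0 < n
    0<n = ≤-trans (s≤s z≤n) 2≤n

    -- An uncovered vertex is a class of its own. It is entered in `C` to mark it as taken, although
    -- no tile is dissolved.
    L-free : FreeAll 1 0 L
    L-free {y} y∈ F le Fy = record
      { C = y ∷ [] ; new = [] ; few = ≤-refl
      ; unique = λ r → ≤-trans (≤-reflexive (+-identityʳ _)) (𝟙≤1 (y == r))
      ; avoidF = λ r h → trans (cong (mult F) (sym (trans ϱy (is-y r h)))) Fy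
      ; avoidA = λ r h → trans (cong (mult A) (sym (is-y r h))) Ay
      ; tiled = []
      ; value = ≤-trans (∑-mono ts (λ q → first≤ q)) (≤-reflexive (trans (sym (flat-∑ ts (λ u → 𝟙 (u == y)))) fy))
      ; fits = fits-y }
      where
      Ly : 1 ≤ mult L y
      Ly = ∈⇒mult y∈
      rest0 : mult A y + mult (flat ts) y ≡ 0
      rest0 = n<1⇒n≡0 (+-cancelˡ-< 1 _ _ (s≤s (≤-trans (+-monoˡ-≤ _ Ly)
        (≤-reflexive (trans (eq (mult A y) (mult L y) (mult (flat ts) y)) (all-vertices y))))))
        where
        eq : ∀ a l f → l + (a + f) ≡ a + (l + f)
        eq = solve-∀
      Ay : mult A y ≡ 0
      Ay = m+n≡0⇒m≡0 _ rest0
      fy : mult (flat ts) y ≡ 0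
      fy = m+n≡0⇒n≡0 (mult A y) rest0
      ϱy : ϱ y ≡ y
      ϱy = rep-out ts fy
      is-y : ∀ r → 1 ≤ mult (y ∷ []) r → y ≡ r
      is-y r h = ==-sound (𝟙-pos (≤-trans h (≤-reflexive (+-identityʳ _))))
      first≤ : ∀ q → mult (y ∷ []) (first q) ≤ mult (verts q) y
      first≤ (a , b , c , d) = ≤-trans (≤-reflexive (trans (+-identityʳ _) (cong 𝟙 (==-sym y a)))) (m≤m+n _ _)
      fits-y : ∀ v → 0 + mult (y ∷ []) v ≤ mult (y ∷ []) (ϱ v)
      fits-y v = by-cases (y == v) refl
        where
        by-cases : ∀ b → (y == v) ≡ b → 𝟙 b + 0 ≤ mult (y ∷ []) (ϱ v)
        by-cases false _ = z≤n
        by-cases true  h = ≤-trans (≤-reflexive (cong 𝟙 (sym (subst (λ w → (y == w) ≡ true)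
          (trans (sym ϱy) (cong ϱ (==-sound h))) (==-refl y))))) (m≤m+n _ 0)

    start : State 0
    start = record { Pr = [] ; Un = ts ; total = λ v → refl ; cellsP = [] ; cellsU = All.tabulate cell
                   ; free = λ {y} y∈ → L-free (in-L y∈) ; progress = z≤n }
      where
      in-L : ∀ {y} → y ∈ L ++ [] → y ∈ L
      in-L y∈ with ∈-++⁻ L y∈
      ... | inj₁ h = h
      cell : ∀ {q} → q ∈ ts → Cell q
      cell {q@(s , a , b , c)} q∈ = same a (le₂ (s == a) (𝟙 (a == a)) (self a)) , same b (le₃ (s == b) (a == b) (𝟙 (b == b)) (self b)) ,
          same c (le₄ (s == c) (a == c) (b == c) (self c))
        where
        self : ∀ x → 1 ≤ 𝟙 (x == x)
        self x = ≤-reflexive (sym (𝟙-true (==-refl x)))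
        le₂ : ∀ i j {x} → 1 ≤ j → 1 ≤ 𝟙 i + (j + x)
        le₂ i j {x} h = ≤-trans h (≤-trans (m≤m+n j x) (m≤n+m (j + x) (𝟙 i)))
        le₃ : ∀ i i′ j {x} → 1 ≤ j → 1 ≤ 𝟙 i + (𝟙 i′ + (j + x))
        le₃ i i′ j {x} h = ≤-trans (le₂ i′ j {x} h) (m≤n+m _ (𝟙 i))
        le₄ : ∀ i i′ i″ {j} → 1 ≤ j → 1 ≤ 𝟙 i + (𝟙 i′ + (𝟙 i″ + (j + 0)))
        le₄ i i′ i″ {j} h = ≤-trans (le₃ i′ i″ j {0} h) (m≤n+m _ (𝟙 i))
        same : ∀ x → 1 ≤ mult (verts q) x → ϱ x ≡ ϱ s
        same x h = trans (rep-in ts ts-simple q∈ h) (sym (rep-in ts ts-simple q∈ (first-verts q)))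

    module Round {j : ℕ} (S : State j) (enough : 4 * (cost j + 1) + reserve j ≤ B) where

      T : List (Fin n)
      T = L ++ bodies (Pr S)

      t : ℕ
      t = length T

      t-large : 16 * (B + 4) * θ < t
      t-large = <-≤-trans many-left (≤-trans (m≤m+n (length L) _) (≤-reflexive (sym (length-++ L))))

      mult-bodies≤ : ∀ (ps : List (Quad n)) v → mult (bodies ps) v ≤ mult (flat ps) v
      mult-bodies≤ ps v = ≤-trans (m≤n+m _ (mult (centers ps) v)) (≤-reflexive (sym (flat-split ps (λ u → 𝟙 (u == v)))))

      T≤1 : ∀ v → mult T v ≤ 1
      T≤1 v = begin
        mult T v
          ≡⟨ mult-++ L (bodies (Pr S)) v ⟩
        mult L v + mult (bodies (Pr S)) v
          ≤⟨ +-monoʳ-≤ (mult L v) (≤-trans (mult-bodies≤ (Pr S) v) (≤-trans (m≤m+n (mult (flat (Pr S)) v) _) (≤-reflexive (total S v)))) ⟩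
        mult L v + mult (flat ts) v
          ≤⟨ m≤n+m _ (mult A v) ⟩
        mult A v + (mult L v + mult (flat ts) v)
          ≡⟨ all-vertices v ⟩
        1 ∎
        where open ≤-Reasoning

      triangles : Fin n → ℕ
      triangles v = ∑ʷ T 3 (λ s → 𝟙 (triangle v s))

      record Split (qs : List (Quad n)) : Set where
        field
          supers others : List (Quad n)
          divided : ∀ v → mult (flat supers) v + mult (flat others) v ≡ mult (flat qs) v
          super   : All (λ q → Super θ T (first q)) supers
          cellsW  : All Cell supers
          cellsN  : All Cell others
          normal  : ∀ {v} → v ∈ flat others → θ * triangles v ≤ t ^ 3

      open Split

      split : ∀ qs → All Cell qs → Split qs
      split [] [] = record { supers = [] ; others = [] ; divided = λ _ → refl ; super = [] ; cellsW = [] ; cellsN = [] ; normal = λ () }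
      split (q@(x , y , z , w) ∷ qs) (cell@(yx , zx , wx) ∷ cells) = by-cases (_ ≤? _) (_ ≤? _) (_ ≤? _) (_ ≤? _)
        where
        rec : Split qs
        rec = split qs cells
        put : ∀ q′ → (∀ v → mult (verts q′) v ≡ mult (verts q) v) → Super θ T (first q′) → Cell q′ → Split (q ∷ qs)
        put q′ same sup cell′ = record
          { supers = q′ ∷ supers rec ; others = others rec
          ; divided = λ v → trans (cong (_+ mult (flat (others rec)) v) (mult-flat-∷ q′ (supers rec) v))
              (trans (+-assoc (mult (verts q′) v) _ _) (trans (cong₂ _+_ (same v) (divided rec v)) (sym (mult-flat-∷ q qs v))))
          ; super = sup ∷ super rec ; cellsW = cell′ ∷ cellsW rec ; cellsN = cellsN rec ; normal = normal rec }
        eq₂ : ∀ x y z w → y + (x + (z + (w + 0))) ≡ x + (y + (z + (w + 0)))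
        eq₂ = solve-∀
        eq₃ : ∀ x y z w → z + (y + (x + (w + 0))) ≡ x + (y + (z + (w + 0)))
        eq₃ = solve-∀
        eq₄ : ∀ x y z w → w + (y + (z + (x + 0))) ≡ x + (y + (z + (w + 0)))
        eq₄ = solve-∀
        by-cases : Dec (Super θ T x) → Dec (Super θ T y) → Dec (Super θ T z) → Dec (Super θ T w) → Split (q ∷ qs)
        by-cases (yes sx) _ _ _ = put q (λ _ → refl) sx cell
        by-cases (no _) (yes sy) _ _ = put (y , x , z , w)
          (λ v → eq₂ (𝟙 (x == v)) (𝟙 (y == v)) (𝟙 (z == v)) (𝟙 (w == v))) sy (sym yx , trans zx (sym yx) , trans wx (sym yx))
        by-cases (no _) (no _) (yes sz) _ = put (z , y , x , w)
          (λ v → eq₃ (𝟙 (x == v)) (𝟙 (y == v)) (𝟙 (z == v)) (𝟙 (w == v))) sz (trans yx (sym zx) , sym zx , trans wx (sym zx))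
        by-cases (no _) (no _) (no _) (yes sw) = put (w , y , z , x)
          (λ v → eq₄ (𝟙 (x == v)) (𝟙 (y == v)) (𝟙 (z == v)) (𝟙 (w == v))) sw (trans yx (sym wx) , trans zx (sym wx) , sym wx)
        by-cases (no nx) (no ny) (no nz) (no nw) = record
          { supers = supers rec ; others = q ∷ others rec
          ; divided = λ v → trans (cong (mult (flat (supers rec)) v +_) (mult-flat-∷ q (others rec) v))
              (trans (eq (mult (flat (supers rec)) v) (mult (verts q) v) (mult (flat (others rec)) v))
                (trans (cong (mult (verts q) v +_) (divided rec v)) (sym (mult-flat-∷ q qs v))))
          ; super = super rec ; cellsW = cellsW rec ; cellsN = cell ∷ cellsN rec ; normal = normal-∷ }
          where
          eq : ∀ a b c → a + (b + c) ≡ b + (a + c)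
          eq = solve-∀
          normal-∷ : ∀ {v} → v ∈ x ∷ y ∷ z ∷ w ∷ flat (others rec) → θ * triangles v ≤ t ^ 3
          normal-∷ (here refl)                         = ≰⇒≥ nx
          normal-∷ (there (here refl))                 = ≰⇒≥ ny
          normal-∷ (there (there (here refl)))         = ≰⇒≥ nz
          normal-∷ (there (there (there (here refl)))) = ≰⇒≥ nw
          normal-∷ (there (there (there (there v∈))))  = normal rec v∈

      sp : Split (Un S)
      sp = split (Un S) (cellsU S)

      extended : List (Fin n) → Bool
      extended (v ∷ a ∷ b ∷ c ∷ []) = e a b c ∧ ext v a b c
      extended _                    = false

      gain : t ^ 4 ≤ θ * ∑ʷ T 4 (λ s → 𝟙 (extended s)) → ∃ λ ts′ → Tiling A ts′ × length ts < length ts′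
      gain many-ext = use (select θ 4 T [] extended T≤1 (≤-<-trans (*-monoˡ-≤ θ (16 ⊙ m≤n+m 4 B)) t-large) many-ext)
        where
        use : (∃ λ s → length s ≡ 4 × All (_∈ T) s × extended s ≡ true × Spread ϱ [] s) →
              ∃ λ ts′ → Tiling A ts′ × length ts < length ts′
        use (v ∷ a ∷ b ∷ c ∷ [] , _ , s∈ , h , spread) =
          let h₁ , h₂ = ∧-true {e a b c} h in
          enlarge (v , a , b , c) (ext-tile {v} {a} {b} {c} h₂ h₁) (free-many (free S) (v ∷ a ∷ b ∷ c ∷ []) [] s∈ spread enough)

      stuck : 12 * k * length (supers sp) ≤ n → θ * ∑ʷ T 4 (λ s → 𝟙 (extended s)) ≤ t ^ 4 → ⊥
      stuck few-W no-ext = Count.absurd e sym₁₂ sym₂₃ irr D g k codeg half dense 2≤n D≤n T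
        A L (Pr S) (supers sp) (others sp) refl all-v T≤1 θ ≤-refl 6k<t 0<g 0<θ
        (≤-trans no-ext (≤-reflexive (eq₄ t))) (λ v∈ → ≤-trans (normal sp v∈) (≤-reflexive (eq₃ t))) few-A few-W 0<k
        where
        0<θ : 0 < θ
        0<θ = *-mono-≤ (s≤s {0} {11} z≤n) 0<k
        eq₄ : ∀ t → t * (t * (t * (t * 1))) ≡ t * t * (t * t)
        eq₄ = solve-∀
        eq₃ : ∀ t → t * (t * (t * 1)) ≡ t * (t * t)
        eq₃ = solve-∀
        6k<t : 6 * k < t
        6k<t = ≤-<-trans (≤-trans (*-monoˡ-≤ k (m≤m+n 6 6)) (≤-trans (≤-reflexive (sym (*-identityˡ θ)))
          (*-monoˡ-≤ θ (≤-trans (s≤s z≤n) (16 ⊙ m≤n+m 4 B))))) t-large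
        all-v : ∀ v → mult A v + (mult L v + (mult (flat (Pr S)) v + (mult (flat (supers sp)) v + mult (flat (others sp)) v))) ≡ 1
        all-v v = trans (cong (λ x → mult A v + (mult L v + x)) (trans (cong (mult (flat (Pr S)) v +_) (divided sp v)) (total S v)))
                        (all-vertices v)

      find : ∀ W {y} → y ∈ bodies W → All (λ q → Super θ T (first q)) W → All Cell W → (∀ v → mult (flat W) v ≤ mult (flat ts) v) →
             ∃ λ s → s ≢ y × ϱ y ≡ ϱ s × 1 ≤ mult (flat ts) s × Super θ T s
      find ((s , a , b , c) ∷ W) {y} y∈ (sup ∷ sups) ((ca , cb , cc) ∷ cells) le = by-cases y∈
        where
        s-in : 1 ≤ mult (flat ts) s
        s-in = ≤-trans (≤-trans (≤-reflexive (sym (𝟙-true (==-refl s)))) (m≤m+n _ _)) (le s)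
        self : ∀ x → 1 ≤ 𝟙 (x == x)
        self x = ≤-reflexive (sym (𝟙-true (==-refl x)))
        differ : ∀ {y} → 1 ≤ 𝟙 (a == y) + (𝟙 (b == y) + (𝟙 (c == y) + mult (flat W) y)) → s ≢ y
        differ {y} h refl = <⇒≱ (self s ⊕ h) (≤-trans (le s) (ts-simple s))
        by-cases : y ∈ a ∷ b ∷ c ∷ bodies W → ∃ λ s → s ≢ y × ϱ y ≡ ϱ s × 1 ≤ mult (flat ts) s × Super θ T s
        by-cases (here refl) = s , differ (≤-trans (self a) (m≤m+n _ _)) , ca , s-in , sup
        by-cases (there (here refl)) = s , differ (≤-trans (self b) (≤-trans (m≤m+n _ _) (m≤n+m _ (𝟙 (a == b))))) , cb , s-in , sup
        by-cases (there (there (here refl))) =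
          s , differ (≤-trans (self c) (≤-trans (m≤m+n _ _) (≤-trans (m≤n+m _ (𝟙 (b == c))) (m≤n+m _ (𝟙 (a == c)))))) , cc , s-in , sup
        by-cases (there (there (there y∈))) = find W y∈ sups cells (λ v → ≤-trans
          (≤-trans (m≤n+m _ (mult (verts (s , a , b , c)) v)) (≤-reflexive (sym (mult-flat-∷ (s , a , b , c) W v)))) (le v))

      next : n < 12 * k * length (supers sp) → State (suc j)
      next many-W = record
        { Pr = supers sp ++ Pr S ; Un = others sp
        ; total = λ v → trans (cong (_+ mult (flat (others sp)) v) (flat-++ (supers sp) (Pr S) (λ u → 𝟙 (u == v))))
            (trans (eq (mult (flat (supers sp)) v) (mult (flat (Pr S)) v) (mult (flat (others sp)) v))
              (trans (cong (mult (flat (Pr S)) v +_) (divided sp v)) (total S v)))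
        ; cellsP = All.++⁺ (cellsW sp) (cellsP S) ; cellsU = cellsN sp
        ; free = free-next
        ; progress = ≤-trans (<⇒≤ many-W ⊕ progress S) (≤-reflexive (trans (sym (*-distribˡ-+ (12 * k) (length (supers sp)) (length (Pr S))))
            (cong (12 * k *_) (sym (length-++ (supers sp)))))) }
        where
        eq : ∀ a b c → a + b + c ≡ b + (a + c)
        eq = solve-∀
        W≤ : ∀ v → mult (flat (supers sp)) v ≤ mult (flat ts) v
        W≤ v = ≤-trans (m≤m+n _ _) (≤-trans (≤-reflexive (divided sp v)) (≤-trans (m≤n+m _ _) (≤-reflexive (total S v))))
        large : 3 * (4 * (B + 3)) * θ < length T
        large = ≤-<-trans (*-monoˡ-≤ θ (lin (4 * B + 28) (≤-refl {0}) (eq′ B))) t-large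
          where
          eq′ : ∀ B → 16 * (B + 4) + 0 ≡ 3 * (4 * (B + 3)) + 0 + (4 * B + 28)
          eq′ = solve-∀
        free-next : FreeAll (cost (suc j)) (reserve (suc j)) (L ++ bodies (supers sp ++ Pr S))
        free-next {y} y∈ F le Fy = by-cases (∈-++⁻ L y∈)
          where
          old : y ∈ T → Free (cost (suc j)) (y ∷ []) F
          old h = free-weaken (≤-trans (m≤m+n (cost j) _) (n≤1+n _))
            (free S h F (≤-trans (+-monoʳ-≤ (length F) (≤-trans (m≤m+n (reserve j) 4) (m≤m+n _ _))) le) Fy)
          in-bodies : y ∈ bodies (supers sp) ++ bodies (Pr S) → Free (cost (suc j)) (y ∷ []) F
          in-bodies h with ∈-++⁻ (bodies (supers sp)) h
          ... | inj₂ h′ = old (∈-++⁺ʳ L h′)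
          ... | inj₁ h′ with find (supers sp) h′ (super sp) (cellsW sp) W≤
          ...   | s , s≢y , same , covered , sup = free-super {θ} {cost j} {reserve j} {T} T≤1 (free S) large s y s≢y same covered sup F le Fy
          by-cases : (y ∈ L) ⊎ (y ∈ bodies (supers sp ++ Pr S)) → Free (cost (suc j)) (y ∷ []) F
          by-cases (inj₁ h) = old (∈-++⁺ˡ h)
          by-cases (inj₂ h) = in-bodies (subst (y ∈_) (bodies-++ (supers sp) (Pr S)) h)

    -- A round ends with a larger tiling if `T` contains many tiles. Otherwise few super blocks
    -- would contradict the degree count in `stuck`, so there are many, and `T` grows.
    rounds : ∀ f j → f + j ≡ R → State j → ∃ λ ts′ → Tiling A ts′ × length ts < length ts′
    rounds zero j refl S = ⊥-elim (<⇒≱ (m<n+m (12 * k * n) 0<n) (≤-trans (progress S) ((12 * k) ⊙ Pr≤n)))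
      where
      Pr≤n : length (Pr S) ≤ n
      Pr≤n = begin
        length (Pr S)          ≤⟨ m≤m+n _ _ ⟩
        4 * length (Pr S)      ≡⟨ sym (length-flat (Pr S)) ⟩
        length (flat (Pr S))   ≡⟨ trans (length-∑ (flat (Pr S))) (∑-mult (flat (Pr S)) (λ _ → 1)) ⟩
        ∑[ v ← V ] (mult (flat (Pr S)) v * 1)
          ≤⟨ ∑-V-≤const 1 (λ v → ≤-trans (≤-reflexive (*-identityʳ _)) (≤-trans (m≤m+n (mult (flat (Pr S)) v) _) (≤-trans (≤-reflexive (total S v)) (ts-simple v)))) ⟩
        n * 1                  ≡⟨ *-identityʳ n ⟩
        n                      ∎
        where open ≤-Reasoning
    rounds (suc f) j eq S = by-cases (_ ≤? _) (_ ≤? _)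
      where
      enough : 4 * (cost j + 1) + reserve j ≤ B
      enough = 4 ⊙ +-monoˡ-≤ 1 (subst (λ r → cost j ≤ cost r) eq (cost-mono (suc f) j))
               ⊕ subst (λ r → reserve j ≤ reserve r) eq (reserve-mono (suc f) j)
      open Round S enough
      by-cases : Dec (t ^ 4 ≤ θ * ∑ʷ T 4 (λ s → 𝟙 (extended s))) → Dec (12 * k * length (Split.supers sp) ≤ n) →
                 ∃ λ ts′ → Tiling A ts′ × length ts < length ts′
      by-cases (yes h) _        = gain h
      by-cases (no ¬h) (yes h′) = ⊥-elim (stuck h′ (≰⇒≥ ¬h))
      by-cases (no ¬h) (no ¬h′) = rounds f (suc j) (trans (+-suc f j) eq) (next (≰⇒> ¬h′))

    longer-tiling : ∃ λ ts′ → Tiling A ts′ × length ts < length ts′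
    longer-tiling = rounds R 0 (+-identityʳ R) start

   zeroᵇ : ℕ → Bool
   zeroᵇ zero    = true
   zeroᵇ (suc _) = false

   uncovered : List (Quad n) → List (Fin n)
   uncovered ts = filterᵇ (λ v → zeroᵇ (mult A v + mult (flat ts) v)) V

   mult-filter : ∀ (p : Fin n → Bool) l v → mult (filterᵇ p l) v ≡ 𝟙 (p v) * mult l v
   mult-filter p []      v = sym (*-zeroʳ (𝟙 (p v)))
   mult-filter p (x ∷ l) v = trans (step (p x) refl) (sym (*-distribˡ-+ (𝟙 (p v)) (𝟙 (x == v)) (mult l v)))
    where
    rec = mult-filter p l v
    absorb-𝟙 : ∀ b → p x ≡ b → 𝟙 (p v) * 𝟙 (x == v) ≡ 𝟙 b * 𝟙 (x == v)
    absorb-𝟙 b eq = at-eq (x == v) refl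
      where
      at-eq : ∀ c → (x == v) ≡ c → 𝟙 (p v) * 𝟙 c ≡ 𝟙 b * 𝟙 c
      at-eq false _ = trans (*-zeroʳ (𝟙 (p v))) (sym (*-zeroʳ (𝟙 b)))
      at-eq true  h = cong (λ i → 𝟙 i * 1) (trans (cong p (sym (==-sound h))) eq)
    step : ∀ b → p x ≡ b → mult (filterᵇ p (x ∷ l)) v ≡ 𝟙 (p v) * 𝟙 (x == v) + 𝟙 (p v) * mult l v
    step true  eq rewrite eq = cong₂ _+_ (trans (sym (*-identityˡ _)) (sym (absorb-𝟙 true eq))) rec
    step false eq rewrite eq = trans rec (cong (_+ 𝟙 (p v) * mult l v) (sym (absorb-𝟙 false eq)))

   uncovered-spec : ∀ {ts} → Tiling A ts → ∀ v → mult A v + (mult (uncovered ts) v + mult (flat ts) v) ≡ 1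
   uncovered-spec {ts} 𝒯 v = trans (cong (λ x → mult A v + (x + mult (flat ts) v))
      (trans (mult-filter _ V v) (trans (cong (𝟙 (zeroᵇ (mult A v + mult (flat ts) v)) *_) (mult-allFin v)) (*-identityʳ _))))
      (point (mult A v) (mult (flat ts) v) (simple 𝒯 v))
    where
    point : ∀ a f → a + f ≤ 1 → a + (𝟙 (zeroᵇ (a + f)) + f) ≡ 1
    point zero    zero          _       = refl
    point zero    (suc zero)    _       = refl
    point zero    (suc (suc _)) (s≤s ())
    point (suc zero)    zero    _       = refl
    point (suc zero)    (suc _) (s≤s ())
    point (suc (suc _)) f       (s≤s ())

   almost-tiling : (∀ v → mult A v ≤ 1) → ∃ λ ts → Tiling A ts × length (uncovered ts) ≤ leftover k
   almost-tiling A≤1 = grow (suc n) [] (record { tiles = [] ; simple = λ v → ≤-trans (≤-reflexive (+-identityʳ _)) (A≤1 v) })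
                            (≤-reflexive (sym (+-identityʳ (suc n))))
    where
    grow : ∀ f ts → Tiling A ts → suc n ≤ f + length ts → ∃ λ ts → Tiling A ts × length (uncovered ts) ≤ leftover k
    grow zero    ts 𝒯 h = ⊥-elim (<⇒≱ h ts≤n)
      where
      ts≤n : length ts ≤ n
      ts≤n = begin
        length ts          ≤⟨ m≤m+n _ _ ⟩
        4 * length ts      ≡⟨ sym (length-flat ts) ⟩
        length (flat ts)   ≡⟨ trans (length-∑ (flat ts)) (∑-mult (flat ts) (λ _ → 1)) ⟩
        ∑[ v ← V ] (mult (flat ts) v * 1)
          ≤⟨ ∑-V-≤const 1 (λ v → ≤-trans (≤-reflexive (*-identityʳ _)) (≤-trans (m≤n+m _ (mult A v)) (simple 𝒯 v))) ⟩
        n * 1              ≡⟨ *-identityʳ n ⟩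
        n                  ∎
        where open ≤-Reasoning
    grow (suc f) ts 𝒯 h with length (uncovered ts) ≤? leftover k
    ... | yes le = ts , 𝒯 , le
    ... | no ¬le =
      let ts′ , 𝒯′ , lt = longer-tiling ts 𝒯 (uncovered ts) (uncovered-spec 𝒯) (≰⇒> ¬le) in
      grow f ts′ 𝒯′ (≤-trans h (≤-trans (≤-reflexive (sym (+-suc f (length ts)))) (+-monoʳ-≤ f lt)))

-- Choice of constants and the perfect tiling

chunks : ∀ {n} q (l : List (Fin n)) → length l ≡ q * 4 → ∃ λ qs → flat qs ≡ l × length qs ≡ q
chunks zero    []                      _  = [] , refl , refl
chunks (suc q) (a ∷ b ∷ c ∷ d ∷ l) eq =
  let qs , h , len = chunks q l (suc-injective (suc-injective (suc-injective (suc-injective eq)))) in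
  (a , b , c , d) ∷ qs , cong (λ l → a ∷ b ∷ c ∷ d ∷ l) h , cong suc len

module Assembly (k : ℕ) (60≤k : 60 ≤ k) where

  E : ℕ
  E = k * k * k * k * k * k * k

  h c m C₀ : ℕ
  h  = level-h (1 + 2 * E)
  c  = level-c k E (1 + 2 * E)
  m  = 4 + ((3 + 4 * h + (3 + 4 * h)) + (3 + 4 * h + (3 + 4 * h)))
  C₀ = 2 * k * (1 * (c * c) * (1 * (c * c)))

  picks-bound : ∃ λ n₀ → ∀ n → n₀ ≤ n → ∃ λ J →
    (C₀ + suc C₀) ^ J * n ^ 4 < suc (C₀ + suc C₀) ^ J
    × 2 * suc C₀ * (m * (4 * (leftover k * (J * m) + 0 + m))) < n × 3 * k * (leftover k * (J * m)) ≤ n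
  picks-bound = few-picks (suc C₀) (C₀ + suc C₀) m (leftover k) (3 * k) (≤-trans (s≤s z≤n) (m≤n+m (suc C₀) C₀))

  -- The bound `6 * k ≤ n` yields `6 ≤ g`, since `n ≤ k * g`.
  order : ℕ
  order = proj₁ picks-bound ⊔ 6 * k

  module _ {n : ℕ} (e : Fin n → Fin n → Fin n → Bool)
    (sym₁₂ : ∀ x y z → e x y z ≡ e y x z) (sym₂₃ : ∀ x y z → e x y z ≡ e x z y)
    (irr : ∀ x z → e x x z ≡ false)
    (D g : ℕ) (codeg : ∀ x y → x ≢ y → D ≤ ∑[ z ← Tiles.V e ] 𝟙 (e x y z))
    (half : n + 2 * g ≤ 2 * D) (dense : n ≤ k * g) (D≤n : D ≤ n) (order≤n : order ≤ n) (4∣n : 4 ∣ n) where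

    private
      0<k : 0 < k
      0<k = ≤-trans (s≤s z≤n) 60≤k
      6k≤n : 6 * k ≤ n
      6k≤n = ≤-trans (m≤n⊔m (proj₁ picks-bound) (6 * k)) order≤n
      2≤n : 2 ≤ n
      2≤n = ≤-trans (*-mono-≤ (m≤m+n 2 4) 0<k) 6k≤n
      6≤g : 6 ≤ g
      6≤g = *-cancelˡ-≤ k {{>-nonZero 0<k}} (≤-trans (≤-reflexive (*-comm k 6)) (≤-trans 6k≤n dense))
      0<g : 0 < g
      0<g = ≤-trans (s≤s z≤n) 6≤g

    open Codegree e sym₁₂ sym₂₃ irr D g k codeg half dense 2≤n
    open Closure e sym₁₂ sym₂₃ irr D g k codeg half dense 2≤n E D≤n 6≤g 60≤k ≤-refl using (reach-all)
    open Absorbers e (2 * k) h c many-tiles reach-all hiding (C₀; size)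
    open Improve e sym₁₂ sym₂₃ irr D g k codeg half dense 2≤n D≤n 0<k
    open Enlarging e sym₁₂ sym₂₃ irr D g k codeg half dense 2≤n D≤n 0<k 0<g

    private
      tiled-length : ∀ {s} → Tiled s → 4 ∣ length s
      tiled-length []          = divides 0 refl
      tiled-length (tile∷ _ p) with tiled-length p
      ... | divides q eq = divides (suc q) (cong (4 +_) eq)

      Fac-length : ∀ {l} → Fac l → 4 ∣ length l
      Fac-length {l} (s , p , eq) = subst (4 ∣_) (length-mult s l eq) (tiled-length p)

      flat-tiled : ∀ {ts} → All IsTile ts → Tiled (flat ts)
      flat-tiled []       = []
      flat-tiled (p ∷ ps) = tile∷ p (flat-tiled ps)

      reps-id : ∀ (s : List (Fin n)) → reps id s ≡ s
      reps-id []      = refl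
      reps-id (x ∷ s) = cong (x ∷_) (reps-id s)

    perfect-tiling : Fac V
    perfect-tiling = with-picks (proj₂ picks-bound n (≤-trans (m≤m⊔n (proj₁ picks-bound) (6 * k)) order≤n))
      where
      with-picks : _ → Fac V
      with-picks (J , big , fits , few) = with-families (families J big (leftover k) [] fits)
        where
        with-families : _ → Fac V
        with-families (fs , length-fs , few-fs , spread) = with-tiling (almost-tiling A few-A A≤1)
          where
          A = total fs
          A≤1 : ∀ v → mult A v ≤ 1
          A≤1 v = subst (λ l → mult l v ≤ 1) (reps-id A) (distinct spread v)
          few-A : 3 * k * length A ≤ n
          few-A = ≤-trans ((3 * k) ⊙ few-fs) few
          with-tiling : _ → Fac V
          with-tiling (ts , 𝒯 , few-left) = conclude (chunks (_∣_.quotient 4∣L) L (_∣_.equality 4∣L))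
            where
            L = uncovered A few-A ts
            spec : ∀ v → mult A v + (mult L v + mult (flat ts) v) ≡ 1
            spec = uncovered-spec A few-A 𝒯
            parts : length (flat ts ++ A) + length L ≡ n
            parts = trans (cong (_+ length L) (length-++ (flat ts))) (trans (eq (length (flat ts)) (length A) (length L))
              (trans (sym (trans (length-++ A) (cong (length A +_) (length-++ L))))
                (trans (length-mult (A ++ L ++ flat ts) V (λ v → trans (mult-++ A (L ++ flat ts) v)
                  (trans (cong (mult A v +_) (mult-++ L (flat ts) v)) (trans (spec v) (sym (mult-allFin v)))))) length-V)))
              where
              eq : ∀ f a l → f + a + l ≡ a + (l + f)
              eq = solve-∀
            -- `A` is a union of tiles by itself (`absorb-all` without any 4-set), so the number of
            -- covered vertices is divisible by 4.
            4∣L : 4 ∣ length L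
            4∣L = ∣m+n∣m⇒∣n (subst (4 ∣_) (sym parts) 4∣n)
              (Fac-length {flat ts ++ A} (Fac-++ {flat ts} {A} (flat ts , flat-tiled (tiles 𝒯) , λ _ → refl) (absorb-all fs [] z≤n)))
            conclude : (∃ λ qs → flat qs ≡ L × length qs ≡ _∣_.quotient 4∣L) → Fac V
            conclude (qs , flat≡ , _) = Fac-resp ((flat qs ++ A) ++ flat ts) V eqv
              (Fac-++ {flat qs ++ A} {flat ts} (absorb-all fs qs qs-few) (flat ts , flat-tiled (tiles 𝒯) , λ _ → refl))
              where
              qs-few : length qs ≤ length fs
              qs-few = begin
                length qs        ≤⟨ m≤m+n (length qs) _ ⟩
                4 * length qs    ≡⟨ sym (length-flat qs) ⟩
                length (flat qs) ≡⟨ cong length flat≡ ⟩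
                length L         ≤⟨ few-left ⟩
                leftover k       ≡⟨ sym length-fs ⟩
                length fs        ∎
                where open ≤-Reasoning
              eq : ∀ l a f → l + a + f ≡ a + (l + f)
              eq = solve-∀
              eqv : ∀ v → mult ((flat qs ++ A) ++ flat ts) v ≡ mult V v
              eqv v = trans (mult-++ (flat qs ++ A) (flat ts) v) (trans (cong (_+ mult (flat ts) v)
                (trans (mult-++ (flat qs) A v) (cong (λ l → mult l v + mult A v) flat≡)))
                (trans (eq (mult L v) (mult A v) (mult (flat ts) v)) (trans (spec v) (sym (mult-allFin v)))))

open import Defs
open import Data.Bool using (T)
open import Data.Bool.Properties using (T?)
open import Data.Fin.Subset as Subset using (Subset; ∣_∣; _∪_; ⁅_⁆; inside; outside)
open import Data.Fin.Subset.Properties as Subset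
  using (∪-comm; ∪-assoc; x∈p∪q⁻; x∈p∪q⁺; x∈⁅x⁆; x∈⁅y⁆⇒x≡y; ⊆-antisym; _∈?_; anySubset?; ∣⁅x⁆∣≡1;
    p⊆q⇒∣p∣≤∣q∣)
import Data.Integer.Properties as ℤ
open import Data.List using (lookup; filter)
open import Data.List.Extrema.Nat using (min; min≤xs)
open import Data.List.Membership.Propositional.Properties using (∈-filter⁺; ∈-map⁺; ∈-lookup)
open import Data.List.Properties using (map-cong)
open import Data.Rational as ℚ using (ℚ; mkℚ; 0ℚ; 1ℚ; ½)
import Data.Rational.Properties as ℚ
open import Data.Rational.Unnormalised as ℚᵘ using (mkℚᵘ)
import Data.Rational.Unnormalised.Properties as ℚᵘ
open import Data.Unit using (tt)
import Data.Vec as Vec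
import Data.Vec.Properties as Vec
open import Relation.Nullary using (¬?)
open import Relation.Nullary.Decidable using (decidable-stable)

-- 3-graphs as ternary relations

T-true : ∀ {b} → T b → b ≡ true
T-true {true} _ = refl

true-T : ∀ {b} → b ≡ true → T b
true-T refl = tt

card-∪ : ∀ {n} (p q : Subset n) → ∣ p ∪ q ∣ ≤ ∣ p ∣ + ∣ q ∣
card-∪ Vec.[]            Vec.[]            = z≤n
card-∪ (inside  Vec.∷ p) (inside  Vec.∷ q) = s≤s (≤-trans (card-∪ p q) (+-monoʳ-≤ ∣ p ∣ (n≤1+n ∣ q ∣)))
card-∪ (inside  Vec.∷ p) (outside Vec.∷ q) = s≤s (card-∪ p q)
card-∪ (outside Vec.∷ p) (inside  Vec.∷ q) = ≤-trans (s≤s (card-∪ p q)) (≤-reflexive (sym (+-suc ∣ p ∣ ∣ q ∣)))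
card-∪ (outside Vec.∷ p) (outside Vec.∷ q) = card-∪ p q

card-tabulate : ∀ {n} (f : Fin n → Bool) → ∣ Vec.tabulate f ∣ ≡ ∑[ v ← allFin n ] 𝟙 (f v)
card-tabulate {zero}  f = refl
card-tabulate {suc n} f = trans (head (f zero)) (sym (∑-allFin-suc n (λ v → 𝟙 (f v))))
  where
  head : ∀ b → ∣ b Vec.∷ Vec.tabulate (f ∘ suc) ∣ ≡ 𝟙 b + ∑[ v ← allFin n ] 𝟙 (f (suc v))
  head true  = cong suc (card-tabulate (f ∘ suc))
  head false = card-tabulate (f ∘ suc)

module Relation {n : ℕ} (H : 3Graph n) where

  e : Fin n → Fin n → Fin n → Bool
  e x y z = edge H ((⁅ x ⁆ ∪ ⁅ y ⁆) ∪ ⁅ z ⁆)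

  sym₁₂ : ∀ x y z → e x y z ≡ e y x z
  sym₁₂ x y z = cong (λ s → edge H (s ∪ ⁅ z ⁆)) (∪-comm ⁅ x ⁆ ⁅ y ⁆)

  sym₂₃ : ∀ x y z → e x y z ≡ e x z y
  sym₂₃ x y z = cong (edge H) (trans (∪-assoc ⁅ x ⁆ ⁅ y ⁆ ⁅ z ⁆)
    (trans (cong (⁅ x ⁆ ∪_) (∪-comm ⁅ y ⁆ ⁅ z ⁆)) (sym (∪-assoc ⁅ x ⁆ ⁅ z ⁆ ⁅ y ⁆))))

  irr : ∀ x z → e x x z ≡ false
  irr x z with e x x z in eq
  ... | false = refl
  ... | true  = ⊥-elim (<⇒≱ (n<1+n 2) (≤-trans (≤-reflexive (sym (uniform H _ (true-T eq)))) small))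
    where
    collapse : ((⁅ x ⁆ ∪ ⁅ x ⁆) ∪ ⁅ z ⁆) Subset.⊆ (⁅ x ⁆ ∪ ⁅ z ⁆)
    collapse h with x∈p∪q⁻ (⁅ x ⁆ ∪ ⁅ x ⁆) ⁅ z ⁆ h
    ... | inj₂ hz = x∈p∪q⁺ (inj₂ hz)
    ... | inj₁ hx with x∈p∪q⁻ ⁅ x ⁆ ⁅ x ⁆ hx
    ...   | inj₁ h′ = x∈p∪q⁺ (inj₁ h′)
    ...   | inj₂ h′ = x∈p∪q⁺ (inj₁ h′)
    small : ∣ (⁅ x ⁆ ∪ ⁅ x ⁆) ∪ ⁅ z ⁆ ∣ ≤ 2
    small = ≤-trans (p⊆q⇒∣p∣≤∣q∣ collapse) (≤-trans (card-∪ ⁅ x ⁆ ⁅ z ⁆) (≤-reflexive (cong₂ _+_ (∣⁅x⁆∣≡1 x) (∣⁅x⁆∣≡1 z))))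

  codegree : ∀ x y → x ≢ y → δ₂ H ≤ ∑[ z ← allFin n ] 𝟙 (e x y z)
  codegree x y x≢y = ≤-trans
    (All.lookup (min≤xs n _) (∈-map⁺ (λ (u , v) → deg H (⁅ u ⁆ ∪ ⁅ v ⁆))
      (∈-filter⁺ (λ (u , v) → ¬? (u Fin.≟ v)) (∈-cartesianProduct⁺ (∈-allFin x) (∈-allFin y)) x≢y)))
    (≤-reflexive (card-tabulate (e x y)))

-- Images of subsets

∈-image⁻ : ∀ {m n} (f : Fin m → Fin n) s {w} → w Subset.∈ image f s → ∃ λ u → u Subset.∈ s × f u ≡ w
∈-image⁻ f s {w} h = does-sound (Fin.any? λ u → (u ∈? s) ×-dec (f u Fin.≟ w))
  (trans (sym (Vec.lookup∘tabulate _ w)) (Vec.[]=⇒lookup h))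

∈-image⁺ : ∀ {m n} (f : Fin m → Fin n) s {u} → u Subset.∈ s → f u Subset.∈ image f s
∈-image⁺ f s {u} h = Vec.lookup⇒[]= (f u) (image f s)
  (trans (Vec.lookup∘tabulate _ (f u)) (dec-true (Fin.any? λ v → (v ∈? s) ×-dec (f v Fin.≟ f u)) (u , h , refl)))

image-triple : ∀ {m n} (f : Fin m → Fin n) s i j k → i Subset.∈ s → j Subset.∈ s → k Subset.∈ s →
               (∀ u → u Subset.∈ s → u ≡ i ⊎ u ≡ j ⊎ u ≡ k) → image f s ≡ (⁅ f i ⁆ ∪ ⁅ f j ⁆) ∪ ⁅ f k ⁆
image-triple f s i j k hi hj hk only = ⊆-antisym to from
  where
  to : image f s Subset.⊆ ((⁅ f i ⁆ ∪ ⁅ f j ⁆) ∪ ⁅ f k ⁆)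
  to h with ∈-image⁻ f s h
  ... | u , hu , refl with only u hu
  ...   | inj₁ refl        = x∈p∪q⁺ (inj₁ (x∈p∪q⁺ (inj₁ (x∈⁅x⁆ (f i)))))
  ...   | inj₂ (inj₁ refl) = x∈p∪q⁺ (inj₁ (x∈p∪q⁺ (inj₂ (x∈⁅x⁆ (f j)))))
  ...   | inj₂ (inj₂ refl) = x∈p∪q⁺ (inj₂ (x∈⁅x⁆ (f k)))
  from : ((⁅ f i ⁆ ∪ ⁅ f j ⁆) ∪ ⁅ f k ⁆) Subset.⊆ image f s
  from h with x∈p∪q⁻ (⁅ f i ⁆ ∪ ⁅ f j ⁆) ⁅ f k ⁆ h
  ... | inj₂ h′ = subst (Subset._∈ image f s) (sym (x∈⁅y⁆⇒x≡y (f k) h′)) (∈-image⁺ f s hk)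
  ... | inj₁ h′ with x∈p∪q⁻ ⁅ f i ⁆ ⁅ f j ⁆ h′
  ...   | inj₁ h″ = subst (Subset._∈ image f s) (sym (x∈⁅y⁆⇒x≡y (f i) h″)) (∈-image⁺ f s hi)
  ...   | inj₂ h″ = subst (Subset._∈ image f s) (sym (x∈⁅y⁆⇒x≡y (f j) h″)) (∈-image⁺ f s hj)

pattern 0F = zero
pattern 1F = suc zero
pattern 2F = suc (suc zero)
pattern 3F = suc (suc (suc zero))

s₀₁₂ s₀₁₃ s₀₂₃ : Subset 4
s₀₁₂ = inside Vec.∷ inside Vec.∷ inside Vec.∷ outside Vec.∷ Vec.[]
s₀₁₃ = inside Vec.∷ inside Vec.∷ outside Vec.∷ inside Vec.∷ Vec.[]
s₀₂₃ = inside Vec.∷ outside Vec.∷ inside Vec.∷ inside Vec.∷ Vec.[]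

module _ {n : ℕ} (f : Fin 4 → Fin n) where

  image₀₁₂ : image f s₀₁₂ ≡ (⁅ f 0F ⁆ ∪ ⁅ f 1F ⁆) ∪ ⁅ f 2F ⁆
  image₀₁₂ = image-triple f s₀₁₂ 0F 1F 2F Vec.here (Vec.there Vec.here) (Vec.there (Vec.there Vec.here)) λ where
    0F _ → inj₁ refl
    1F _ → inj₂ (inj₁ refl)
    2F _ → inj₂ (inj₂ refl)
    3F (Vec.there (Vec.there (Vec.there ())))

  image₀₁₃ : image f s₀₁₃ ≡ (⁅ f 0F ⁆ ∪ ⁅ f 1F ⁆) ∪ ⁅ f 3F ⁆
  image₀₁₃ = image-triple f s₀₁₃ 0F 1F 3F Vec.here (Vec.there Vec.here) (Vec.there (Vec.there (Vec.there Vec.here))) λ where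
    0F _ → inj₁ refl
    1F _ → inj₂ (inj₁ refl)
    2F (Vec.there (Vec.there ()))
    3F _ → inj₂ (inj₂ refl)

  image₀₂₃ : image f s₀₂₃ ≡ (⁅ f 0F ⁆ ∪ ⁅ f 2F ⁆) ∪ ⁅ f 3F ⁆
  image₀₂₃ = image-triple f s₀₂₃ 0F 2F 3F Vec.here (Vec.there (Vec.there Vec.here)) (Vec.there (Vec.there (Vec.there Vec.here))) λ where
    0F _ → inj₁ refl
    1F (Vec.there ())
    2F _ → inj₂ (inj₁ refl)
    3F _ → inj₂ (inj₂ refl)

-- Factors and perfect tilings

pos : ∀ {n} → Quad n → Fin 4 → Fin n
pos (a , b , c , d) 0F = a
pos (a , b , c , d) 1F = b
pos (a , b , c , d) 2F = c
pos (a , b , c , d) 3F = d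

pos-verts : ∀ {n} (q : Quad n) u → 1 ≤ mult (verts q) (pos q u)
pos-verts q@(a , b , c , d) u = ∈⇒mult (at u)
  where
  at : ∀ u → pos q u ∈ verts q
  at 0F = here refl
  at 1F = there (here refl)
  at 2F = there (there (here refl))
  at 3F = there (there (there (here refl)))

verts-pos : ∀ {n} (q : Quad n) {w} → 1 ≤ mult (verts q) w → ∃ λ u → pos q u ≡ w
verts-pos q@(a , b , c , d) h with mult⇒∈ (verts q) h
... | here refl                         = 0F , refl
... | there (here refl)                 = 1F , refl
... | there (there (here refl))         = 2F , refl
... | there (there (there (here refl))) = 3F , refl

same-index : ∀ {n} (qs : List (Quad n)) {w} → Simple qs → ∀ i j →
             1 ≤ mult (verts (lookup qs i)) w → 1 ≤ mult (verts (lookup qs j)) w → i ≡ j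
same-index (q ∷ qs) s zero    zero    _ _ = refl
same-index (q ∷ qs) s zero    (suc j) h h′ = ⊥-elim (exclusive {q = q} {qs} s h (≤-trans h′ (mult-verts≤flat (∈-lookup {xs = qs} j))))
same-index (q ∷ qs) s (suc i) zero    h h′ = ⊥-elim (exclusive {q = q} {qs} s h′ (≤-trans h (mult-verts≤flat (∈-lookup {xs = qs} i))))
same-index (q ∷ qs) s (suc i) (suc j) h h′ = cong suc (same-index qs (simple-tail {q = q} {qs} s) i j h h′)

module _ {n : ℕ} (H : 3Graph n) where

  open Relation H
  open Tiles e

  Star : Quad n → Set
  Star (a , b , c , d) = e a b c ≡ true × e a b d ≡ true × e a c d ≡ true

  -- Three of the four triples of a 4-set have exactly one common vertex. It is moved to the front,
  -- where `K₄³-e` has the vertex common to its edges.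
  stars : ∀ {s} → Tiled s → ∃ λ qs → All Star qs × (∀ v → mult (flat qs) v ≡ mult s v)
  stars []                              = [] , [] , λ _ → refl
  stars (tile∷ {a} {b} {c} {d} {s} h p) = choose (e a b c) (e a b d) (e a c d) (e b c d) refl refl refl refl h
    where
    rec = stars p
    qs = proj₁ rec
    same = proj₂ (proj₂ rec)
    put : ∀ q → Star q → (∀ v → mult (verts q) v ≡ mult (a ∷ b ∷ c ∷ d ∷ []) v) →
          ∃ λ qs → All Star qs × (∀ v → mult (flat qs) v ≡ mult (a ∷ b ∷ c ∷ d ∷ s) v)
    put q star eq = q ∷ qs , star ∷ proj₁ (proj₂ rec) , λ v →
      trans (mult-flat-∷ q qs v) (trans (cong₂ _+_ (eq v) (same v)) (sym (∑-++ (a ∷ b ∷ c ∷ d ∷ []) s (λ u → 𝟙 (u == v)))))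
    eqb : ∀ a b c d → b + (a + (c + (d + 0))) ≡ a + (b + (c + (d + 0)))
    eqb = solve-∀
    eqc : ∀ a b c d → c + (a + (b + (d + 0))) ≡ a + (b + (c + (d + 0)))
    eqc = solve-∀
    eqd : ∀ a b c d → d + (a + (b + (c + 0))) ≡ a + (b + (c + (d + 0)))
    eqd = solve-∀
    choose : ∀ w x y z → e a b c ≡ w → e a b d ≡ x → e a c d ≡ y → e b c d ≡ z → at-least-3 w x y z ≡ true →
             ∃ λ qs → All Star qs × (∀ v → mult (flat qs) v ≡ mult (a ∷ b ∷ c ∷ d ∷ s) v)
    choose true true true  z    w₁ x₁ y₁ z₁ _ = put (a , b , c , d) (w₁ , x₁ , y₁) (λ _ → refl)
    choose true true false true w₁ x₁ y₁ z₁ _ =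
      put (b , a , c , d) (trans (sym₁₂ b a c) w₁ , trans (sym₁₂ b a d) x₁ , z₁)
          (λ v → eqb (𝟙 (a == v)) (𝟙 (b == v)) (𝟙 (c == v)) (𝟙 (d == v)))
    choose true false true true w₁ x₁ y₁ z₁ _ =
      put (c , a , b , d) (trans (trans (sym₁₂ c a b) (sym₂₃ a c b)) w₁ , trans (sym₁₂ c a d) y₁ , trans (sym₁₂ c b d) z₁)
          (λ v → eqc (𝟙 (a == v)) (𝟙 (b == v)) (𝟙 (c == v)) (𝟙 (d == v)))
    choose false true true true w₁ x₁ y₁ z₁ _ =
      put (d , a , b , c) (trans (trans (sym₁₂ d a b) (sym₂₃ a d b)) x₁ , trans (trans (sym₁₂ d a c) (sym₂₃ a d c)) y₁ ,
                           trans (trans (sym₁₂ d b c) (sym₂₃ b d c)) z₁)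
          (λ v → eqd (𝟙 (a == v)) (𝟙 (b == v)) (𝟙 (c == v)) (𝟙 (d == v)))

  distinct₁₂ : ∀ {x y z} → e x y z ≡ true → x ≢ y
  distinct₁₂ {x} {.x} {z} h refl with trans (sym h) (irr x z)
  ... | ()

  distinct₂₃ : ∀ {x y z} → e x y z ≡ true → y ≢ z
  distinct₂₃ {x} {y} {z} h = distinct₁₂ (trans (sym (trans (sym₁₂ x y z) (sym₂₃ y x z))) h)

  distinct₁₃ : ∀ {x y z} → e x y z ≡ true → x ≢ z
  distinct₁₃ {x} {y} {z} h = distinct₁₂ (trans (sym (sym₂₃ x y z)) h)

  star-copy : ∀ q → Star q → Copy K₄³-e H
  star-copy q@(a , b , c , d) (abc , abd , acd) = record
    { vertex = pos q ; injective = λ {u} {v} → inj u v ; preserves = pres }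
    where
    inj : ∀ u v → pos q u ≡ pos q v → u ≡ v
    inj 0F 0F _ = refl
    inj 1F 1F _ = refl
    inj 2F 2F _ = refl
    inj 3F 3F _ = refl
    inj 0F 1F p = ⊥-elim (distinct₁₂ abc p)
    inj 0F 2F p = ⊥-elim (distinct₁₃ abc p)
    inj 0F 3F p = ⊥-elim (distinct₁₃ abd p)
    inj 1F 0F p = ⊥-elim (distinct₁₂ abc (sym p))
    inj 1F 2F p = ⊥-elim (distinct₂₃ abc p)
    inj 1F 3F p = ⊥-elim (distinct₂₃ abd p)
    inj 2F 0F p = ⊥-elim (distinct₁₃ abc (sym p))
    inj 2F 1F p = ⊥-elim (distinct₂₃ abc (sym p))
    inj 2F 3F p = ⊥-elim (distinct₂₃ acd p)
    inj 3F 0F p = ⊥-elim (distinct₁₃ abd (sym p))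
    inj 3F 1F p = ⊥-elim (distinct₂₃ abd (sym p))
    inj 3F 2F p = ⊥-elim (distinct₂₃ acd (sym p))
    pres : ∀ s → T (edge K₄³-e s) → T (edge H (image (pos q) s))
    pres (inside Vec.∷ inside  Vec.∷ inside  Vec.∷ outside Vec.∷ Vec.[]) _ = subst (T ∘ edge H) (sym (image₀₁₂ (pos q))) (true-T abc)
    pres (inside Vec.∷ inside  Vec.∷ outside Vec.∷ inside  Vec.∷ Vec.[]) _ = subst (T ∘ edge H) (sym (image₀₁₃ (pos q))) (true-T abd)
    pres (inside Vec.∷ outside Vec.∷ inside  Vec.∷ inside  Vec.∷ Vec.[]) _ = subst (T ∘ edge H) (sym (image₀₂₃ (pos q))) (true-T acd)
    pres (inside Vec.∷ inside  Vec.∷ inside  Vec.∷ inside  Vec.∷ Vec.[]) ()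
    pres (inside Vec.∷ inside  Vec.∷ outside Vec.∷ outside Vec.∷ Vec.[]) ()
    pres (inside Vec.∷ outside Vec.∷ inside  Vec.∷ outside Vec.∷ Vec.[]) ()
    pres (inside Vec.∷ outside Vec.∷ outside Vec.∷ inside  Vec.∷ Vec.[]) ()
    pres (inside Vec.∷ outside Vec.∷ outside Vec.∷ outside Vec.∷ Vec.[]) ()
    pres (outside Vec.∷ _) ()

  Fac⇒Factor : Fac V → Factor K₄³-e H
  Fac⇒Factor (s , p , eq) = build (stars p)
    where
    build : (∃ λ qs → All Star qs × (∀ v → mult (flat qs) v ≡ mult s v)) → Factor K₄³-e H
    build (qs , all , same) = record
      { size = length qs
      ; copy = λ i → star-copy (lookup qs i) (All.lookup all (∈-lookup {xs = qs} i))
      ; disjoint = λ i j u v h → same-index qs simple-qs i j (pos-verts (lookup qs i) u)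
          (subst (λ w → 1 ≤ mult (verts (lookup qs j)) w) (sym h) (pos-verts (lookup qs j) v))
      ; spanning = span }
      where
      exactly : ∀ v → mult (flat qs) v ≡ 1
      exactly v = trans (same v) (trans (eq v) (mult-allFin v))
      simple-qs : Simple qs
      simple-qs v = ≤-reflexive (exactly v)
      find-index : ∀ {q} (qs : List (Quad n)) → q ∈ qs → ∃ λ i → lookup qs i ≡ q
      find-index (q ∷ qs) (here refl) = zero , refl
      find-index (q ∷ qs) (there h)   = let i , eq = find-index qs h in suc i , eq
      span : ∀ w → ∃ λ i → ∃ λ u → pos (lookup qs i) u ≡ w
      span w with covering qs (≤-reflexive (sym (exactly w)))
      ... | q , q∈ , h with find-index qs q∈
      ...   | i , refl = i , verts-pos (lookup qs i) h

  -- The converse makes the existence of a factor decidable through `fac?`, on which the search for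
  -- the threshold rests.
  Factor⇒Fac : Factor K₄³-e H → Fac V
  Factor⇒Fac 𝓕 = flat (map quad (allFin size)) , tiled (allFin size) , λ v → trans (exactly v) (sym (mult-allFin v))
    where
    open Factor 𝓕
    f : Fin size → Fin 4 → Fin n
    f i = vertex (copy i)
    quad : Fin size → Quad n
    quad i = f i 0F , f i 1F , f i 2F , f i 3F
    edge-of : ∀ i s {x y z} → image (f i) s ≡ (⁅ x ⁆ ∪ ⁅ y ⁆) ∪ ⁅ z ⁆ → T (edge K₄³-e s) → e x y z ≡ true
    edge-of i s eq h = T-true (subst (T ∘ edge H) eq (preserves (copy i) s h))
    is-tile : ∀ i → tile (f i 0F) (f i 1F) (f i 2F) (f i 3F) ≡ true
    is-tile i = at-least-3-∧₁₂₃ (e (f i 1F) (f i 2F) (f i 3F)) (edge-of i s₀₁₂ (image₀₁₂ (f i)) tt)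
                    (edge-of i s₀₁₃ (image₀₁₃ (f i)) tt) (edge-of i s₀₂₃ (image₀₂₃ (f i)) tt)
    tiled : ∀ is → Tiled (flat (map quad is))
    tiled []       = []
    tiled (i ∷ is) = tile∷ (is-tile i) (tiled is)
    exactly : ∀ v → mult (flat (map quad (allFin size))) v ≡ 1
    exactly v with spanning v
    ... | i₀ , u₀ , refl = begin
      mult (flat (map quad (allFin size))) v
        ≡⟨ trans (flat-∑ (map quad (allFin size)) (λ u → 𝟙 (u == v))) (∑-map quad (allFin size) (λ q → ∑ (verts q) (λ u → 𝟙 (u == v)))) ⟩
      ∑[ i ← allFin size ] ∑[ u ← allFin 4 ] 𝟙 (f i u == v)
        ≡⟨ ∑-cong (allFin size) (λ i → trans (∑-cong (allFin 4) (λ u → only i u)) (∑-*ˡ (𝟙 (i₀ == i)) (allFin 4) (λ u → 𝟙 (u₀ == u) * 1))) ⟩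
      ∑[ i ← allFin size ] (𝟙 (i₀ == i) * ∑[ u ← allFin 4 ] (𝟙 (u₀ == u) * 1))
        ≡⟨ trans (∑-delta i₀ (λ _ → ∑[ u ← allFin 4 ] (𝟙 (u₀ == u) * 1))) (∑-delta u₀ (λ _ → 1)) ⟩
      1 ∎
      where
      open ≡-Reasoning
      only : ∀ i u → 𝟙 (f i u == f i₀ u₀) ≡ 𝟙 (i₀ == i) * (𝟙 (u₀ == u) * 1)
      only i u with f i u Fin.≟ f i₀ u₀ | i₀ Fin.≟ i | u₀ Fin.≟ u
      ... | yes p | yes refl | yes refl = refl
      ... | yes p | yes refl | no ¬q    = ⊥-elim (¬q (sym (injective (copy i) p)))
      ... | yes p | no ¬q    | _        = ⊥-elim (¬q (sym (disjoint i i₀ u u₀ p)))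
      ... | no ¬p | yes refl | yes refl = ⊥-elim (¬p refl)
      ... | no ¬p | yes refl | no _     = refl
      ... | no ¬p | no _     | _        = refl

  factor? : Dec (Factor K₄³-e H)
  factor? = map′ Fac⇒Factor Factor⇒Fac (fac? V)

-- Deciding ForcesFactor

-- Induction on `n`: a function on the subsets of `n + 1` points is a pair of functions on the
-- subsets of `n` points. It is recovered from the pair only up to pointwise equality, which `P`
-- must therefore respect.
all-edge-functions? : ∀ n (P : (Subset n → Bool) → Set) → (∀ f g → (∀ s → f s ≡ g s) → P f → P g) →
                      (∀ f → Dec (P f)) → Dec (∀ f → P f)
all-edge-functions? zero P resp P? with P? (λ _ → true) | P? (λ _ → false)
... | no ¬p | _     = no λ p → ¬p (p _)
... | yes _ | no ¬p = no λ p → ¬p (p _)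
... | yes p | yes q = yes λ f → by-value f (f Vec.[]) refl
  where
  by-value : ∀ f b → f Vec.[] ≡ b → P f
  by-value f true  h = resp (λ _ → true) f (λ { Vec.[] → sym h }) p
  by-value f false h = resp (λ _ → false) f (λ { Vec.[] → sym h }) q
all-edge-functions? (suc n) P resp P? = map′
  (λ h f → resp (glue (λ s → f (inside Vec.∷ s)) (λ s → f (outside Vec.∷ s))) f (unglue f) (h _ _))
  (λ h g g′ → h (glue g g′))
  (all-edge-functions? n (λ g → ∀ g′ → P (glue g g′))
    (λ f g f≗g h g′ → resp (glue f g′) (glue g g′) (λ { (inside Vec.∷ s) → f≗g s ; (outside Vec.∷ s) → refl }) (h g′))
    (λ g → all-edge-functions? n (λ g′ → P (glue g g′))
      (λ f f′ f≗f′ → resp (glue g f) (glue g f′) (λ { (inside Vec.∷ s) → refl ; (outside Vec.∷ s) → f≗f′ s }))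
      (λ g′ → P? (glue g g′))))
  where
  glue : (Subset n → Bool) → (Subset n → Bool) → Subset (suc n) → Bool
  glue g g′ (inside  Vec.∷ s) = g s
  glue g g′ (outside Vec.∷ s) = g′ s
  unglue : ∀ f s → glue (λ s → f (inside Vec.∷ s)) (λ s → f (outside Vec.∷ s)) s ≡ f s
  unglue f (inside  Vec.∷ s) = refl
  unglue f (outside Vec.∷ s) = refl

Factor-resp : ∀ {m n} {F : 3Graph m} {H H′ : 3Graph n} → (∀ s → edge H s ≡ edge H′ s) → Factor F H → Factor F H′
Factor-resp same 𝓕 = record
  { size = Factor.size 𝓕
  ; copy = λ i → let c = Factor.copy 𝓕 i in record
      { vertex = vertex c ; injective = injective c
      ; preserves = λ s h → subst T (same (image (vertex c) s)) (preserves c s h) }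
  ; disjoint = Factor.disjoint 𝓕
  ; spanning = Factor.spanning 𝓕 }

δ₂-cong : ∀ {n} (H H′ : 3Graph n) → (∀ s → edge H s ≡ edge H′ s) → δ₂ H ≡ δ₂ H′
δ₂-cong {n} H H′ same = cong (min n) (map-cong
  (λ (u , v) → cong ∣_∣ (Vec.tabulate-cong (λ w → same ((⁅ u ⁆ ∪ ⁅ v ⁆) ∪ ⁅ w ⁆))))
  (filter (λ (u , v) → ¬? (u Fin.≟ v)) (cartesianProduct (allFin n) (allFin n))))

forces-factor? : ∀ n d → Dec (ForcesFactor n K₄³-e d)
forces-factor? n d = map′ (λ h H → h (edge H) (uniform H)) (λ h f u → h (record { edge = f ; uniform = u }))
  (all-edge-functions? n P P-resp P?)
  where
  Uniform : (Subset n → Bool) → Set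
  Uniform f = ∀ s → T (f s) → ∣ s ∣ ≡ 3
  P : (Subset n → Bool) → Set
  P f = ∀ (u : Uniform f) → d ≤ δ₂ (record { edge = f ; uniform = u }) → Factor K₄³-e (record { edge = f ; uniform = u })
  P-resp : ∀ f g → (∀ s → f s ≡ g s) → P f → P g
  P-resp f g f≗g h u le = Factor-resp f≗g (h u′ (≤-trans le (≤-reflexive (δ₂-cong (record { edge = g ; uniform = u }) (record { edge = f ; uniform = u′ }) (λ s → sym (f≗g s))))))
    where
    u′ : Uniform f
    u′ s t = u s (subst T (f≗g s) t)
  uniform? : ∀ f → Dec (Uniform f)
  uniform? f with anySubset? (λ s → T? (f s) ×-dec ¬? (∣ s ∣ ℕ.≟ 3))
  ... | yes (s , t , ≢3) = no λ u → ≢3 (u s t)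
  ... | no none          = yes λ s t → decidable-stable (∣ s ∣ ℕ.≟ 3) (λ ≢3 → none (s , t , ≢3))
  P? : ∀ f → Dec (P f)
  P? f with uniform? f
  ... | no ¬u = yes λ u → ⊥-elim (¬u u)
  ... | yes u with factor? (record { edge = f ; uniform = u }) | d ≤? δ₂ (record { edge = f ; uniform = u })
  ...   | yes 𝓕 | _      = yes λ u′ _ → Factor-resp (λ _ → refl) 𝓕
  ...   | no _  | no ¬le = yes λ u′ le → ⊥-elim (¬le le)
  ...   | no ¬𝓕 | yes le = no λ h → ¬𝓕 (h u le)

least : (P : ℕ → Set) → (∀ d → Dec (P d)) → ∀ D → P D → ∃ λ t → t ≤ D × P t × (∀ d → P d → t ≤ d)
least P P? D PD = search D 0 (+-identityʳ D) (λ _ ())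
  where
  search : ∀ f b → f + b ≡ D → (∀ d → d < b → ¬ P d) → ∃ λ t → t ≤ D × P t × (∀ d → P d → t ≤ d)
  search f b eq below with P? b
  ... | yes Pb = b , ≤-trans (m≤n+m b f) (≤-reflexive eq) , Pb , λ d Pd → ≮⇒≥ (λ d<b → below d d<b Pd)
  search zero    b refl below | no ¬Pb = ⊥-elim (¬Pb PD)
  search (suc f) b eq   below | no ¬Pb = search f (suc b) (trans (+-suc f b) eq) below′
    where
    below′ : ∀ d → d < suc b → ¬ P d
    below′ d d≤b with m≤n⇒m<n∨m≡n (ℕ.s≤s⁻¹ d≤b)
    ... | inj₁ d<b  = below d d<b
    ... | inj₂ refl = ¬Pb

-- Real and rational bounds

open import Data.Integer as ℤ using (+_; -[1+_])

ℕ/1 : ∀ a → ℚ.toℚᵘ (+ a ℚ./ 1) ℚᵘ.≃ mkℚᵘ (+ a) 0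
ℕ/1 a = ℚ.toℚᵘ-fromℚᵘ (mkℚᵘ (+ a) 0)

suc/1 : ∀ a → 1ℚ ℚ.+ (+ a ℚ./ 1) ≡ + suc a ℚ./ 1
suc/1 a = ℚ.toℚᵘ-injective (begin
  ℚ.toℚᵘ (1ℚ ℚ.+ (+ a ℚ./ 1))
    ≈⟨ ℚ.toℚᵘ-homo-+ 1ℚ (+ a ℚ./ 1) ⟩
  ℚ.toℚᵘ 1ℚ ℚᵘ.+ ℚ.toℚᵘ (+ a ℚ./ 1)
    ≈⟨ ℚᵘ.+-congʳ (ℚ.toℚᵘ 1ℚ) (ℕ/1 a) ⟩
  mkℚᵘ (+ 1) 0 ℚᵘ.+ mkℚᵘ (+ a) 0
    ≈⟨ ℚᵘ.*≡* (cong (λ x → (+ 1 ℤ.+ x) ℤ.* + 1) (ℤ.*-identityʳ (+ a))) ⟩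
  mkℚᵘ (+ suc a) 0
    ≈⟨ ℚᵘ.≃-sym (ℕ/1 (suc a)) ⟩
  ℚ.toℚᵘ (+ suc a ℚ./ 1) ∎)
  where open ℚᵘ.≃-Reasoning

seq-· : ∀ a x i → seq (a · x) i ≡ (+ a ℚ./ 1) ℚ.* seq x i
seq-· zero    x i = sym (ℚ.*-zeroˡ (seq x i))
seq-· (suc a) x i = begin
  seq x i ℚ.+ seq (a · x) i
    ≡⟨ cong₂ ℚ._+_ (sym (ℚ.*-identityˡ (seq x i))) (seq-· a x i) ⟩
  1ℚ ℚ.* seq x i ℚ.+ (+ a ℚ./ 1) ℚ.* seq x i
    ≡⟨ sym (ℚ.*-distribʳ-+ (seq x i) 1ℚ (+ a ℚ./ 1)) ⟩
  (1ℚ ℚ.+ (+ a ℚ./ 1)) ℚ.* seq x i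
    ≡⟨ cong (ℚ._* seq x i) (suc/1 a) ⟩
  (+ suc a ℚ./ 1) ℚ.* seq x i ∎
  where open ≡-Reasoning

fraction-bound : ∀ t n g m → 2 * t ≤ n + 2 * g → g * suc m ≤ n →
                 (+ t ℚ./ 1) ℚ.≤ (+ n ℚ./ 1) ℚ.* (½ ℚ.+ (+ 1 ℚ./ suc m))
fraction-bound t n g m h₁ h₂ = ℚ.toℚᵘ-cancel-≤ (begin
  ℚ.toℚᵘ (+ t ℚ./ 1)
    ≃⟨ ℕ/1 t ⟩
  mkℚᵘ (+ t) 0
    ≤⟨ ℚᵘ.*≤* (subst₂ ℤ._≤_ (ℤ.pos-* t _) eqʳ (ℤ.+≤+ nat)) ⟩
  mkℚᵘ (+ n) 0 ℚᵘ.* (mkℚᵘ (+ 1) 1 ℚᵘ.+ mkℚᵘ (+ 1) m)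
    ≃⟨ ℚᵘ.≃-sym (ℚᵘ.*-cong (ℕ/1 n) (ℚᵘ.≃-trans (ℚ.toℚᵘ-homo-+ ½ (+ 1 ℚ./ suc m))
         (ℚᵘ.+-congʳ (ℚ.toℚᵘ ½) (ℚ.toℚᵘ-fromℚᵘ (mkℚᵘ (+ 1) m))))) ⟩
  ℚ.toℚᵘ (+ n ℚ./ 1) ℚᵘ.* ℚ.toℚᵘ (½ ℚ.+ (+ 1 ℚ./ suc m))
    ≃⟨ ℚᵘ.≃-sym (ℚ.toℚᵘ-homo-* (+ n ℚ./ 1) (½ ℚ.+ (+ 1 ℚ./ suc m))) ⟩
  ℚ.toℚᵘ ((+ n ℚ./ 1) ℚ.* (½ ℚ.+ (+ 1 ℚ./ suc m))) ∎)
  where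
  open ℚᵘ.≤-Reasoning
  -- The inequality multiplied by the denominators, in the very form to which the unnormalised
  -- rationals compute.
  nat : t * suc (m + 1 * suc m + 0 * (m + 1 * suc m)) ≤ n * (1 * suc m + 1 * 2) * 1
  nat = lin 0 (suc m ⊙ h₁ ⊕ 2 ⊙ h₂) (eq t n g m)
    where
    eq : ∀ t n g m → n * (1 * (1 + m) + 1 * 2) * 1 + ((1 + m) * (2 * t) + 2 * (g * (1 + m)))
       ≡ t * (1 + (m + 1 * (1 + m) + 0 * (m + 1 * (1 + m)))) + ((1 + m) * (n + 2 * g) + 2 * n) + 0
    eq = solve-∀
  eqʳ : + (n * (1 * suc m + 1 * 2) * 1) ≡ + n ℤ.* (+ 1 ℤ.* + suc m ℤ.+ + 1 ℤ.* + 2) ℤ.* + 1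
  eqʳ = trans (ℤ.pos-* (n * (1 * suc m + 1 * 2)) 1) (cong (ℤ._* + 1) (ℤ.pos-* n (1 * suc m + 1 * 2)))

inverse-bound : ∀ ε → 0ℚ ℚ.< ε → ∃ λ d → ∀ m → suc d ≤ suc m → (+ 1 ℚ./ suc m) ℚ.≤ ε
inverse-bound (mkℚ -[1+ _ ] _ _) (ℚ.*<* ())
inverse-bound (mkℚ (+ zero) _ _) (ℚ.*<* (ℤ.+<+ ()))
inverse-bound ε@(mkℚ (+ suc p) d _) _ = d , λ m d≤m → ℚ.toℚᵘ-cancel-≤ (ℚᵘ.≤-trans
  (ℚᵘ.≤-reflexive (ℚ.toℚᵘ-fromℚᵘ (mkℚᵘ (+ 1) m)))
  (ℚᵘ.*≤* (subst₂ ℤ._≤_ (ℤ.pos-* 1 (suc d)) (ℤ.pos-* (suc p) (suc m))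
    (ℤ.+≤+ (≤-trans (≤-reflexive (*-identityˡ (suc d))) (≤-trans d≤m (m≤m+n (suc m) (p * suc m))))))))

-- The threshold for a rational excess

module Threshold (ε : ℚ) (m k : ℕ) (k≡ : k ≡ 2 * suc m) (60≤k : 60 ≤ k) (1/m≤ε : (+ 1 ℚ./ suc m) ℚ.≤ ε) where

  open Assembly k 60≤k using (order; perfect-tiling)

  module _ (n : ℕ) (order≤n : order ≤ n) (4∣n : 4 ∣ n) where

    g D : ℕ
    g = n / suc m
    D = _∣_.quotient 4∣n * 2 + g

    gm≤n : g * suc m ≤ n
    gm≤n = m/n*n≤m n (suc m)

    m≤n : suc m ≤ n
    m≤n = ≤-trans (≤-trans (≤-trans (m≤m+n (suc m) _) (≤-reflexive (sym k≡))) (≤-trans (m≤m+n k _) (m≤n⊔m _ (6 * k)))) order≤n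

    half : n + 2 * g ≡ 2 * D
    half = trans (cong (_+ 2 * g) (_∣_.equality 4∣n)) (eq (_∣_.quotient 4∣n) g)
      where
      eq : ∀ q g → q * 4 + 2 * g ≡ 2 * (q * 2 + g)
      eq = solve-∀

    -- Rounding `n / (m + 1)` down loses less than half of it up to the bound needed: as `g ≥ 1`, it
    -- holds that `n < (m + 1) + g (m + 1) ≤ 2 (m + 1) g`. Hence the choice `k = 2 * suc m`.
    dense : n ≤ k * g
    dense = <⇒≤ (<-≤-trans n<  (≤-trans (+-monoˡ-≤ (g * suc m) (m≤gm g refl)) (≤-reflexive (trans (eq g (suc m)) (cong (_* g) (sym k≡))))))
      where
      n< : n < suc m + g * suc m
      n< = ≤-<-trans (≤-reflexive (m≡m%n+[m/n]*n n (suc m))) (+-monoˡ-< (g * suc m) (m%n<n n (suc m)))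
      m≤gm : ∀ x → g ≡ x → suc m ≤ g * suc m
      m≤gm zero    eq = ⊥-elim (<⇒≱ n< (≤-trans (≤-reflexive (cong (λ g → suc m + g * suc m) eq)) (≤-trans (≤-reflexive (+-identityʳ (suc m))) m≤n)))
      m≤gm (suc x) eq = subst (λ g → suc m ≤ g * suc m) (sym eq) (m≤m+n (suc m) (x * suc m))
      eq : ∀ g m → g * m + g * m ≡ 2 * m * g
      eq = solve-∀

    D≤n : D ≤ n
    D≤n = *-cancelˡ-≤ 2 (≤-trans (≤-reflexive (sym half)) (lin 0 (≤-trans (≤-reflexive (*-comm 2 g)) (≤-trans (g ⊙ 2≤m) gm≤n)) (eq n g)))
      where
      2≤m : 2 ≤ suc m
      2≤m = *-cancelˡ-≤ 2 (≤-trans (m≤m+n 4 56) (≤-trans 60≤k (≤-reflexive k≡)))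
      eq : ∀ n g → 2 * n + 2 * g ≡ n + 2 * g + n + 0
      eq = solve-∀

    forces : ForcesFactor n K₄³-e D
    forces H D≤δ = Fac⇒Factor H (perfect-tiling e sym₁₂ sym₂₃ irr D g (λ x y x≢y → ≤-trans D≤δ (codegree x y x≢y))
      (≤-reflexive half) dense D≤n order≤n 4∣n)
      where open Relation H

    threshold : ∃ λ t → t ≤ D × IsThreshold n K₄³-e t
    threshold = let t , t≤D , Pt , min-t = least (ForcesFactor n K₄³-e) (forces-factor? n) D forces in t , t≤D , Pt , min-t

    threshold≤ : ∀ {t} → t ≤ D → (+ t ℚ./ 1) ℚ.≤ (+ n ℚ./ 1) ℚ.* (½ ℚ.+ ε)
    threshold≤ {t} t≤D = ℚ.≤-trans
      (fraction-bound t n g m (≤-trans (2 ⊙ t≤D) (≤-reflexive (sym half))) gm≤n)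
      (ℚ.*-monoˡ-≤-nonNeg (+ n ℚ./ 1) {{nonneg}} (ℚ.+-monoʳ-≤ ½ 1/m≤ε))
      where
      nonneg : ℚ.NonNegative (+ n ℚ./ 1)
      nonneg = ℚ.normalize-nonNeg n 1

  bounded-threshold : ∃ λ n₀ → ∀ n → n₀ ≤ n → 4 ∣ n →
                      ∃ λ t → IsThreshold n K₄³-e t × (+ t ℚ./ 1) ℚ.≤ (+ n ℚ./ 1) ℚ.* (½ ℚ.+ ε)
  bounded-threshold = order , λ n order≤n 4∣n →
    let t , t≤D , isThreshold = threshold n order≤n 4∣n in t , isThreshold , threshold≤ n order≤n 4∣n t≤D

rational-bound : ∀ ε → 0ℚ ℚ.< ε → ∃ λ n₀ → ∀ n → n₀ ≤ n → 4 ∣ n →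
                 ∃ λ t → IsThreshold n K₄³-e t × (+ t ℚ./ 1) ℚ.≤ (+ n ℚ./ 1) ℚ.* (½ ℚ.+ ε)
rational-bound ε ε>0 = with-bound (inverse-bound ε ε>0)
  where
  with-bound : (∃ λ d → ∀ m → suc d ≤ suc m → (+ 1 ℚ./ suc m) ℚ.≤ ε) → _
  -- The summand 29 ensures `k = 2 * (30 + d) ≥ 60`.
  with-bound (d , 1/m≤ε) = Threshold.bounded-threshold ε (29 + d) (2 * suc (29 + d)) refl
    (2 ⊙ m≤m+n 30 d) (1/m≤ε (29 + d) (s≤s (m≤n+m d 29)))

theorem1p2 : (γ : ℝ) → fromℚ 0ℚ <ℝ γ →
    ∃ λ (n₀ : ℕ) → (n : ℕ) → n₀ ≤ n → 4 ∣ n →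
    ∃ λ (t : ℕ) → IsThreshold n K₄³-e t × fromℕ t ≤ℝ n · (fromℚ ½ +ℝ γ)
theorem1p2 γ (ε , ε>0 , N , ε≤γ) =
  -- Positivity of `γ` supplies a rational `ε > 0` that bounds the terms of `γ` from index `N` on
  -- from below, so the bound for `ε` implies the one for `γ`.
  let n₀ , h = rational-bound ε ε>0 in n₀ , λ n n₀≤n 4∣n →
  let t , isThreshold , t≤ = h n n₀≤n 4∣n in
  t , isThreshold , λ ε′ ε′>0 → N , λ i N≤i → bound n t ε′ i ε′>0 t≤
    (subst (ℚ._≤ seq γ i) (ℚ.+-identityˡ ε) (ε≤γ i N≤i))
  where
  bound : ∀ n t ε′ i → 0ℚ ℚ.< ε′ → (+ t ℚ./ 1) ℚ.≤ (+ n ℚ./ 1) ℚ.* (½ ℚ.+ ε) → ε ℚ.≤ seq γ i →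
          (+ t ℚ./ 1) ℚ.≤ seq (n · (fromℚ ½ +ℝ γ)) i ℚ.+ ε′
  bound n t ε′ i ε′>0 h ε≤ = begin
    + t ℚ./ 1
      ≤⟨ h ⟩
    (+ n ℚ./ 1) ℚ.* (½ ℚ.+ ε)
      ≤⟨ ℚ.*-monoˡ-≤-nonNeg (+ n ℚ./ 1) {{ℚ.normalize-nonNeg n 1}} (ℚ.+-monoʳ-≤ ½ ε≤) ⟩
    (+ n ℚ./ 1) ℚ.* (½ ℚ.+ seq γ i)
      ≡⟨ sym (seq-· n (fromℚ ½ +ℝ γ) i) ⟩
    seq (n · (fromℚ ½ +ℝ γ)) i
      ≡⟨ sym (ℚ.+-identityʳ _) ⟩
    seq (n · (fromℚ ½ +ℝ γ)) i ℚ.+ 0ℚ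
      ≤⟨ ℚ.+-monoʳ-≤ (seq (n · (fromℚ ½ +ℝ γ)) i) (ℚ.<⇒≤ ε′>0) ⟩
    seq (n · (fromℚ ½ +ℝ γ)) i ℚ.+ ε′ ∎
    where open ℚ.≤-Reasoning
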